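{- Let $n$ be a positive integer and let $S=S_1\cup S_2\subseteq T_{8n}\setminus\{e\}$ be nonempty with $S=S^{ -1}$, where $S_1\subseteq\langle a\rangle\cup\langle a\rangle b^2$ and $S_2\subseteq\langle a\rangle b\cup\langle a\rangle b^3$, and suppose that $\mathrm{Cay}(T_{8n},S)$ is normal, i.e. $S$ is a union of conjugacy classes of $T_{8n}$. Then the normal Cayley graph $\mathrm{Cay}(T_{8n},S)$ is integral if and only if $S_1$ and $S_2$ satisfy the following conditions: (1) $S_1$ is one of the following sets: $\emptyset$, $[a^r]$, $[a^rb^2]$, or arbitrary finite unions of these sets, where $$[a^r]=\{a^l\in\langle a^r\rangle \mid \gcd(k,o(a^r))=1 \text{ and } l\equiv kr \pmod{2n},\ k\in\mathbb N^+\},$$ $$[a^rb^2]=\{a^lb^2\in\langle a^rb^2\rangle \mid \mathrm{lcm}(o(a^r),4)=\mathrm{lcm}(o(a^l),4),\ l\equiv r(4t+1)\pmod{2n} \text{ or } l\equiv r(4t+3)+n\pmod{2n},\ t\in\mathbb N^+\},$$ $o(a^r)=\frac{2n}{\gcd(r,2n)}$ denotes the order of the element $a^r$, and $o(a^rb^2)=\mathrm{lcm}(o(a^r),4)$; (2) $S_2$ is one of the following sets: - $\emptyset$ or $\{a^rb,a^rb^3\mid r=0,1,\dots,2n-1\}$, if $n$ is odd; - $\emptyset$, $\{a^rb,a^rb^3\mid r=0,2,\dots,2n-2\}$, $\{a^rb,a^rb^3\mid r=1,3,\dots,2n-1\}$, or $\{a^rb,a^rb^3\mid r=0,1,\dots,2n-1\}$,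 if $n$ is even.
   Context: $T_{8n}=\langle a,b\mid a^{2n}=b^8=e,\ a^n=b^4,\ b^{ -1}ab=a^{ -1}\rangle$ is a group of order $8n$ with identity $e$; its elements are $a^r b^s$ with $0\le r\le 2n-1$, $0\le s\le 3$ (each written uniquely in this form). $o(x)$ denotes the order of an element $x$ of $T_{8n}$. For a finite group $G$ with identity $e$ and a nonempty $S\subseteq G\setminus\{e\}$ with $S=S^{ -1}$, $\mathrm{Cay}(G,S)$ is the graph with vertex set $G$ in which $x,y$ are adjacent iff $xy^{ -1}\in S$. It is called normal if $S$ is a union of conjugacy classes of $G$. A graph is integral if all eigenvalues of its adjacency matrix are integers. $\mathbb N^+$ is the set of positive integers. In the set descriptions in (1), the conditions on $l$ are to hold for some $k$ (respectively $t$) in $\mathbb N^+$.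
   Formalization: The aside o(a^r b^2)=lcm(o(a^r),4) is left out, being false in general (n=2, r=1: ab^2 has order 2, not 4); the sets [a^r b^2] are defined by the displayed formula, which does not use it. ℂ is replaced by any algebraically closed field of characteristic 0. -}

module Defs where

open import Level using (0ℓ; _⊔_) renaming (suc to lsuc)
open import Algebra.Apartness.Bundles using (HeytingField; HeytingCommutativeRing)
open import Algebra.Bundles using (CommutativeRing; Group; Semiring)
open import Algebra.Structures using (IsGroup)
import Algebra.Definitions.RawMonoid as RawMonoidDefs
import Algebra.Definitions.RawSemiring as RawSemiringDefs
import Algebra.Properties.Group as GroupProperties
import Algebra.Properties.Monoid.Mult as MonoidMult
open import Data.Bool.Base using (if_then_else_)
open import Data.Fin.Base using (Fin; toℕ)
open import Data.Fin.Properties using (toℕ-injective; toℕ-fromℕ<; toℕ<n; *↔×)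
open import Data.Integer.Base as ℤ using (ℤ)
open import Data.List.Base using (List)
open import Data.List.Relation.Unary.Any using (Any)
open import Data.Nat.Base as ℕ using (ℕ; zero; suc; pred; _+_; _*_; _∸_; _/_; _%_; _≤_; _<_; NonZero; ≢-nonZero; ≢-nonZero⁻¹)
open import Data.Nat.DivMod
open import Data.Nat.Divisibility using (_∣_; _∤_; divides; m%n≡0⇒n∣m; *-cancelʳ-∣; n∣m*n; ∣⇒≤)
open import Data.Nat.GCD using (gcd; gcd[m,n]≢0; gcd[m,n]∣m; gcd[m,n]∣n; gcd-greatest; c*gcd[m,n]≡gcd[cm,cn])
open import Data.Nat.LCM using (lcm)
open import Data.Nat.Properties
open import Data.Nat.Tactic.RingSolver using (solve-∀)
open import Data.Product.Base using (_×_; _,_; ∃; Σ; proj₁; proj₂)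
open import Data.Sum.Base using (_⊎_; inj₁; inj₂)
open import Function.Base using (_∘_)
open import Function.Bundles using (_↔_; Inverse)
open import Relation.Binary.Core using (Rel)
import Relation.Binary.Definitions as Binary
open import Relation.Binary.PropositionalEquality
open import Relation.Nullary.Decidable using (does)
open import Relation.Nullary.Negation using (¬_)
open import Relation.Unary using (Pred; Decidable; Satisfiable; _∈_; _∉_; _≐_; ∅; U; ⋃)

------------------------------------------------------------------------
-- Scalars

module FieldDefs {c ℓ₁ ℓ₂} (K : HeytingField c ℓ₁ ℓ₂) where
  open HeytingField K public
    using (Carrier; _≈_; _#_; 0#; 1#; heytingCommutativeRing)
    renaming (_+_ to _+ᴷ_; _*_ to _*ᴷ_; -_ to -ᴷ_)
  open HeytingCommutativeRing heytingCommutativeRing public using (commutativeRing)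
  open RawSemiringDefs (Semiring.rawSemiring (CommutativeRing.semiring commutativeRing)) public
    using (sum) renaming (_×_ to _·_; _^_ to _^ᴷ_)

  fromℤ : ℤ → Carrier
  fromℤ (ℤ.+ m)    = m · 1#
  fromℤ ℤ.-[1+ m ] = -ᴷ (suc m · 1#)

  CharacteristicZero : Set ℓ₂
  CharacteristicZero = ∀ m → (suc m · 1#) # 0#

  -- Every monic polynomial X^(d+1) + Σ_{i ≤ d} pᵢ X^i has a root.
  AlgebraicallyClosed : Set (c ⊔ ℓ₁)
  AlgebraicallyClosed = ∀ d (p : Fin (suc d) → Carrier) →
    ∃ λ x → (x ^ᴷ suc d) +ᴷ sum (λ i → p i *ᴷ (x ^ᴷ toℕ i)) ≈ 0#

  -- The eigenvector v is nonzero in the positive sense that one of its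
  -- coordinates is apart from 0.
  IsEigenvalue : ∀ {m} → (Fin m → Fin m → Carrier) → Carrier → Set (c ⊔ ℓ₁ ⊔ ℓ₂)
  IsEigenvalue {m} M λ′ = ∃ λ (v : Fin m → Carrier) →
    (∃ λ i → v i # 0#) × (∀ i → sum (λ j → M i j *ᴷ v j) ≈ λ′ *ᴷ v i)

-- The complex numbers enter only as an algebraically closed field of
-- characteristic zero.  Since agda-stdlib has no ℂ, statements are made for
-- every such field.  Equality is not required to be decidable, so that the
-- Cauchy complex numbers are an instance; classically, x # y means x ≉ y.
record AlgebraicallyClosedField₀ c ℓ₁ ℓ₂ : Set (lsuc (c ⊔ ℓ₁ ⊔ ℓ₂)) where
  field
    heytingField        : HeytingField c ℓ₁ ℓ₂
    characteristicZero  : FieldDefs.CharacteristicZero heytingField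
    algebraicallyClosed : FieldDefs.AlgebraicallyClosed heytingField

  open FieldDefs heytingField public

------------------------------------------------------------------------
-- Finite simple graphs

record FiniteGraph : Set₁ where
  infix 4 _~_ _~?_
  field
    Vertex   : Set
    order    : ℕ
    vertices : Fin order ↔ Vertex
    _~_      : Rel Vertex 0ℓ
    _~?_     : Binary.Decidable _~_
    ~-sym    : Binary.Symmetric _~_
    ~-irrefl : ∀ {x} → ¬ x ~ x

module _ {c ℓ₁ ℓ₂} (K : AlgebraicallyClosedField₀ c ℓ₁ ℓ₂) (Γ : FiniteGraph) where
  open AlgebraicallyClosedField₀ K using (Carrier; _≈_; 0#; 1#; fromℤ; IsEigenvalue)
  open FiniteGraph Γ

  adjacencyMatrix : Fin order → Fin order → Carrier
  adjacencyMatrix i j =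
    if does (Inverse.to vertices i ~? Inverse.to vertices j) then 1# else 0#

  Integral : Set (c ⊔ ℓ₁ ⊔ ℓ₂)
  Integral = ∀ x → IsEigenvalue adjacencyMatrix x → ∃ λ (z : ℤ) → x ≈ fromℤ z

------------------------------------------------------------------------
-- Finite groups and their Cayley graphs

record FiniteGroup : Set₁ where
  infixl 7 _∙_
  infix  8 _⁻¹
  field
    Carrier  : Set
    _∙_      : Carrier → Carrier → Carrier
    ε        : Carrier
    _⁻¹      : Carrier → Carrier
    isGroup  : IsGroup _≡_ _∙_ ε _⁻¹
    order    : ℕ
    elements : Fin order ↔ Carrier

  group : Group 0ℓ 0ℓ
  group = record { isGroup = isGroup }

  open IsGroup isGroup public using (assoc; identityˡ; identityʳ; inverseˡ; inverseʳ)

  infixr 8 _^_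
  _^_ : Carrier → ℕ → Carrier
  x ^ k = RawMonoidDefs._×_ (Group.rawMonoid group) k x

  -- Natural exponents suffice, since the group is finite.
  ⟨_⟩ : Carrier → Pred Carrier 0ℓ
  ⟨ x ⟩ y = ∃ λ k → y ≡ x ^ k

  IsOrderOf : ℕ → Carrier → Set
  IsOrderOf m x = 1 ≤ m × x ^ m ≡ ε × (∀ k → 1 ≤ k → x ^ k ≡ ε → m ≤ k)

  conjugacyClass : Carrier → Pred Carrier 0ℓ
  conjugacyClass g x = ∃ λ h → x ≡ h ⁻¹ ∙ g ∙ h

  IsUnionOfConjugacyClasses : Pred Carrier 0ℓ → Set₁
  IsUnionOfConjugacyClasses S = ∃ λ (R : Pred Carrier 0ℓ) →
    S ≐ ⋃ (∃ R) (conjugacyClass ∘ proj₁)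

  record IsConnectionSet (S : Pred Carrier 0ℓ) : Set where
    field
      nonempty      : Satisfiable S
      ε∉            : ε ∉ S
      inverseClosed : S ≐ (λ x → x ⁻¹ ∈ S)

module _ (G : FiniteGroup) where
  open FiniteGroup G

  Cay : (S : Pred Carrier 0ℓ) → Decidable S → IsConnectionSet S → FiniteGraph
  Cay S S? isConn = record
    { Vertex   = Carrier
    ; order    = order
    ; vertices = elements
    ; _~_      = λ x y → (x ∙ y ⁻¹) ∈ S
    ; _~?_     = λ x y → S? (x ∙ y ⁻¹)
    ; ~-sym    = λ {x} {y} xy⁻¹∈S →
        subst S (trans (⁻¹-anti-homo-∙ x (y ⁻¹)) (cong (_∙ x ⁻¹) (⁻¹-involutive y)))
                (proj₁ inverseClosed xy⁻¹∈S)
    ; ~-irrefl = λ {x} xx⁻¹∈S → ε∉ (subst S (inverseʳ x) xx⁻¹∈S)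
    }
    where
    open IsConnectionSet isConn
    open GroupProperties group using (⁻¹-anti-homo-∙; ⁻¹-involutive)

  -- A property of the pair (G , S), not of the underlying graph.
  IsNormalCayley : Pred Carrier 0ℓ → Set₁
  IsNormalCayley = IsUnionOfConjugacyClasses

------------------------------------------------------------------------
-- The group T₈ₙ = ⟨ a , b ∣ a²ⁿ = b⁸ = e , aⁿ = b⁴ , b⁻¹ab = a⁻¹ ⟩

module T₈ (n : ℕ) .{{n≢0 : NonZero n}} where

  private
    instance
      2n≢0 : NonZero (2 * n)
      2n≢0 = m*n≢0 2 n

  infix 4 _≋_
  _≋_ : Rel ℕ 0ℓ
  p ≋ q = p % (2 * n) ≡ q % (2 * n)

  -- The pair (r , s) stands for aʳbˢ.
  T : Set
  T = Fin (2 * n) × Fin 4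

  -- word p q is the normal form of aᵖb^q, found by means of b⁴ = aⁿ.
  word : ℕ → ℕ → T
  word p q = (p + n * (q / 4)) mod (2 * n) , q mod 4

  -- a⁻¹ = a^σ, hence b^s aʳ = a^(σ^s r) b^s.
  σ : ℕ
  σ = pred (2 * n)

  infixl 7 _∙_
  _∙_ : T → T → T
  (r , s) ∙ (r′ , s′) = word (toℕ r + σ ℕ.^ toℕ s * toℕ r′) (toℕ s + toℕ s′)

  ε : T
  ε = word 0 0

  infix 8 _⁻¹
  _⁻¹ : T → T
  (r , s) ⁻¹ = word (σ ℕ.^ (9 ∸ toℕ s) * toℕ r) (8 ∸ toℕ s)

  private
    toℕ-mod : ∀ p d .{{_ : NonZero d}} → toℕ (p mod d) ≡ p % d
    toℕ-mod p d = toℕ-fromℕ< (m%n<n p d)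

    mod-cong : ∀ p q d .{{_ : NonZero d}} → p % d ≡ q % d → p mod d ≡ q mod d
    mod-cong p q d eq =
      toℕ-injective (trans (toℕ-mod p d) (trans eq (sym (toℕ-mod q d))))

    +-≋ : ∀ p p′ q q′ → p ≋ p′ → q ≋ q′ → p + q ≋ p′ + q′
    +-≋ p p′ q q′ e f = begin
      (p + q) % (2 * n)                             ≡⟨ %-distribˡ-+ p q (2 * n) ⟩
      (p % (2 * n) + q % (2 * n)) % (2 * n)         ≡⟨ cong₂ (λ x y → (x + y) % (2 * n)) e f ⟩
      (p′ % (2 * n) + q′ % (2 * n)) % (2 * n)       ≡⟨ %-distribˡ-+ p′ q′ (2 * n) ⟨
      (p′ + q′) % (2 * n)                           ∎
      where open ≡-Reasoning

    *-≋ : ∀ p p′ q q′ → p ≋ p′ → q ≋ q′ → p * q ≋ p′ * q′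
    *-≋ p p′ q q′ e f = begin
      (p * q) % (2 * n)                             ≡⟨ %-distribˡ-* p q (2 * n) ⟩
      (p % (2 * n) * (q % (2 * n))) % (2 * n)       ≡⟨ cong₂ (λ x y → (x * y) % (2 * n)) e f ⟩
      (p′ % (2 * n) * (q′ % (2 * n))) % (2 * n)     ≡⟨ %-distribˡ-* p′ q′ (2 * n) ⟨
      (p′ * q′) % (2 * n)                           ∎
      where open ≡-Reasoning

    sucσ : suc σ ≡ 2 * n
    sucσ = suc-pred (2 * n)

    multiple≋0 : ∀ k → k * (2 * n) ≋ 0
    multiple≋0 k = [m+kn]%n≡m%n 0 k (2 * n)

    σ-odd : σ ≡ suc (2 * pred n)
    σ-odd = suc-injective (trans sucσ (trans (cong (2 *_) (sym (suc-pred n))) (lem (pred n))))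
      where
      lem : ∀ m → 2 * suc m ≡ suc (suc (2 * m))
      lem = solve-∀

    σn≋n : σ * n ≋ n
    σn≋n = trans (cong (_% (2 * n)) eq) ([m+kn]%n≡m%n n (pred n) (2 * n))
      where
      lem : ∀ m n → suc (2 * m) * n ≡ n + m * (2 * n)
      lem = solve-∀
      eq : σ * n ≡ n + pred n * (2 * n)
      eq = trans (cong (_* n) σ-odd) (lem (pred n) n)

    σ²≋1 : σ * σ ≋ 1
    σ²≋1 = trans (cong (_% (2 * n)) eq) ([m+kn]%n≡m%n 1 (2 * pred n) (2 * n))
      where
      lem : ∀ m → suc (2 * m) * suc (2 * m) ≡ 1 + 2 * m * (2 * suc m)
      lem = solve-∀
      eq : σ * σ ≡ 1 + 2 * pred n * (2 * n)
      eq = trans (cong₂ _*_ σ-odd σ-odd)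
             (trans (lem (pred n)) (cong (λ k → 1 + 2 * pred n * (2 * k)) (suc-pred n)))

    σ^q*n≋n : ∀ q → σ ℕ.^ q * n ≋ n
    σ^q*n≋n zero    = cong (_% (2 * n)) (*-identityˡ n)
    σ^q*n≋n (suc q) = begin
      (σ * σ ℕ.^ q * n) % (2 * n)    ≡⟨ cong (_% (2 * n)) (*-assoc σ (σ ℕ.^ q) n) ⟩
      (σ * (σ ℕ.^ q * n)) % (2 * n)  ≡⟨ *-≋ σ σ _ n refl (σ^q*n≋n q) ⟩
      (σ * n) % (2 * n)              ≡⟨ σn≋n ⟩
      n % (2 * n)                    ∎
      where open ≡-Reasoning

    σ^[4k]≋1 : ∀ k → σ ℕ.^ (k * 4) ≋ 1
    σ^[4k]≋1 zero    = refl
    σ^[4k]≋1 (suc k) = begin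
      (σ * (σ * (σ * (σ * σ ℕ.^ (k * 4))))) % (2 * n) ≡⟨ cong (_% (2 * n)) (lem σ (σ ℕ.^ (k * 4))) ⟩
      (σ * σ * (σ * σ * σ ℕ.^ (k * 4))) % (2 * n)     ≡⟨ *-≋ (σ * σ) 1 _ 1 σ²≋1
                                                          (*-≋ (σ * σ) 1 _ 1 σ²≋1 (σ^[4k]≋1 k)) ⟩
      1 % (2 * n)                                     ∎
      where
      open ≡-Reasoning
      lem : ∀ s t → s * (s * (s * (s * t))) ≡ s * s * (s * s * t)
      lem = solve-∀

    σ^%4 : ∀ q → σ ℕ.^ (q % 4) ≋ σ ℕ.^ q
    σ^%4 q = sym (begin
      σ ℕ.^ q % (2 * n)                             ≡⟨ cong (λ k → σ ℕ.^ k % (2 * n)) (m≡m%n+[m/n]*n q 4) ⟩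
      σ ℕ.^ (q % 4 + q / 4 * 4) % (2 * n)           ≡⟨ cong (_% (2 * n)) (^-distribˡ-+-* σ (q % 4) (q / 4 * 4)) ⟩
      (σ ℕ.^ (q % 4) * σ ℕ.^ (q / 4 * 4)) % (2 * n) ≡⟨ *-≋ (σ ℕ.^ (q % 4)) _ _ 1 refl (σ^[4k]≋1 (q / 4)) ⟩
      (σ ℕ.^ (q % 4) * 1) % (2 * n)                 ≡⟨ cong (_% (2 * n)) (*-identityʳ _) ⟩
      σ ℕ.^ (q % 4) % (2 * n)                       ∎)
      where open ≡-Reasoning

    quotient-+ : ∀ q q′ → (q + q′) / 4 ≡ (q % 4 + q′ % 4) / 4 + (q / 4 + q′ / 4)
    quotient-+ q q′ = begin
      (q + q′) / 4
        ≡⟨ cong (_/ 4) (cong₂ _+_ (m≡m%n+[m/n]*n q 4) (m≡m%n+[m/n]*n q′ 4)) ⟩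
      (q % 4 + q / 4 * 4 + (q′ % 4 + q′ / 4 * 4)) / 4
        ≡⟨ cong (_/ 4) (lem (q % 4) (q / 4) (q′ % 4) (q′ / 4)) ⟩
      (q % 4 + q′ % 4 + (q / 4 + q′ / 4) * 4) / 4
        ≡⟨ +-distrib-/-∣ʳ (q % 4 + q′ % 4) (n∣m*n (q / 4 + q′ / 4)) ⟩
      (q % 4 + q′ % 4) / 4 + (q / 4 + q′ / 4) * 4 / 4
        ≡⟨ cong ((q % 4 + q′ % 4) / 4 +_) (m*n/n≡m (q / 4 + q′ / 4) 4) ⟩
      (q % 4 + q′ % 4) / 4 + (q / 4 + q′ / 4) ∎
      where
      open ≡-Reasoning
      lem : ∀ r d r′ d′ → r + d * 4 + (r′ + d′ * 4) ≡ r + r′ + (d + d′) * 4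
      lem = solve-∀

  word-cong : ∀ {p p′} q → p ≋ p′ → word p q ≡ word p′ q
  word-cong {p} {p′} q e = cong (_, q mod 4) (mod-cong _ _ (2 * n) (+-≋ p p′ (n * (q / 4)) (n * (q / 4)) e refl))

  word-normal : ∀ r s → word (toℕ r) (toℕ s) ≡ (r , s)
  word-normal r s = cong₂ _,_
    (toℕ-injective (trans (toℕ-mod _ (2 * n))
      (trans (cong (_% (2 * n)) (trans (cong (λ k → toℕ r + n * k) (m<n⇒m/n≡0 (toℕ<n s)))
                                       (trans (cong (toℕ r +_) (*-zeroʳ n)) (+-identityʳ (toℕ r)))))
             (m<n⇒m%n≡m (toℕ<n r)))))
    (toℕ-injective (trans (toℕ-mod (toℕ s) 4) (m<n⇒m%n≡m (toℕ<n s))))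

  word-∙ : ∀ p q p′ q′ → word p q ∙ word p′ q′ ≡ word (p + σ ℕ.^ q * p′) (q + q′)
  word-∙ p q p′ q′ = trans
    (cong₂ (λ x y → word x y)
       {x = toℕ (P mod (2 * n)) + σ ℕ.^ toℕ (q mod 4) * toℕ (P′ mod (2 * n))}
       (cong₂ _+_ (toℕ-mod P (2 * n))
         (cong₂ (λ x y → σ ℕ.^ x * y) (toℕ-mod q 4) (toℕ-mod P′ (2 * n))))
       (cong₂ _+_ (toℕ-mod q 4) (toℕ-mod q′ 4)))
    (cong₂ _,_ (mod-cong _ _ (2 * n) exponents)
               (mod-cong (q % 4 + q′ % 4) (q + q′) 4 (sym (%-distribˡ-+ q q′ 4))))
    where
    open ≡-Reasoning
    P  = p + n * (q / 4)
    P′ = p′ + n * (q′ / 4)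
    c  = (q % 4 + q′ % 4) / 4

    lem₁ : ∀ p m d s p′ d′ → p + m * d + s * (p′ + m * d′) ≡ p + m * d + s * p′ + (s * m) * d′
    lem₁ = solve-∀
    lem₂ : ∀ p m d x d′ c → p + m * d + x + m * d′ + m * c ≡ p + x + m * (c + (d + d′))
    lem₂ = solve-∀

    exponents : P % (2 * n) + σ ℕ.^ (q % 4) * (P′ % (2 * n)) + n * c
              ≋ p + σ ℕ.^ q * p′ + n * ((q + q′) / 4)
    exponents = begin
      (P % (2 * n) + σ ℕ.^ (q % 4) * (P′ % (2 * n)) + n * c) % (2 * n)
        ≡⟨ +-≋ _ (P + σ ℕ.^ q * P′) (n * c) _
             (+-≋ _ P _ (σ ℕ.^ q * P′) (m%n%n≡m%n P (2 * n))
               (*-≋ (σ ℕ.^ (q % 4)) (σ ℕ.^ q) _ P′ (σ^%4 q) (m%n%n≡m%n P′ (2 * n))))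
             refl ⟩
      (P + σ ℕ.^ q * P′ + n * c) % (2 * n)
        ≡⟨ cong (λ x → (x + n * c) % (2 * n)) (lem₁ p n (q / 4) (σ ℕ.^ q) p′ (q′ / 4)) ⟩
      (p + n * (q / 4) + σ ℕ.^ q * p′ + (σ ℕ.^ q * n) * (q′ / 4) + n * c) % (2 * n)
        ≡⟨ +-≋ _ (p + n * (q / 4) + σ ℕ.^ q * p′ + n * (q′ / 4)) (n * c) _
             (+-≋ (p + n * (q / 4) + σ ℕ.^ q * p′) _ _ _ refl
               (*-≋ (σ ℕ.^ q * n) n (q′ / 4) _ (σ^q*n≋n q) refl))
             refl ⟩
      (p + n * (q / 4) + σ ℕ.^ q * p′ + n * (q′ / 4) + n * c) % (2 * n)
        ≡⟨ cong (_% (2 * n)) (lem₂ p n (q / 4) (σ ℕ.^ q * p′) (q′ / 4) c) ⟩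
      (p + σ ℕ.^ q * p′ + n * (c + (q / 4 + q′ / 4))) % (2 * n)
        ≡⟨ cong (λ k → (p + σ ℕ.^ q * p′ + n * k) % (2 * n)) (quotient-+ q q′) ⟨
      (p + σ ℕ.^ q * p′ + n * ((q + q′) / 4)) % (2 * n) ∎

  private
    word-8 : ∀ p → p ≋ 0 → word p 8 ≡ ε
    word-8 p e = cong (_, 0 mod 4) (mod-cong (p + n * 2) (0 + n * 0) (2 * n) (begin
      (p + n * 2) % (2 * n)  ≡⟨ cong (λ k → (p + k) % (2 * n)) (trans (*-comm n 2) (sym (*-identityˡ _))) ⟩
      (p + 1 * (2 * n)) % (2 * n) ≡⟨ [m+kn]%n≡m%n p 1 (2 * n) ⟩
      p % (2 * n)            ≡⟨ e ⟩
      0 % (2 * n)            ≡⟨ cong (_% (2 * n)) (*-zeroʳ n) ⟨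
      (0 + n * 0) % (2 * n)  ∎))
      where open ≡-Reasoning

    σx+x≋0 : ∀ x → σ * x + x ≋ 0
    σx+x≋0 x = trans (cong (_% (2 * n)) (trans (+-comm (σ * x) x)
      (trans (cong (_* x) sucσ) (*-comm (2 * n) x)))) (multiple≋0 x)

    ∙-assoc : ∀ x y z → (x ∙ y) ∙ z ≡ x ∙ (y ∙ z)
    ∙-assoc (r₁ , s₁) (r₂ , s₂) (r₃ , s₃) = begin
      ((r₁ , s₁) ∙ (r₂ , s₂)) ∙ (r₃ , s₃)
        ≡⟨ cong (word (i + σ ℕ.^ s * j) (s + t) ∙_) (word-normal r₃ s₃) ⟨
      word (i + σ ℕ.^ s * j) (s + t) ∙ word k u
        ≡⟨ word-∙ (i + σ ℕ.^ s * j) (s + t) k u ⟩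
      word (i + σ ℕ.^ s * j + σ ℕ.^ (s + t) * k) (s + t + u)
        ≡⟨ cong₂ word (trans (cong (λ x → i + σ ℕ.^ s * j + x * k) (^-distribˡ-+-* σ s t))
                             (lem i (σ ℕ.^ s) j (σ ℕ.^ t) k)) (+-assoc s t u) ⟩
      word (i + σ ℕ.^ s * (j + σ ℕ.^ t * k)) (s + (t + u))
        ≡⟨ word-∙ i s (j + σ ℕ.^ t * k) (t + u) ⟨
      word i s ∙ word (j + σ ℕ.^ t * k) (t + u)
        ≡⟨ cong (_∙ word (j + σ ℕ.^ t * k) (t + u)) (word-normal r₁ s₁) ⟩
      (r₁ , s₁) ∙ ((r₂ , s₂) ∙ (r₃ , s₃)) ∎
      where
      open ≡-Reasoning
      i = toℕ r₁
      j = toℕ r₂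
      k = toℕ r₃
      s = toℕ s₁
      t = toℕ s₂
      u = toℕ s₃
      lem : ∀ i s j t k → i + s * j + s * t * k ≡ i + s * (j + t * k)
      lem = solve-∀

    ∙-identityˡ : ∀ x → ε ∙ x ≡ x
    ∙-identityˡ (r , s) = begin
      ε ∙ (r , s)                      ≡⟨ cong (ε ∙_) (word-normal r s) ⟨
      word 0 0 ∙ word (toℕ r) (toℕ s)  ≡⟨ word-∙ 0 0 (toℕ r) (toℕ s) ⟩
      word (1 * toℕ r) (toℕ s)         ≡⟨ cong (λ x → word x (toℕ s)) (*-identityˡ (toℕ r)) ⟩
      word (toℕ r) (toℕ s)             ≡⟨ word-normal r s ⟩
      (r , s)                          ∎
      where open ≡-Reasoning

    ∙-identityʳ : ∀ x → x ∙ ε ≡ x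
    ∙-identityʳ (r , s) = begin
      (r , s) ∙ ε                      ≡⟨ cong (_∙ ε) (word-normal r s) ⟨
      word (toℕ r) (toℕ s) ∙ word 0 0  ≡⟨ word-∙ (toℕ r) (toℕ s) 0 0 ⟩
      word (toℕ r + σ ℕ.^ toℕ s * 0) (toℕ s + 0)
        ≡⟨ cong₂ word (trans (cong (toℕ r +_) (*-zeroʳ (σ ℕ.^ toℕ s))) (+-identityʳ (toℕ r))) (+-identityʳ (toℕ s)) ⟩
      word (toℕ r) (toℕ s)             ≡⟨ word-normal r s ⟩
      (r , s)                          ∎
      where open ≡-Reasoning

    s≤8 : ∀ (s : Fin 4) → toℕ s ≤ 8
    s≤8 s = ≤-trans (<⇒≤ (toℕ<n s)) (m≤m+n 4 4)

    ∙-inverseˡ : ∀ x → x ⁻¹ ∙ x ≡ ε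
    ∙-inverseˡ (r , s) = begin
      (r , s) ⁻¹ ∙ (r , s)
        ≡⟨ cong ((r , s) ⁻¹ ∙_) (word-normal r s) ⟨
      word (σ ℕ.^ (9 ∸ t) * i) (8 ∸ t) ∙ word i t
        ≡⟨ word-∙ (σ ℕ.^ (9 ∸ t) * i) (8 ∸ t) i t ⟩
      word (σ ℕ.^ (9 ∸ t) * i + σ ℕ.^ (8 ∸ t) * i) (8 ∸ t + t)
        ≡⟨ cong₂ word (cong (_+ σ ℕ.^ (8 ∸ t) * i)
             (trans (cong (λ k → σ ℕ.^ k * i) (+-∸-assoc 1 (s≤8 s))) (*-assoc σ (σ ℕ.^ (8 ∸ t)) i)))
             (m∸n+n≡m (s≤8 s)) ⟩
      word (σ * (σ ℕ.^ (8 ∸ t) * i) + σ ℕ.^ (8 ∸ t) * i) 8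
        ≡⟨ word-8 _ (σx+x≋0 (σ ℕ.^ (8 ∸ t) * i)) ⟩
      ε ∎
      where
      open ≡-Reasoning
      i = toℕ r
      t = toℕ s

    ∙-inverseʳ : ∀ x → x ∙ x ⁻¹ ≡ ε
    ∙-inverseʳ (r , s) = begin
      (r , s) ∙ (r , s) ⁻¹
        ≡⟨ cong (_∙ (r , s) ⁻¹) (word-normal r s) ⟨
      word i t ∙ word (σ ℕ.^ (9 ∸ t) * i) (8 ∸ t)
        ≡⟨ word-∙ i t (σ ℕ.^ (9 ∸ t) * i) (8 ∸ t) ⟩
      word (i + σ ℕ.^ t * (σ ℕ.^ (9 ∸ t) * i)) (t + (8 ∸ t))
        ≡⟨ cong₂ (λ x y → word x y) exponent (m+[n∸m]≡n (s≤8 s)) ⟩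
      word (σ * (σ ℕ.^ 8 * i) + i) 8
        ≡⟨ word-8 _ (trans (+-≋ _ (σ * i) i i
             (*-≋ σ σ _ i refl (trans (*-≋ _ 1 i i (σ^[4k]≋1 2) refl) (cong (_% (2 * n)) (*-identityˡ i)))) refl)
             (σx+x≋0 i)) ⟩
      ε ∎
      where
      open ≡-Reasoning
      i = toℕ r
      t = toℕ s
      exponent : i + σ ℕ.^ t * (σ ℕ.^ (9 ∸ t) * i) ≡ σ * (σ ℕ.^ 8 * i) + i
      exponent = begin
        i + σ ℕ.^ t * (σ ℕ.^ (9 ∸ t) * i) ≡⟨ +-comm i _ ⟩
        σ ℕ.^ t * (σ ℕ.^ (9 ∸ t) * i) + i ≡⟨ cong (_+ i) (*-assoc (σ ℕ.^ t) _ i) ⟨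
        σ ℕ.^ t * σ ℕ.^ (9 ∸ t) * i + i   ≡⟨ cong (λ x → x * i + i) (^-distribˡ-+-* σ t (9 ∸ t)) ⟨
        σ ℕ.^ (t + (9 ∸ t)) * i + i       ≡⟨ cong (λ k → σ ℕ.^ k * i + i) (m+[n∸m]≡n (m≤n⇒m≤1+n (s≤8 s))) ⟩
        σ * σ ℕ.^ 8 * i + i               ≡⟨ cong (_+ i) (*-assoc σ (σ ℕ.^ 8) i) ⟩
        σ * (σ ℕ.^ 8 * i) + i             ∎

  T₈ₙ : FiniteGroup
  T₈ₙ = record
    { Carrier  = T
    ; _∙_      = _∙_
    ; ε        = ε
    ; _⁻¹      = _⁻¹
    ; isGroup  = record
      { isMonoid = record
        { isSemigroup = record
          { isMagma = record { isEquivalence = isEquivalence ; ∙-cong = cong₂ _∙_ }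
          ; assoc   = ∙-assoc
          }
        ; identity = ∙-identityˡ , ∙-identityʳ
        }
      ; inverse = ∙-inverseˡ , ∙-inverseʳ
      ; ⁻¹-cong = cong _⁻¹
      }
    ; order    = (2 * n) * 4
    ; elements = *↔× {2 * n} {4}
    }

  open FiniteGroup T₈ₙ public using (_^_; ⟨_⟩; IsOrderOf)

  a b : T
  a = word 1 0
  b = word 0 1

  a^-word : ∀ k → a ^ k ≡ word k 0
  a^-word zero    = refl
  a^-word (suc k) = trans (cong (a ∙_) (a^-word k))
    (trans (word-∙ 1 0 k 0) (cong (λ x → word (suc x) 0) (*-identityˡ k)))

  b^-word : ∀ k → b ^ k ≡ word 0 k
  b^-word zero    = refl
  b^-word (suc k) = trans (cong (b ∙_) (b^-word k))
    (trans (word-∙ 0 1 0 k) (cong (λ x → word x (suc k)) (*-zeroʳ (σ ℕ.^ 1))))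

  -- The defining relations, and the normal form of elements.  A group
  -- generated by a and b subject to these relations has at most 8n elements,
  -- so they identify T₈ₙ with the group presented.

  a^2n≡ε : a ^ (2 * n) ≡ ε
  a^2n≡ε = trans (a^-word (2 * n)) (word-cong 0
    (trans (cong (_% (2 * n)) (sym (*-identityˡ (2 * n)))) (multiple≋0 1)))

  b^8≡ε : b ^ 8 ≡ ε
  b^8≡ε = trans (b^-word 8) (word-8 0 refl)

  a^n≡b^4 : a ^ n ≡ b ^ 4
  a^n≡b^4 = trans (a^-word n) (trans
    (cong (λ k → k mod (2 * n) , 0 mod 4)
      (trans (cong (n +_) (*-zeroʳ n)) (trans (+-identityʳ n) (sym (*-identityʳ n)))))
    (sym (b^-word 4)))

  b⁻¹ab≡a⁻¹ : b ⁻¹ ∙ a ∙ b ≡ a ⁻¹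
  b⁻¹ab≡a⁻¹ = inverseˡ-unique (b ⁻¹ ∙ a ∙ b) a (begin
    b ⁻¹ ∙ a ∙ b ∙ a      ≡⟨ ∙-assoc (b ⁻¹ ∙ a) b a ⟩
    b ⁻¹ ∙ a ∙ (b ∙ a)    ≡⟨ ∙-assoc (b ⁻¹) a (b ∙ a) ⟩
    b ⁻¹ ∙ (a ∙ (b ∙ a))  ≡⟨ cong (b ⁻¹ ∙_) aba≡b ⟩
    b ⁻¹ ∙ b              ≡⟨ ∙-inverseˡ b ⟩
    ε                     ∎)
    where
    open ≡-Reasoning
    open GroupProperties (FiniteGroup.group T₈ₙ) using (inverseˡ-unique)
    aba≡b : a ∙ (b ∙ a) ≡ b
    aba≡b = begin
      a ∙ (b ∙ a)                     ≡⟨ cong (a ∙_) (word-∙ 0 1 1 0) ⟩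
      a ∙ word (σ ℕ.^ 1 * 1) 1        ≡⟨ word-∙ 1 0 (σ ℕ.^ 1 * 1) 1 ⟩
      word (1 + 1 * (σ ℕ.^ 1 * 1)) 1  ≡⟨ word-cong 1 (trans (cong (_% (2 * n)) (lem σ)) (σx+x≋0 1)) ⟩
      word 0 1                        ∎
      where
      lem : ∀ s → 1 + 1 * (s * 1 * 1) ≡ s * 1 + 1
      lem = solve-∀

  a^r∙b^s≡normal : ∀ r s → a ^ toℕ r ∙ b ^ toℕ s ≡ (r , s)
  a^r∙b^s≡normal r s = begin
    a ^ toℕ r ∙ b ^ toℕ s            ≡⟨ cong₂ _∙_ (a^-word (toℕ r)) (b^-word (toℕ s)) ⟩
    word (toℕ r) 0 ∙ word 0 (toℕ s)  ≡⟨ word-∙ (toℕ r) 0 0 (toℕ s) ⟩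
    word (toℕ r + 0) (toℕ s)         ≡⟨ cong (λ k → word k (toℕ s)) (+-identityʳ (toℕ r)) ⟩
    word (toℕ r) (toℕ s)             ≡⟨ word-normal r s ⟩
    (r , s)                          ∎
    where open ≡-Reasoning

  ----------------------------------------------------------------------
  -- Orders of the powers of a

  private
    gcd≢0 : ∀ r → NonZero (gcd r (2 * n))
    gcd≢0 r = ≢-nonZero (gcd[m,n]≢0 r (2 * n) (inj₂ (≢-nonZero⁻¹ (2 * n))))

  -- o r is the order of a ^ r; see o-isOrder.
  o : ℕ → ℕ
  o r = _/_ (2 * n) (gcd r (2 * n)) {{gcd≢0 r}}

  private
    a^k≡ε⇒2n∣k : ∀ k → a ^ k ≡ ε → 2 * n ∣ k
    a^k≡ε⇒2n∣k k eq = m%n≡0⇒n∣m k (2 * n) (begin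
      k % (2 * n)                      ≡⟨ cong (_% (2 * n)) (+-n*0 k) ⟨
      (k + n * 0) % (2 * n)            ≡⟨ toℕ-mod _ (2 * n) ⟨
      toℕ (proj₁ (word k 0))           ≡⟨ cong (toℕ ∘ proj₁) (trans (sym (a^-word k)) eq) ⟩
      toℕ (proj₁ (word 0 0))           ≡⟨ toℕ-mod _ (2 * n) ⟩
      (0 + n * 0) % (2 * n)            ≡⟨ cong (_% (2 * n)) (*-zeroʳ n) ⟩
      0 % (2 * n)                      ≡⟨ m<n⇒m%n≡m (≤-trans (ℕ.s≤s ℕ.z≤n) (ℕ.>-nonZero⁻¹ (2 * n))) ⟩
      0                                ∎)
      where
      open ≡-Reasoning
      +-n*0 : ∀ k → k + n * 0 ≡ k
      +-n*0 k = trans (cong (k +_) (*-zeroʳ n)) (+-identityʳ k)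

    2n∣k⇒a^k≡ε : ∀ k → 2 * n ∣ k → a ^ k ≡ ε
    2n∣k⇒a^k≡ε k (divides q refl) = trans (a^-word k) (word-cong 0 (multiple≋0 q))

    [a^r]^k : ∀ r k → (a ^ r) ^ k ≡ a ^ (k * r)
    [a^r]^k r k = ×-assocˡ a k r
      where open MonoidMult (Group.monoid (FiniteGroup.group T₈ₙ)) using (×-assocˡ)

    o*gcd : ∀ r → o r * gcd r (2 * n) ≡ 2 * n
    o*gcd r = m/n*n≡m {{gcd≢0 r}} (gcd[m,n]∣n r (2 * n))

  o-isOrder : ∀ r → IsOrderOf (o r) (a ^ r)
  o-isOrder r = 1≤o , [a^r]^o≡ε , minimal
    where
    1≤o : 1 ≤ o r
    1≤o = n≢0⇒n>0 λ o≡0 →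
      ≢-nonZero⁻¹ (2 * n) (trans (sym (o*gcd r)) (cong (_* gcd r (2 * n)) o≡0))

    [a^r]^o≡ε : (a ^ r) ^ o r ≡ ε
    [a^r]^o≡ε with gcd[m,n]∣m r (2 * n)
    ... | divides q r≡qg = trans ([a^r]^k r (o r)) (2n∣k⇒a^k≡ε (o r * r) (divides q (begin
      o r * r                     ≡⟨ cong (o r *_) r≡qg ⟩
      o r * (q * gcd r (2 * n))   ≡⟨ lem (o r) q (gcd r (2 * n)) ⟩
      q * (o r * gcd r (2 * n))   ≡⟨ cong (q *_) (o*gcd r) ⟩
      q * (2 * n)                 ∎)))
      where
      open ≡-Reasoning
      lem : ∀ x y z → x * (y * z) ≡ y * (x * z)
      lem = solve-∀

    minimal : ∀ k → 1 ≤ k → (a ^ r) ^ k ≡ ε → o r ≤ k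
    minimal k 1≤k eq = ∣⇒≤ {{ℕ.>-nonZero 1≤k}}
      (*-cancelʳ-∣ (gcd r (2 * n)) {{gcd≢0 r}}
        (subst₂ _∣_ (sym (o*gcd r)) (sym (c*gcd[m,n]≡gcd[cm,cn] k r (2 * n)))
          (gcd-greatest (a^k≡ε⇒2n∣k (k * r) (trans (sym ([a^r]^k r k)) eq)) (n∣m*n k))))

  ----------------------------------------------------------------------
  -- The sets occurring in the classification

  ⟨a⟩∪⟨a⟩b² ⟨a⟩b∪⟨a⟩b³ : Pred T 0ℓ
  ⟨a⟩∪⟨a⟩b² x = x ∈ ⟨ a ⟩ ⊎ ∃ λ y → y ∈ ⟨ a ⟩ × x ≡ y ∙ b ^ 2
  ⟨a⟩b∪⟨a⟩b³ x = (∃ λ y → y ∈ ⟨ a ⟩ × x ≡ y ∙ b) ⊎ (∃ λ y → y ∈ ⟨ a ⟩ × x ≡ y ∙ b ^ 3)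

  [a^_] : ℕ → Pred T 0ℓ
  [a^ r ] x = ∃ λ l → x ≡ a ^ l × x ∈ ⟨ a ^ r ⟩ ×
    ∃ λ k → 1 ≤ k × gcd k (o r) ≡ 1 × l ≋ k * r

  [a^_b²] : ℕ → Pred T 0ℓ
  [a^ r b²] x = ∃ λ l → x ≡ a ^ l ∙ b ^ 2 × x ∈ ⟨ a ^ r ∙ b ^ 2 ⟩ ×
    lcm (o r) 4 ≡ lcm (o l) 4 ×
    ∃ λ t → 1 ≤ t × (l ≋ r * (4 * t + 1) ⊎ l ≋ r * (4 * t + 3) + n)

  -- Taking rs or rs′ (or both) empty or a singleton gives ∅, [a^r] and
  -- [a^rb²] themselves.
  Condition₁ : Pred T 0ℓ → Set
  Condition₁ S = ∃ λ (rs : List ℕ) → ∃ λ (rs′ : List ℕ) →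
    S ≐ λ x → Any (λ r → x ∈ [a^ r ]) rs ⊎ Any (λ r → x ∈ [a^ r b²]) rs′

  a^rb,a^rb³ : Pred ℕ 0ℓ → Pred T 0ℓ
  a^rb,a^rb³ P x = ∃ λ r → r < 2 * n × P r × (x ≡ a ^ r ∙ b ⊎ x ≡ a ^ r ∙ b ^ 3)

  AllCase EvenCase OddCase : Pred T 0ℓ
  AllCase  = a^rb,a^rb³ U
  EvenCase = a^rb,a^rb³ (2 ∣_)
  OddCase  = a^rb,a^rb³ (2 ∤_)

  Condition₂ : Pred T 0ℓ → Set
  Condition₂ S =
    (2 ∤ n → S ≐ ∅ ⊎ S ≐ AllCase) ×
    (2 ∣ n → S ≐ ∅ ⊎ S ≐ EvenCase ⊎ S ≐ OddCase ⊎ S ≐ AllCase)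

module Submission where

-- T₈ₙ has the abelian subgroup A = ⟨a, b²⟩ of index 2.  Write f for the element Σ_{s ∈ S} s of the
-- group ring, so that the adjacency matrix is multiplication by f.
--
-- Sufficiency.  [aʳ] and [aʳb²] are the sets of generators of ⟨aʳ⟩ and ⟨aʳb²⟩, so condition (1) says that
-- S₁ is closed under passing to another generator of the same cyclic group.  By induction over the cyclic
-- subgroups the indicator function of S₁ is an integral combination of indicator functions 1_H of
-- subgroups H ⊆ A; in condition (2) S₂ is a difference of two normal subgroups.  All these 1_H commute,
-- and 1_H · 1_H = |H| 1_H, so any eigenvector of f can be projected to a common eigenvector of the 1_H, on
-- which f acts by an integer.
--
-- Necessity of (1).  A monic polynomial annihilating f splits over K; factors whose root is not an
-- eigenvalue can be dropped, so f is annihilated by some Π (X − zᵢ) with zᵢ ∈ ℤ, and this holds already over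
-- ℤ.  Modulo a prime p ∤ 4n it follows that f^p − f is nilpotent, whence f^{p·q} = f^q for some power q of p.
-- The part f₁ of f supported on A is central, so the same holds for f₁; as A is abelian f₁^q = Σ_{s ∈ S₁} s^q,
-- and as s ↦ s^q is injective on A, S₁ is closed under p-th powers.  Hence it is closed under all powers
-- prime to 4n, that is, under changing generators.  Goals are decidable, so all this may be done under ¬¬.
--
-- Necessity of (2).  Normality and S = S⁻¹ leave only the listed sets if n is even.  If n is odd, the
-- characters aʳbˢ ↦ ζ^{4r+s} with ζ⁴ = −1, for ζ and −ζ, have eigenvalues differing by ±2n(ζ − ζ³), whose
-- square is 8n², in the two cases to be excluded; so they cannot both be integers.

open import Defs
open import Level using (0ℓ; _⊔_)
open import Algebra.Apartness.Bundles using (HeytingField)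
import Algebra.Apartness.Properties.HeytingCommutativeRing as HeytingProperties
open import Algebra.Bundles using (CommutativeRing; Group; Ring; Semiring)
import Algebra.Properties.Group as GroupProperties
import Algebra.Properties.Monoid.Mult as MonoidMult
import Algebra.Properties.Ring as RingProperties
import Algebra.Properties.Semiring.Binomial as Binomial
import Algebra.Properties.Semiring.Exp as SemiringExp
import Algebra.Properties.Semiring.Mult as SemiringMult
import Algebra.Properties.Semiring.Sum as SemiringSum
import Algebra.Solver.Ring as RingSolver
open import Algebra.Solver.Ring.AlmostCommutativeRing using (fromCommutativeRing; _-Raw-AlmostCommutative⟶_)
open import Data.Bool.Base using (if_then_else_)
open import Data.Empty using (⊥)
open import Data.Fin.Base as Fin using (Fin; zero; suc; toℕ; _↑ˡ_; _↑ʳ_; remQuot)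
open import Data.Fin.Patterns using (0F; 1F; 2F; 3F)
open import Data.Fin.Permutation using (Permutation; permutation)
import Data.Fin.Properties as Fin
open import Data.Integer.Base as ℤ using (ℤ; +_; -[1+_])
open import Data.Integer.Divisibility.Signed as ℤ∣ using () renaming (_∣_ to _∣ℤ_; divides to dividesℤ)
import Data.Integer.Properties as ℤ
import Data.Integer.Tactic.RingSolver as ℤ-Solver
open import Data.List.Base using (List; []; _∷_; _++_; allFin; filter; foldr; length; map; upTo)
open import Data.List.Membership.Propositional using (find; lose) renaming (_∈_ to _∈ˡ_)
open import Data.List.Membership.Propositional.Properties using (∈-allFin; ∈-filter⁺; ∈-filter⁻; ∈-map⁺; ∈-upTo⁺)
open import Data.List.Relation.Unary.All as All using (All; []; _∷_)
import Data.List.Relation.Unary.All.Properties as All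
open import Data.List.Relation.Unary.Any as Any using (Any; here; there)
open import Data.Maybe.Base using (Maybe; just; nothing)
open import Data.Nat.Base as ℕ using (ℕ; NonZero; zero; suc; parity; pred)
open import Data.Nat.Combinatorics using (_C_; k![n∸k]!∣n!; nCk≡n!/k![n-k]!; nCn≡1)
open import Data.Nat.Divisibility using (_∣_; _∤_; divides; _∣0; _∣?_; 0∣⇒≡0; ∣1⇒≡1; ∣-antisym; ∣-refl; ∣-trans; ∣⇒≤; m∣m*n; n∣m*n; ∣m⇒∣m*n; ∣n⇒∣m*n; ∣m∣n⇒∣m+n; ∣m+n∣m⇒∣n; *-cancelˡ-∣; *-cancelʳ-∣; *-monoˡ-∣; m%n≡0⇒n∣m; n∣m⇒m%n≡0; hasNonTrivialDivisor)
open import Data.Nat.DivMod using (_mod_; %-distribˡ-*; %-distribˡ-+; +-distrib-/-∣ˡ; [m+kn]%n≡m%n; [m+n]%n≡m%n; m%n<n; m/n*n≡m; m≡m%n+[m/n]*n)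
open import Data.Nat.GCD using (gcd; gcd-GCD; gcd-greatest; gcd[m,n]∣m; gcd[m,n]∣n; gcd[m,n]≢0; c*gcd[m,n]≡gcd[cm,cn]; module Bézout; module GCD)
open import Data.Nat.Induction using (<-wellFounded)
open import Data.Nat.LCM using (lcm; lcm-least; m∣lcm[m,n]; n∣lcm[m,n])
open import Data.Nat.ListAction using (product)
open import Data.Nat.Primality using (Prime; euclidsLemma; prime[2]; prime⇒nonTrivial; prime⇒nonZero; ¬prime[0]; ¬prime[1])
open import Data.Nat.Primality.Factorisation using (factorise)
import Data.Nat.Properties as ℕ
import Data.Nat.Tactic.RingSolver as ℕ-Solver
open import Data.Parity.Base as ℙ using (Parity; 0ℙ; 1ℙ)
import Data.Parity.Properties as ℙ
open import Data.Product.Base using (_×_; _,_; ∃; map₁; proj₁; proj₂)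
open import Data.Sum.Base using (_⊎_; inj₁; inj₂; [_,_]′)
open import Data.Unit.Base using (⊤; tt)
open import Function.Base using (_∘_)
open import Function.Bundles using (_⇔_; Equivalence; Inverse; mk⇔)
open import Induction.WellFounded using (Acc; acc)
open import Relation.Binary.Definitions using (DecidableEquality)
open import Relation.Binary.PropositionalEquality as ≡ using (_≡_; _≢_; cong; cong₂; refl)
import Relation.Binary.Reasoning.Setoid as SetoidReasoning
open import Relation.Nullary.Decidable using (Dec; yes; no; decidable-stable; does; map′; ¬?; ¬¬-excluded-middle; _×-dec_)
open import Relation.Nullary.Negation using (¬_; contradiction)
open import Relation.Unary using (Pred; Decidable; U; ∅; _⊆_; _∪_; _≐_)
open import Relation.Unary.Properties using (_∪?_)

open GCD using (GCD)

-- Integrality questions of this kind are usually settled by Galois conjugation of character values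
-- in a cyclotomic field. Here K is any algebraically closed field of characteristic zero, without
-- decidable equality. An integer annihilator carries the question into the group ring over ℤ/p,
-- where the Frobenius map plays the part of the Galois group. The obstacle there is
-- noncommutativity. With q a power of p, f^q = f₁^q + f₂^q holds because normality makes f₁
-- central, and the two powers can be separated because q is odd, so that f₂^q stays outside A. The
-- summands of f₂ do not commute with each other, so f₂^q has no such description as f₁^q; this is
-- why odd n needs a character of its own. The number 4n is an exponent of A: p ∤ 4n gives both the
-- injectivity of s ↦ s^q on A and the oddness of p. In the other direction characteristic zero
-- makes |H| invertible, so that 1_H is a multiple of a projection; that one of the two components
-- of a nonzero vector is nonzero is an application of cotransitivity of apartness.

module FiniteGroupProperties (G : FiniteGroup) where
  open FiniteGroup G
  open GroupProperties group using (⁻¹-involutive; ⁻¹-anti-homo-∙) public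

  infix 4 _≟_
  _≟_ : DecidableEquality Carrier
  x ≟ y = map′ from-injective (cong from) (from x Fin.≟ from y)
    where
    open Inverse elements
    from-injective : from x ≡ from y → x ≡ y
    from-injective eq =
      ≡.trans (≡.sym (strictlyInverseˡ x)) (≡.trans (cong to eq) (strictlyInverseˡ y))

  x∙y∙y⁻¹≡x : ∀ x y → x ∙ y ∙ y ⁻¹ ≡ x
  x∙y∙y⁻¹≡x x y = ≡.trans (assoc x y (y ⁻¹)) (≡.trans (cong (x ∙_) (inverseʳ y)) (identityʳ x))

  x∙y⁻¹∙y≡x : ∀ x y → x ∙ y ⁻¹ ∙ y ≡ x
  x∙y⁻¹∙y≡x x y = ≡.trans (assoc x (y ⁻¹) y) (≡.trans (cong (x ∙_) (inverseˡ y)) (identityʳ x))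

  x⁻¹∙[x∙y]≡y : ∀ x y → x ⁻¹ ∙ (x ∙ y) ≡ y
  x⁻¹∙[x∙y]≡y x y = ≡.trans (≡.sym (assoc (x ⁻¹) x y)) (≡.trans (cong (_∙ y) (inverseˡ x)) (identityˡ y))

  x∙[x⁻¹∙y]≡y : ∀ x y → x ∙ (x ⁻¹ ∙ y) ≡ y
  x∙[x⁻¹∙y]≡y x y = ≡.trans (≡.sym (assoc x (x ⁻¹) y)) (≡.trans (cong (_∙ y) (inverseʳ x)) (identityˡ y))

  conj-conj : ∀ x h → (h ⁻¹) ⁻¹ ∙ (h ⁻¹ ∙ x ∙ h) ∙ h ⁻¹ ≡ x
  conj-conj x h = begin
    (h ⁻¹) ⁻¹ ∙ (h ⁻¹ ∙ x ∙ h) ∙ h ⁻¹   ≡⟨ assoc _ _ _ ⟩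
    (h ⁻¹) ⁻¹ ∙ (h ⁻¹ ∙ x ∙ h ∙ h ⁻¹)   ≡⟨ cong ((h ⁻¹) ⁻¹ ∙_) (x∙y∙y⁻¹≡x (h ⁻¹ ∙ x) h) ⟩
    (h ⁻¹) ⁻¹ ∙ (h ⁻¹ ∙ x)              ≡⟨ x⁻¹∙[x∙y]≡y (h ⁻¹) x ⟩
    x                                   ∎
    where open ≡.≡-Reasoning

-- The group ring as functions on G under convolution

module GroupRing {c ℓ} (k : CommutativeRing c ℓ) (G : FiniteGroup) where
  open FiniteGroup G renaming (Carrier to 𝔾; assoc to ∙-assoc; order to N)
  open FiniteGroupProperties G
  open CommutativeRing k hiding (zero; ring) renaming (Carrier to K; refl to ≈-refl; sym to ≈-sym; trans to ≈-trans)
  open SemiringSum semiring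
  open SetoidReasoning setoid

  A : Set c
  A = 𝔾 → K

  infix 4 _≋_
  _≋_ : A → A → Set ℓ
  u ≋ v = ∀ x → u x ≈ v x

  private
    sum-single : ∀ {m} (h : Fin m → K) i → (∀ j → ¬ j ≡ i → h j ≈ 0#) → sum h ≈ h i
    sum-single {suc m} h zero    z = ≈-trans
      (+-congˡ (≈-trans (sum-cong-≋ (λ j → z (suc j) (λ ()))) (sum-replicate-zero m))) (+-identityʳ _)
    sum-single {suc m} h (suc i) z = ≈-trans
      (+-cong (z zero (λ ())) (sum-single (h ∘ suc) i (λ j j≢i → z (suc j) (j≢i ∘ Fin.suc-injective))))
      (+-identityˡ _)

  -- Opaque, so that h can be inferred from ∑ h.
  opaque
    ∑ : A → K
    ∑ h = sum (h ∘ Inverse.to elements)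

    ∑-cong : ∀ {h h′} → h ≋ h′ → ∑ h ≈ ∑ h′
    ∑-cong eq = sum-cong-≋ (λ i → eq (Inverse.to elements i))

    ∑-zero : ∀ {h} → (∀ x → h x ≈ 0#) → ∑ h ≈ 0#
    ∑-zero eq = ≈-trans (∑-cong eq) (sum-replicate-zero N)

    ∑-reindex : ∀ (π π⁻¹ : 𝔾 → 𝔾) → (∀ x → π (π⁻¹ x) ≡ x) → (∀ x → π⁻¹ (π x) ≡ x) →
                ∀ h → ∑ h ≈ ∑ (h ∘ π)
    ∑-reindex π π⁻¹ ππ⁻¹ π⁻¹π h = ≈-trans (∑-permute (h ∘ to) perm)
      (sum-cong-≋ (λ i → reflexive (cong h (strictlyInverseˡ (π (to i))))))
      where
      open Inverse elements
      perm : Permutation N N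
      perm = permutation (from ∘ π ∘ to) (from ∘ π⁻¹ ∘ to)
        (λ i → ≡.trans (cong (from ∘ π) (strictlyInverseˡ _)) (≡.trans (cong from (ππ⁻¹ _)) (strictlyInverseʳ i)))
        (λ i → ≡.trans (cong (from ∘ π⁻¹) (strictlyInverseˡ _)) (≡.trans (cong from (π⁻¹π _)) (strictlyInverseʳ i)))

    ∑-single : ∀ h g → (∀ x → ¬ x ≡ g → h x ≈ 0#) → ∑ h ≈ h g
    ∑-single h g z = ≈-trans
      (sum-single (h ∘ to) (from g) (λ j j≢ → z (to j) (λ eq → j≢ (≡.trans (≡.sym (strictlyInverseʳ j)) (cong from eq)))))
      (reflexive (cong h (strictlyInverseˡ g)))
      where open Inverse elements

    ∑-* : ∀ a h → a * ∑ h ≈ ∑ (λ y → a * h y)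
    ∑-* a h = *-distribˡ-sum a (h ∘ Inverse.to elements)

    ∑-*ʳ : ∀ a h → ∑ h * a ≈ ∑ (λ y → h y * a)
    ∑-*ʳ a h = *-distribʳ-sum a (h ∘ Inverse.to elements)

    ∑-+ : ∀ h h′ → ∑ (λ y → h y + h′ y) ≈ ∑ h + ∑ h′
    ∑-+ h h′ = ∑-distrib-+ (h ∘ Inverse.to elements) (h′ ∘ Inverse.to elements)

    ∑-swap : ∀ (h : 𝔾 → 𝔾 → K) → ∑ (λ x → ∑ (h x)) ≈ ∑ (λ y → ∑ (λ x → h x y))
    ∑-swap h = ∑-comm (λ i j → h (Inverse.to elements i) (Inverse.to elements j))

    -- The only access to the definition of `∑` from outside. Through it sums over ℤ and over ℤ/p
    -- are recognised as the same integer, and sums over G as sums over matrix indices.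
    ∑-def : ∀ h → ∑ h ≡ sum (h ∘ Inverse.to elements)
    ∑-def h = refl

  ind : ∀ {p} {P : Set p} → Dec P → K
  ind d = if does d then 1# else 0#

  ind-yes : ∀ {p} {P : Set p} (d : Dec P) → P → ind d ≡ 1#
  ind-yes (yes _) _ = refl
  ind-yes (no ¬p) p = contradiction p ¬p

  ind-no : ∀ {p} {P : Set p} (d : Dec P) → ¬ P → ind d ≡ 0#
  ind-no (yes p) ¬p = contradiction p ¬p
  ind-no (no _)  _  = refl

  ind-cong : ∀ {p q} {P : Set p} {Q : Set q} (d : Dec P) (e : Dec Q) → (P → Q) → (Q → P) → ind d ≡ ind e
  ind-cong (yes p) e f g = ≡.sym (ind-yes e (f p))
  ind-cong (no ¬p) e f g = ≡.sym (ind-no e (¬p ∘ g))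

  δ : 𝔾 → A
  δ g x = ind (x ≟ g)

  infixl 7 _⋆_ _·ᵥ_
  infixl 6 _⊕_
  infix  8 ⊖_

  -- The kernel u (xy⁻¹) follows the adjacency relation of `Cay`, so that the adjacency operator is
  -- multiplication on the left.
  _⋆_ _⊕_ : A → A → A
  (u ⋆ v) x = ∑ λ y → u (x ∙ y ⁻¹) * v y
  (u ⊕ v) x = u x + v x

  ⊖_ : A → A
  (⊖ u) x = - u x

  _·ᵥ_ : K → A → A
  (a ·ᵥ u) x = a * u x

  𝟘 : A
  𝟘 x = 0#

  δ-⋆ : ∀ g v x → (δ g ⋆ v) x ≈ v (g ⁻¹ ∙ x)
  δ-⋆ g v x = begin
    ∑ (λ y → δ g (x ∙ y ⁻¹) * v y)
      ≈⟨ ∑-single _ (g ⁻¹ ∙ x) (λ y y≢ → ≈-trans (*-congʳ (reflexive (ind-no (_ ≟ g) (λ eq → y≢ (lem y eq))))) (zeroˡ _)) ⟩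
    δ g (x ∙ (g ⁻¹ ∙ x) ⁻¹) * v (g ⁻¹ ∙ x)
      ≈⟨ *-congʳ (reflexive (ind-yes (_ ≟ g) lem′)) ⟩
    1# * v (g ⁻¹ ∙ x) ≈⟨ *-identityˡ _ ⟩
    v (g ⁻¹ ∙ x) ∎
    where
    lem : ∀ y → x ∙ y ⁻¹ ≡ g → y ≡ g ⁻¹ ∙ x
    lem y refl = ≡.sym (≡.trans (cong (λ z → (x ∙ y ⁻¹) ⁻¹ ∙ z) (≡.sym (x∙y⁻¹∙y≡x x y))) (x⁻¹∙[x∙y]≡y (x ∙ y ⁻¹) y))
    lem′ : x ∙ (g ⁻¹ ∙ x) ⁻¹ ≡ g
    lem′ = ≡.trans (cong (x ∙_) (≡.trans (⁻¹-anti-homo-∙ (g ⁻¹) x) (cong (x ⁻¹ ∙_) (⁻¹-involutive g))))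
                   (x∙[x⁻¹∙y]≡y x g)

  δ-⋆-δ : ∀ g h → δ g ⋆ δ h ≋ δ (g ∙ h)
  δ-⋆-δ g h x = ≈-trans (δ-⋆ g (δ h) x) (reflexive (ind-cong (_ ≟ h) (_ ≟ g ∙ h)
    (λ eq → ≡.trans (≡.sym (x∙[x⁻¹∙y]≡y g x)) (cong (g ∙_) eq))
    (λ eq → ≡.trans (cong (g ⁻¹ ∙_) eq) (x⁻¹∙[x∙y]≡y g h))))

  ⋆-cong : ∀ {u u′ v v′} → u ≋ u′ → v ≋ v′ → u ⋆ v ≋ u′ ⋆ v′
  ⋆-cong eq eq′ x = ∑-cong (λ y → *-cong (eq _) (eq′ y))

  ⋆-assoc : ∀ u v w → (u ⋆ v) ⋆ w ≋ u ⋆ (v ⋆ w)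
  ⋆-assoc u v w x = begin
    ∑ (λ y → ∑ (λ z → u (x ∙ y ⁻¹ ∙ z ⁻¹) * v z) * w y)
      ≈⟨ ∑-cong (λ y → ∑-*ʳ (w y) _) ⟩
    ∑ (λ y → ∑ (λ z → u (x ∙ y ⁻¹ ∙ z ⁻¹) * v z * w y))
      ≈⟨ ∑-cong (λ y → ∑-reindex (_∙ y ⁻¹) (_∙ y) (λ z → x∙y∙y⁻¹≡x z y) (λ z → x∙y⁻¹∙y≡x z y) _) ⟩
    ∑ (λ y → ∑ (λ z → u (x ∙ y ⁻¹ ∙ (z ∙ y ⁻¹) ⁻¹) * v (z ∙ y ⁻¹) * w y))
      ≈⟨ ∑-swap _ ⟩
    ∑ (λ z → ∑ (λ y → u (x ∙ y ⁻¹ ∙ (z ∙ y ⁻¹) ⁻¹) * v (z ∙ y ⁻¹) * w y))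
      ≈⟨ ∑-cong (λ z → ∑-cong (λ y → ≈-trans (*-assoc _ _ _) (*-congʳ (reflexive (cong u (lem y z)))))) ⟩
    ∑ (λ z → ∑ (λ y → u (x ∙ z ⁻¹) * (v (z ∙ y ⁻¹) * w y)))
      ≈⟨ ∑-cong (λ z → ∑-* (u (x ∙ z ⁻¹)) _) ⟨
    ∑ (λ z → u (x ∙ z ⁻¹) * ∑ (λ y → v (z ∙ y ⁻¹) * w y)) ∎
    where
    lem : ∀ y z → x ∙ y ⁻¹ ∙ (z ∙ y ⁻¹) ⁻¹ ≡ x ∙ z ⁻¹
    lem y z = ≡.trans (cong (x ∙ y ⁻¹ ∙_) (≡.trans (⁻¹-anti-homo-∙ z (y ⁻¹)) (cong (_∙ z ⁻¹) (⁻¹-involutive y))))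
      (≡.trans (≡.sym (∙-assoc (x ∙ y ⁻¹) y (z ⁻¹))) (cong (_∙ z ⁻¹) (x∙y⁻¹∙y≡x x y)))

  ⋆-distribˡ : ∀ u v w → u ⋆ (v ⊕ w) ≋ (u ⋆ v) ⊕ (u ⋆ w)
  ⋆-distribˡ u v w x = ≈-trans (∑-cong (λ y → distribˡ _ _ _)) (∑-+ _ _)

  ⋆-distribʳ : ∀ w u v → (u ⊕ v) ⋆ w ≋ (u ⋆ w) ⊕ (v ⋆ w)
  ⋆-distribʳ w u v x = ≈-trans (∑-cong (λ y → distribʳ _ _ _)) (∑-+ _ _)

  ·ᵥ-congˡ : ∀ a {u v} → u ≋ v → a ·ᵥ u ≋ a ·ᵥ v
  ·ᵥ-congˡ a e x = *-congˡ (e x)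

  ⋆-·ᵥ : ∀ u a v → u ⋆ (a ·ᵥ v) ≋ a ·ᵥ (u ⋆ v)
  ⋆-·ᵥ u a v x = ≈-trans (∑-cong λ y → ≈-trans (≈-sym (*-assoc _ _ _))
    (≈-trans (*-congʳ (*-comm _ _)) (*-assoc _ _ _))) (≈-sym (∑-* a _))

  ·ᵥ-⋆ : ∀ a u v → (a ·ᵥ u) ⋆ v ≋ a ·ᵥ (u ⋆ v)
  ·ᵥ-⋆ a u v x = ≈-trans (∑-cong λ y → *-assoc _ _ _) (≈-sym (∑-* a _))

  ⋆-identityˡ : ∀ u → δ ε ⋆ u ≋ u
  ⋆-identityˡ u x = ≈-trans (δ-⋆ ε u x) (reflexive (cong u
    (≡.trans (cong (_∙ x) (≡.trans (≡.sym (identityˡ (ε ⁻¹))) (inverseʳ ε))) (identityˡ x))))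

  ⋆-flip : ∀ u v x → (u ⋆ v) x ≈ ∑ (λ y → u y * v (y ⁻¹ ∙ x))
  ⋆-flip u v x = ≈-trans (∑-reindex (λ y → y ⁻¹ ∙ x) (λ y → x ∙ y ⁻¹) lem lem′ _)
    (∑-cong (λ y → *-congʳ (reflexive (cong u (lem′ y)))))
    where
    lem : ∀ y → (x ∙ y ⁻¹) ⁻¹ ∙ x ≡ y
    lem y = ≡.trans (cong (_∙ x) (≡.trans (⁻¹-anti-homo-∙ x (y ⁻¹)) (cong (_∙ x ⁻¹) (⁻¹-involutive y)))) (x∙y⁻¹∙y≡x y x)
    lem′ : ∀ y → x ∙ (y ⁻¹ ∙ x) ⁻¹ ≡ y
    lem′ y = ≡.trans (cong (x ∙_) (≡.trans (⁻¹-anti-homo-∙ (y ⁻¹) x) (cong (x ⁻¹ ∙_) (⁻¹-involutive y)))) (x∙[x⁻¹∙y]≡y x y)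

  ⋆-identityʳ : ∀ u → u ⋆ δ ε ≋ u
  ⋆-identityʳ u x = begin
    (u ⋆ δ ε) x               ≈⟨ ∑-single _ ε (λ y y≢ε → ≈-trans (*-congˡ (reflexive (ind-no (y ≟ ε) y≢ε))) (zeroʳ _)) ⟩
    u (x ∙ ε ⁻¹) * δ ε ε      ≈⟨ *-congˡ (reflexive (ind-yes (ε ≟ ε) refl)) ⟩
    u (x ∙ ε ⁻¹) * 1#         ≈⟨ *-identityʳ _ ⟩
    u (x ∙ ε ⁻¹)              ≈⟨ reflexive (cong u (≡.trans (cong (_∙ ε ⁻¹) (≡.sym (identityʳ x))) (x∙y∙y⁻¹≡x x ε))) ⟩
    u x                       ∎

  ring : Ring c ℓ
  ring = record
    { Carrier = A ; _≈_ = _≋_ ; _+_ = _⊕_ ; _*_ = _⋆_ ; -_ = ⊖_ ; 0# = 𝟘 ; 1# = δ ε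
    ; isRing = record
      { +-isAbelianGroup = record
        { isGroup = record
          { isMonoid = record
            { isSemigroup = record
              { isMagma = record
                { isEquivalence = record
                  { refl = λ x → ≈-refl ; sym = λ e x → ≈-sym (e x) ; trans = λ e e′ x → ≈-trans (e x) (e′ x) }
                ; ∙-cong = λ e e′ x → +-cong (e x) (e′ x) }
              ; assoc = λ u v w x → +-assoc _ _ _ }
            ; identity = (λ u x → +-identityˡ _) , (λ u x → +-identityʳ _) }
          ; inverse = (λ u x → -‿inverseˡ _) , (λ u x → -‿inverseʳ _)
          ; ⁻¹-cong = λ e x → -‿cong (e x) }
        ; comm = λ u v x → +-comm _ _ }
      ; *-cong = ⋆-cong
      ; *-assoc = ⋆-assoc
      ; *-identity = ⋆-identityˡ , ⋆-identityʳ
      ; distrib = ⋆-distribˡ , ⋆-distribʳ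
      }
    }

  -- Reversing the order of a convolution costs at each y the exchange of
  -- v (y⁻¹x) with v (xy⁻¹).
  ⋆-comm : ∀ u v → (∀ x y → u y * v (y ⁻¹ ∙ x) ≈ u y * v (x ∙ y ⁻¹)) → u ⋆ v ≋ v ⋆ u
  ⋆-comm u v eq x = ≈-trans (⋆-flip u v x) (∑-cong (λ y → ≈-trans (eq x y) (*-comm _ _)))

  -- Since y⁻¹x is the conjugate of xy⁻¹ by y, the exchange required by `⋆-comm` is conjugation
  -- invariance.
  classFunction-central : ∀ v → (∀ x h → v (h ⁻¹ ∙ x ∙ h) ≈ v x) → ∀ u → u ⋆ v ≋ v ⋆ u
  classFunction-central v cf u = ⋆-comm u v λ x y → *-congˡ (≈-trans
    (reflexive (cong v (≡.sym (≡.trans (cong (_∙ y) (≡.sym (∙-assoc (y ⁻¹) x (y ⁻¹)))) (x∙y⁻¹∙y≡x (y ⁻¹ ∙ x) y)))))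
    (cf (x ∙ y ⁻¹) y))

-- The Frobenius map in a noncommutative ring of characteristic p

p∤m! : ∀ {p} → Prime p → ∀ m → m ℕ.< p → p ∤ m ℕ.!
p∤m! pr zero    m<p p∣1 = contradiction (∣⇒≤ p∣1) (ℕ.<⇒≱ (ℕ.nonTrivial⇒n>1 _ {{prime⇒nonTrivial pr}}))
p∤m! pr (suc m) m<p p∣m! with euclidsLemma (suc m) (m ℕ.!) pr p∣m!
... | inj₁ p∣1+m = contradiction (∣⇒≤ p∣1+m) (ℕ.<⇒≱ m<p)
... | inj₂ p∣m!  = p∤m! pr m (ℕ.<-trans (ℕ.n<1+n m) m<p) p∣m!

p∣pCk : ∀ {p} → Prime p → ∀ k → 1 ℕ.≤ k → k ℕ.< p → p ∣ p C k
p∣pCk {p} pr k 1≤k k<p with euclidsLemma (p C k) (k ℕ.! ℕ.* (p ℕ.∸ k) ℕ.!) pr p∣C*k!*[p-k]!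
  where
  instance
    _ = k ℕ.!* (p ℕ.∸ k) !≢0
  C*k!*[p-k]!≡p! : (p C k) ℕ.* (k ℕ.! ℕ.* (p ℕ.∸ k) ℕ.!) ≡ p ℕ.!
  C*k!*[p-k]!≡p! = ≡.trans (cong (ℕ._* (k ℕ.! ℕ.* (p ℕ.∸ k) ℕ.!)) (nCk≡n!/k![n-k]! (ℕ.<⇒≤ k<p)))
    (m/n*n≡m (k![n∸k]!∣n! (ℕ.<⇒≤ k<p)))
  p∣p! : ∀ q → .{{ℕ.NonZero q}} → q ∣ q ℕ.!
  p∣p! (suc q) = m∣m*n (q ℕ.!)
  p∣C*k!*[p-k]! = ≡.subst (p ∣_) (≡.sym C*k!*[p-k]!≡p!) (p∣p! p {{prime⇒nonZero pr}})
... | inj₁ p∣C = p∣C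
... | inj₂ p∣k!*[p-k]! with euclidsLemma (k ℕ.!) _ pr p∣k!*[p-k]!
... | inj₁ p∣k!     = contradiction p∣k! (p∤m! pr k k<p)
... | inj₂ p∣[p-k]! = contradiction p∣[p-k]!
  (p∤m! pr (p ℕ.∸ k) (ℕ.∸-monoʳ-< 1≤k (ℕ.<⇒≤ k<p)))

-- Serves to enlarge an exponent of nilpotency to a power of p, where the Frobenius map is additive.
n≤p^n : ∀ {p} → Prime p → ∀ n → n ℕ.≤ p ℕ.^ n
n≤p^n pr zero    = ℕ.z≤n
n≤p^n {p} pr (suc n) = ℕ.≤-trans (ℕ.s≤s (n≤p^n pr n)) (ℕ.^-monoʳ-< p (ℕ.nonTrivial⇒n>1 p {{prime⇒nonTrivial pr}}) (ℕ.n<1+n n))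

module Commuting {c ℓ} (R : Ring c ℓ) where
  open Ring R renaming (zero to *-zero; refl to ≈-refl; sym to ≈-sym; trans to ≈-trans)
  open SemiringExp semiring
  open SemiringSum semiring using (sum; *-distribˡ-sum; *-distribʳ-sum; sum-cong-≋)
  open RingProperties R using (-‿distribˡ-*; -‿distribʳ-*)
  open SetoidReasoning setoid

  Commute : Carrier → Carrier → Set ℓ
  Commute x y = x * y ≈ y * x

  commute-1 : ∀ x → Commute x 1#
  commute-1 x = ≈-trans (*-identityʳ x) (≈-sym (*-identityˡ x))

  commute-* : ∀ {x y z} → Commute x y → Commute x z → Commute x (y * z)
  commute-* {x} {y} {z} xy xz = begin
    x * (y * z) ≈⟨ *-assoc x y z ⟨
    x * y * z   ≈⟨ *-congʳ xy ⟩
    y * x * z   ≈⟨ *-assoc y x z ⟩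
    y * (x * z) ≈⟨ *-congˡ xz ⟩
    y * (z * x) ≈⟨ *-assoc y z x ⟨
    y * z * x   ∎

  commute-^ : ∀ {x y} → Commute x y → ∀ n → Commute x (y ^ n)
  commute-^ xy zero    = commute-1 _
  commute-^ xy (suc n) = commute-* xy (commute-^ xy n)

  commute-+ : ∀ {x y z} → Commute x y → Commute x z → Commute x (y + z)
  commute-+ xy xz = ≈-trans (distribˡ _ _ _) (≈-trans (+-cong xy xz) (≈-sym (distribʳ _ _ _)))

  commute-neg : ∀ {x y} → Commute x y → Commute x (- y)
  commute-neg xy = ≈-trans (≈-sym (-‿distribʳ-* _ _)) (≈-trans (-‿cong xy) (-‿distribˡ-* _ _))

  commute-sum : ∀ {m x} (u : Fin m → Carrier) → (∀ i → Commute x (u i)) → Commute x (sum u)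
  commute-sum u xu = ≈-trans (*-distribˡ-sum _ u) (≈-trans (sum-cong-≋ xu) (≈-sym (*-distribʳ-sum _ u)))

module Frobenius {c ℓ} (R : Ring c ℓ) {p} (p-prime : Prime p)
  (char : ∀ x → Ring._≈_ R (SemiringMult._×_ (Ring.semiring R) p x) (Ring.0# R)) where
  open Ring R renaming (zero to *-zero; refl to ≈-refl; sym to ≈-sym; trans to ≈-trans)
  open SemiringExp semiring
  open SemiringMult semiring using (×-congˡ; ×-congʳ; ×-assocˡ; ×-homo-1) renaming (_×_ to _·_)
  open SemiringSum semiring
  open RingProperties R using (-‿distribˡ-*; -‿distribʳ-*; -‿involutive)
  open Commuting R
  open SetoidReasoning setoid

  p∣m⇒m·x≈0 : ∀ {m} → p ∣ m → ∀ x → m · x ≈ 0#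
  p∣m⇒m·x≈0 (divides q refl) x = begin
    (q ℕ.* p) · x  ≡⟨ cong (_· x) (ℕ.*-comm q p) ⟩
    (p ℕ.* q) · x  ≈⟨ ×-assocˡ x p q ⟨
    p · (q · x)    ≈⟨ char (q · x) ⟩
    0#             ∎

  frobenius-+ : ∀ {x y} → Commute x y → (x + y) ^ p ≈ x ^ p + y ^ p
  frobenius-+ {x} {y} xy = ≈-trans (Binomial.theorem semiring x y xy p) (expand p refl)
    where
    open Binomial semiring x y using (binomialTerm; binomialExpansion)
    -- p is generalised to q, so that matching on a successor exposes the two end terms of the
    -- expansion; the equation keeps q prime for the middle ones.
    expand : ∀ q → p ≡ q → binomialExpansion q ≈ x ^ q + y ^ q
    expand zero    refl = contradiction p-prime ¬prime[0]
    expand (suc q) refl = begin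
      binomialTerm (suc q) zero + sum (λ i → binomialTerm (suc q) (suc i))
        ≈⟨ +-cong (≈-trans (×-homo-1 _) (*-identityˡ _)) (sum-init-last (λ i → binomialTerm (suc q) (suc i))) ⟩
      y ^ suc q + (sum (λ i → binomialTerm (suc q) (suc (Fin.inject₁ i))) + binomialTerm (suc q) (suc (Fin.fromℕ q)))
        ≈⟨ +-congˡ (+-cong (≈-trans (sum-cong-≋ middle) (sum-replicate-zero q)) top) ⟩
      y ^ suc q + (0# + x ^ suc q) ≈⟨ +-congˡ (+-identityˡ _) ⟩
      y ^ suc q + x ^ suc q        ≈⟨ +-comm _ _ ⟩
      x ^ suc q + y ^ suc q        ∎
      where
      middle : ∀ i → binomialTerm (suc q) (suc (Fin.inject₁ i)) ≈ 0#
      middle i = p∣m⇒m·x≈0 (p∣pCk p-prime (suc (toℕ (Fin.inject₁ i))) (ℕ.s≤s ℕ.z≤n)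
        (ℕ.s≤s (≡.subst (ℕ._< q) (≡.sym (Fin.toℕ-inject₁ i)) (Fin.toℕ<n i)))) _
      top : binomialTerm (suc q) (suc (Fin.fromℕ q)) ≈ x ^ suc q
      top = begin
        (suc q C suc k) · (x ^ suc k * y ^ (q ℕ.∸ k))
          ≡⟨ cong (λ j → (suc q C suc j) · (x ^ suc j * y ^ (q ℕ.∸ j))) (Fin.toℕ-fromℕ q) ⟩
        (suc q C suc q) · (x ^ suc q * y ^ (q ℕ.∸ q))
          ≡⟨ ≡.cong₂ (λ a b → a · (x ^ suc q * y ^ b)) (nCn≡1 (suc q)) (ℕ.n∸n≡0 q) ⟩
        1 · (x ^ suc q * 1#) ≈⟨ ≈-trans (×-homo-1 _) (*-identityʳ _) ⟩
        x ^ suc q ∎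
        where k = toℕ (Fin.fromℕ q)

  frobeniusⁱ-+ : ∀ i {x y} → Commute x y → (x + y) ^ (p ℕ.^ i) ≈ x ^ (p ℕ.^ i) + y ^ (p ℕ.^ i)
  frobeniusⁱ-+ zero {x} {y} xy = ≈-trans (*-identityʳ _) (+-cong (≈-sym (*-identityʳ x)) (≈-sym (*-identityʳ y)))
  frobeniusⁱ-+ (suc i) {x} {y} xy = begin
    (x + y) ^ (p ℕ.* p ℕ.^ i)     ≈⟨ ^-assocʳ (x + y) p (p ℕ.^ i) ⟨
    ((x + y) ^ p) ^ (p ℕ.^ i)     ≈⟨ ^-congˡ (p ℕ.^ i) (frobenius-+ xy) ⟩
    (x ^ p + y ^ p) ^ (p ℕ.^ i)   ≈⟨ frobeniusⁱ-+ i (commute-^ (≈-sym (commute-^ (≈-sym xy) p)) p) ⟩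
    (x ^ p) ^ (p ℕ.^ i) + (y ^ p) ^ (p ℕ.^ i)
      ≈⟨ +-cong (^-assocʳ x p (p ℕ.^ i)) (^-assocʳ y p (p ℕ.^ i)) ⟩
    x ^ (p ℕ.* p ℕ.^ i) + y ^ (p ℕ.* p ℕ.^ i) ∎

  0^p^i≈0 : ∀ i → 0# ^ (p ℕ.^ i) ≈ 0#
  0^p^i≈0 i with p ℕ.^ i | ℕ.m^n≢0 p i {{prime⇒nonZero p-prime}}
  ... | suc m | _ = zeroˡ _

  -- Additivity applied to - x + x = 0, which avoids separating p = 2 from odd p.
  frobeniusⁱ-neg : ∀ i x → (- x) ^ (p ℕ.^ i) ≈ - (x ^ (p ℕ.^ i))
  frobeniusⁱ-neg i x = begin
    a           ≈⟨ +-identityʳ a ⟨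
    a + 0#      ≈⟨ +-congˡ (-‿inverseʳ b) ⟨
    a + (b - b) ≈⟨ +-assoc a b (- b) ⟨
    a + b - b   ≈⟨ +-congʳ (frobeniusⁱ-+ i (≈-sym (commute-neg ≈-refl))) ⟨
    (- x + x) ^ (p ℕ.^ i) - b ≈⟨ +-congʳ (≈-trans (^-congˡ (p ℕ.^ i) (-‿inverseˡ x)) (0^p^i≈0 i)) ⟩
    0# - b      ≈⟨ +-identityˡ _ ⟩
    - b         ∎
    where
    a = (- x) ^ (p ℕ.^ i)
    b = x ^ (p ℕ.^ i)

  frobeniusⁱ-sum : ∀ i {m} (u : Fin m → Carrier) → (∀ j j′ → Commute (u j) (u j′)) →
                   sum u ^ (p ℕ.^ i) ≈ sum (λ j → u j ^ (p ℕ.^ i))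
  frobeniusⁱ-sum i {zero}  u uu = 0^p^i≈0 i
  frobeniusⁱ-sum i {suc m} u uu = ≈-trans
    (frobeniusⁱ-+ i (commute-sum (u ∘ suc) (λ j → uu zero (suc j))))
    (+-congˡ (frobeniusⁱ-sum i (u ∘ suc) (λ j j′ → uu (suc j) (suc j′))))

  ^p-fixed : Carrier → Set ℓ
  ^p-fixed x = x ^ p ≈ x

  ^p-fixed-+ : ∀ {x y} → Commute x y → ^p-fixed x → ^p-fixed y → ^p-fixed (x + y)
  ^p-fixed-+ xy fx fy = ≈-trans (frobenius-+ xy) (+-cong fx fy)

  private
    ^p : ∀ x → x ^ (p ℕ.^ 1) ≈ x ^ p
    ^p x = reflexive (cong (x ^_) (ℕ.*-identityʳ p))

  ^p-fixed-neg : ∀ {x} → ^p-fixed x → ^p-fixed (- x)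
  ^p-fixed-neg {x} fx = ≈-trans (≈-sym (^p (- x))) (≈-trans (frobeniusⁱ-neg 1 x) (-‿cong (≈-trans (^p x) fx)))

  -- If f is a root of a polynomial which splits over the prime field, then
  -- a power of X^p - X kills f, hence so does (X^p - X)^(p^i) = X^(p·p^i) - X^(p^i).
  module _ (f : Carrier) where
    annihilator : List Carrier → Carrier
    annihilator = foldr (λ a r → (f - a) * r) 1#

    f^p-f : Carrier
    f^p-f = f ^ p - f

    -- As a^p = a, additivity gives f^p - f = (f - a)^p - (f - a), from which f - a can be taken
    -- out.
    f^p-f-factor : ∀ a → Commute f a → ^p-fixed a → ∃ λ w → Commute f w × f^p-f ≈ w * (f - a)
    f^p-f-factor a fa a^p = w , commute-+ (commute-^ f[f-a] (ℕ.pred p)) (commute-neg (commute-1 f)) , (begin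
      f ^ p - f                               ≈⟨ +-congʳ (≈-trans (^-congˡ p f≈) (frobenius-+ (≈-sym (commute-neg′)))) ⟩
      (f - a) ^ p + a ^ p - f                 ≈⟨ +-congʳ (+-congˡ a^p) ⟩
      (f - a) ^ p + a - f                     ≈⟨ +-assoc _ _ _ ⟩
      (f - a) ^ p + (a - f)                   ≈⟨ +-congˡ (a-f) ⟩
      (f - a) ^ p + - (f - a)                 ≈⟨ +-cong (reflexive (cong ((f - a) ^_) (≡.sym (ℕ.suc-pred p {{prime⇒nonZero p-prime}})))) (-‿cong (≈-sym (*-identityˡ _))) ⟩
      (f - a) ^ suc (ℕ.pred p) + - (1# * (f - a)) ≈⟨ +-cong (commute-^ ≈-refl (ℕ.pred p)) (-‿distribˡ-* _ _) ⟩
      (f - a) ^ ℕ.pred p * (f - a) + - 1# * (f - a) ≈⟨ distribʳ _ _ _ ⟨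
      w * (f - a) ∎)
      where
      w = (f - a) ^ ℕ.pred p - 1#
      f[f-a] : Commute f (f - a)
      f[f-a] = commute-+ ≈-refl (commute-neg fa)
      f≈ : f ≈ f - a + a
      f≈ = ≈-sym (≈-trans (+-assoc _ _ _) (≈-trans (+-congˡ (-‿inverseˡ a)) (+-identityʳ f)))
      commute-neg′ : Commute a (f - a)
      commute-neg′ = commute-+ (≈-sym fa) (commute-neg ≈-refl)
      a-f : a - f ≈ - (f - a)
      a-f = begin
        a - f         ≈⟨ +-comm _ _ ⟩
        - f + a       ≈⟨ +-congˡ (-‿involutive a) ⟨
        - f + - - a   ≈⟨ ⁻¹-∙-comm f (- a) ⟩
        - (f - a)     ∎
        where open RingProperties R using () renaming (-‿+-comm to ⁻¹-∙-comm)

    -- One factor f^p - f is spent on each entry of the list, so repeated roots need no separate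
    -- treatment.
    [f^p-f]^length : ∀ as → All (λ a → Commute f a × ^p-fixed a) as →
               ∃ λ w → Commute f w × f^p-f ^ length as ≈ w * annihilator as
    [f^p-f]^length []       []               = 1# , commute-1 f , ≈-sym (*-identityˡ 1#)
    [f^p-f]^length (a ∷ as) ((fa , a^p) ∷ q) with f^p-f-factor a fa a^p | [f^p-f]^length as q
    ... | w , fw , factor≈ | w′ , fw′ , power≈ = w′ * w , commute-* fw′ fw , (begin
      f^p-f * f^p-f ^ length as                        ≈⟨ *-congˡ power≈ ⟩
      f^p-f * (w′ * annihilator as)                ≈⟨ *-assoc _ _ _ ⟨
      f^p-f * w′ * annihilator as                  ≈⟨ *-congʳ (≈-sym (commute-+ (commute-^ (≈-sym fw′) p) (commute-neg (≈-sym fw′)))) ⟩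
      w′ * f^p-f * annihilator as                  ≈⟨ *-congʳ (*-congˡ factor≈) ⟩
      w′ * (w * (f - a)) * annihilator as      ≈⟨ *-congʳ (*-assoc _ _ _) ⟨
      w′ * w * (f - a) * annihilator as        ≈⟨ *-assoc _ _ _ ⟩
      w′ * w * ((f - a) * annihilator as)      ∎)

    annihilated⇒^p^i-stable : ∀ as → All (λ a → Commute f a × ^p-fixed a) as → annihilator as ≈ 0# →
      f ^ (p ℕ.^ suc (length as)) ≈ f ^ (p ℕ.^ length as)
    annihilated⇒^p^i-stable as q ann≈0 with [f^p-f]^length as q
    ... | w , fw , power≈ = begin
      f ^ (p ℕ.* p ℕ.^ l)      ≈⟨ ^-assocʳ f p (p ℕ.^ l) ⟨
      (f ^ p) ^ (p ℕ.^ l)      ≈⟨ ^-congˡ (p ℕ.^ l) f^p≈ ⟩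
      (f^p-f + f) ^ (p ℕ.^ l)      ≈⟨ frobeniusⁱ-+ l (≈-sym (commute-+ (commute-^ ≈-refl p) (commute-neg ≈-refl))) ⟩
      f^p-f ^ (p ℕ.^ l) + f ^ (p ℕ.^ l) ≈⟨ +-congʳ [f^p-f]^p^l≈0 ⟩
      0# + f ^ (p ℕ.^ l)       ≈⟨ +-identityˡ _ ⟩
      f ^ (p ℕ.^ l)            ∎
      where
      l = length as
      f^p≈ : f ^ p ≈ f^p-f + f
      f^p≈ = ≈-sym (≈-trans (+-assoc _ _ _) (≈-trans (+-congˡ (-‿inverseˡ f)) (+-identityʳ _)))
      [f^p-f]^p^l≈0 : f^p-f ^ (p ℕ.^ l) ≈ 0#
      [f^p-f]^p^l≈0 = begin
        f^p-f ^ (p ℕ.^ l)                     ≡⟨ cong (f^p-f ^_) (ℕ.m+[n∸m]≡n (n≤p^n p-prime l)) ⟨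
        f^p-f ^ (l ℕ.+ (p ℕ.^ l ℕ.∸ l))       ≈⟨ ^-homo-* f^p-f l _ ⟩
        f^p-f ^ l * f^p-f ^ (p ℕ.^ l ℕ.∸ l)       ≈⟨ *-congʳ (≈-trans power≈ (≈-trans (*-congˡ ann≈0) (zeroʳ w))) ⟩
        0# * f^p-f ^ (p ℕ.^ l ℕ.∸ l)          ≈⟨ zeroˡ _ ⟩
        0#                                ∎

-- Integers inside a Heyting field

module HeytingFieldProperties {c ℓ₁ ℓ₂} (F : HeytingField c ℓ₁ ℓ₂) where
  open FieldDefs F public using (fromℤ; _·_; CharacteristicZero; commutativeRing; heytingCommutativeRing)
  open CommutativeRing commutativeRing public
    renaming (Carrier to K; refl to ≈-refl; sym to ≈-sym; trans to ≈-trans; zero to *-zero)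
  open HeytingField F public using (_#_; #-irrefl; #-sym; #-cotrans; tight; #⇒invertible)
  open HeytingProperties heytingCommutativeRing public
  open SemiringMult semiring using (×-homo-+; ×1-homo-*)
  open RingProperties ring public using (-0#≈0#; -‿involutive; -‿distribˡ-*; -‿+-comm)
  open SetoidReasoning setoid

  fromℤ-neg : ∀ i → fromℤ (ℤ.- i) ≈ - fromℤ i
  fromℤ-neg (+ zero)  = ≈-sym -0#≈0#
  fromℤ-neg (+ suc m) = ≈-refl
  fromℤ-neg -[1+ m ]  = ≈-sym (-‿involutive _)

  fromℤ-⊖ : ∀ m n → fromℤ (m ℤ.⊖ n) ≈ m · 1# - n · 1#
  fromℤ-⊖ m zero = ≈-sym (≈-trans (+-congˡ -0#≈0#) (+-identityʳ _))
  fromℤ-⊖ zero (suc n) = ≈-sym (+-identityˡ _)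
  fromℤ-⊖ (suc m) (suc n) = begin
    fromℤ (suc m ℤ.⊖ suc n)                  ≡⟨ cong fromℤ (ℤ.[1+m]⊖[1+n]≡m⊖n m n) ⟩
    fromℤ (m ℤ.⊖ n)                          ≈⟨ fromℤ-⊖ m n ⟩
    m · 1# - n · 1#                          ≈⟨ +-identityʳ _ ⟨
    m · 1# - n · 1# + 0#                     ≈⟨ +-congˡ (-‿inverseʳ 1#) ⟨
    m · 1# - n · 1# + (1# - 1#)              ≈⟨ +-comm _ _ ⟩
    (1# - 1#) + (m · 1# - n · 1#)            ≈⟨ +-assoc _ _ _ ⟩
    1# + (- 1# + (m · 1# - n · 1#))          ≈⟨ +-congˡ (≈-trans (≈-sym (+-assoc _ _ _)) (≈-trans (+-congʳ (+-comm _ _)) (+-assoc _ _ _))) ⟩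
    1# + (m · 1# + (- 1# - n · 1#))          ≈⟨ +-assoc _ _ _ ⟨
    suc m · 1# + (- 1# - n · 1#)             ≈⟨ +-congˡ (-‿+-comm _ _) ⟩
    suc m · 1# - suc n · 1#                  ∎

  fromℤ-+ : ∀ i j → fromℤ (i ℤ.+ j) ≈ fromℤ i + fromℤ j
  fromℤ-+ (+ m)    (+ n)    = ×-homo-+ 1# m n
  fromℤ-+ (+ m)    -[1+ n ] = fromℤ-⊖ m (suc n)
  fromℤ-+ -[1+ m ] (+ n)    = ≈-trans (fromℤ-⊖ n (suc m)) (+-comm _ _)
  fromℤ-+ -[1+ m ] -[1+ n ] = begin
    - (suc (suc (m ℕ.+ n)) · 1#)       ≡⟨ cong (λ k → - (k · 1#)) (cong suc (ℕ.+-suc m n)) ⟨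
    - ((suc m ℕ.+ suc n) · 1#)         ≈⟨ -‿cong (×-homo-+ 1# (suc m) (suc n)) ⟩
    - (suc m · 1# + suc n · 1#)        ≈⟨ -‿+-comm _ _ ⟨
    - (suc m · 1#) - suc n · 1#        ∎

  private
    fromℤ-*ℕ : ∀ m j → fromℤ (+ m ℤ.* j) ≈ m · 1# * fromℤ j
    fromℤ-*ℕ zero    j = ≈-trans (reflexive (cong fromℤ (ℤ.*-zeroˡ j))) (≈-sym (zeroˡ _))
    fromℤ-*ℕ (suc m) j = begin
      fromℤ (+ suc m ℤ.* j)               ≡⟨ cong fromℤ (ℤ.suc-* (+ m) j) ⟩
      fromℤ (j ℤ.+ + m ℤ.* j)             ≈⟨ fromℤ-+ j (+ m ℤ.* j) ⟩
      fromℤ j + fromℤ (+ m ℤ.* j)         ≈⟨ +-cong (≈-sym (*-identityˡ _)) (fromℤ-*ℕ m j) ⟩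
      1# * fromℤ j + m · 1# * fromℤ j     ≈⟨ distribʳ _ _ _ ⟨
      suc m · 1# * fromℤ j                ∎

  fromℤ-* : ∀ i j → fromℤ (i ℤ.* j) ≈ fromℤ i * fromℤ j
  fromℤ-* (+ m)    j = fromℤ-*ℕ m j
  fromℤ-* -[1+ m ] j = begin
    fromℤ (-[1+ m ] ℤ.* j)          ≡⟨ cong fromℤ (ℤ.neg-distribˡ-* (+ suc m) j) ⟨
    fromℤ (ℤ.- (+ suc m ℤ.* j))     ≈⟨ fromℤ-neg (+ suc m ℤ.* j) ⟩
    - fromℤ (+ suc m ℤ.* j)         ≈⟨ -‿cong (fromℤ-*ℕ (suc m) j) ⟩
    - (suc m · 1# * fromℤ j)        ≈⟨ -‿distribˡ-* _ _ ⟩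
    fromℤ -[1+ m ] * fromℤ j        ∎

  fromℤ-1 : fromℤ (+ 1) ≈ 1#
  fromℤ-1 = +-identityʳ 1#

  private
    -- The solver takes its coefficients from ℤ, because equality in K cannot be decided. Hence
    -- `con (+ 1)` denotes 1# + 0# rather than 1#; later calls either correct this by `fromℤ-1` or
    -- pass 1# as a variable.
    ℤ⟶K : ℤ.+-*-rawRing -Raw-AlmostCommutative⟶ fromCommutativeRing commutativeRing
    ℤ⟶K = record { ⟦_⟧ = fromℤ ; +-homo = fromℤ-+ ; *-homo = fromℤ-* ; -‿homo = fromℤ-neg
                 ; 0-homo = ≈-refl ; 1-homo = fromℤ-1 }

    coeff≟ : ∀ i j → Maybe (fromℤ i ≈ fromℤ j)
    coeff≟ i j with i ℤ.≟ j
    ... | yes refl = just ≈-refl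
    ... | no _     = nothing

  module Solver = RingSolver ℤ.+-*-rawRing (fromCommutativeRing commutativeRing) ℤ⟶K coeff≟

  module _ (char0 : CharacteristicZero) where
    fromℤ≈0⇒≡0 : ∀ i → fromℤ i ≈ 0# → i ≡ + 0
    fromℤ≈0⇒≡0 (+ zero)  _  = refl
    fromℤ≈0⇒≡0 (+ suc m) eq = contradiction (char0 m) (#-irrefl eq)
    fromℤ≈0⇒≡0 -[1+ m ]  eq = contradiction (char0 m) (#-irrefl (begin
      suc m · 1#       ≈⟨ -‿involutive _ ⟨
      - - (suc m · 1#) ≈⟨ -‿cong eq ⟩
      - 0#             ≈⟨ -0#≈0# ⟩
      0#               ∎))

    fromℤ-injective : ∀ i j → fromℤ i ≈ fromℤ j → i ≡ j
    fromℤ-injective i j eq = ℤ.i-j≡0⇒i≡j i j (fromℤ≈0⇒≡0 (i ℤ.- j) (begin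
      fromℤ (i ℤ.- j)            ≈⟨ fromℤ-+ i (ℤ.- j) ⟩
      fromℤ i + fromℤ (ℤ.- j)    ≈⟨ +-cong eq (fromℤ-neg j) ⟩
      fromℤ j - fromℤ j          ≈⟨ -‿inverseʳ _ ⟩
      0#                         ∎))

  #0⇒inverse : ∀ {x} → x # 0# → ∃ λ y → y * x ≈ 1#
  #0⇒inverse {x} x#0 with #⇒invertible x#0
  ... | y , yx≈1 , _ = y , ≈-trans (*-congˡ (≈-sym (x-0≈x x))) yx≈1

  *-cancelʳ-#0 : ∀ {x y z} → z # 0# → x * z ≈ y * z → x ≈ y
  *-cancelʳ-#0 {x} {y} {z} z#0 eq with #0⇒inverse z#0
  ... | w , wz≈1 = begin
    x             ≈⟨ cancel x ⟨
    x * z * w     ≈⟨ *-congʳ eq ⟩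
    y * z * w     ≈⟨ cancel y ⟩
    y             ∎
    where
    cancel : ∀ x → x * z * w ≈ x
    cancel x = ≈-trans (*-assoc x z w) (≈-trans (*-congˡ (≈-trans (*-comm z w) wz≈1)) (*-identityʳ x))

  ¬#⇒≈ : ∀ {x y} → ¬ (x # y) → x ≈ y
  ¬#⇒≈ = proj₁ (tight _ _)

  -- Cotransitivity places y between x + y and 0. If x + y is apart from y, their difference x is
  -- invertible.
  x+y#0⇒ : ∀ {x y} → x + y # 0# → x # 0# ⊎ y # 0#
  x+y#0⇒ {x} {y} x+y#0 with #-cotrans x+y#0 y
  ... | inj₂ y#0   = inj₂ y#0
  ... | inj₁ x+y#y with #⇒invertible x+y#y
  ...   | w , wx≈1 , _ = inj₁ (invertibleˡ⇒# (w , ≈-trans (*-congˡ (begin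
      x - 0#     ≈⟨ x-0≈x x ⟩
      x          ≈⟨ +-identityʳ x ⟨
      x + 0#     ≈⟨ +-congˡ (-‿inverseʳ y) ⟨
      x + (y - y) ≈⟨ +-assoc _ _ _ ⟨
      x + y - y  ∎)) wx≈1))

-- Annihilating polynomials and their roots

module LinearAlgebra {c ℓ₁ ℓ₂} (F : HeytingField c ℓ₁ ℓ₂) where
  open HeytingFieldProperties F
  open SemiringSum semiring
  open SetoidReasoning setoid
  open Solver using (solve; con; _:+_; _:*_; _:-_; :-_; _:=_)

  -- The monic polynomial with lower coefficients p, with uᵢ in the place of Xⁱ.
  monic : ∀ {ℓ} {X : Set ℓ} (u : ℕ → X → K) d (p : Fin d → K) → X → K
  monic u d p x = u d x + sum (λ i → p i * u (toℕ i) x)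

  -- Gaussian elimination with u₀ as pivot; whether u₀ vanishes is only decidable under ¬¬.
  ¬¬monic-relation : ∀ m (u : ℕ → Fin m → K) →
    ¬ ¬ ∃ λ d → ∃ λ (p : Fin d → K) → ∀ x → monic u d p x ≈ 0#
  ¬¬monic-relation zero    u k = k (0 , (λ ()) , λ ())
  ¬¬monic-relation (suc m) u k = ¬¬-excluded-middle λ
    { (no u₀≈0) → k (0 , (λ ()) , λ x → ≈-trans (+-identityʳ _) (¬#⇒≈ (λ u₀#0 → u₀≈0 (x , u₀#0))))
    ; (yes (x₀ , u₀#0)) → pivot x₀ u₀#0 }
    where
    pivot : ∀ x₀ → ¬ (u 0 x₀ # 0#)
    pivot x₀ u₀#0 with #0⇒inverse u₀#0
    ... | w , wu≈1 = ¬¬monic-relation m (λ i y → r i (Fin.punchIn x₀ y)) λ (d , p , eq) →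
      k (suc d , extend d p , λ x → ≈-trans (regroup d p x) (relation d p eq x))
      where
      t : ℕ → K
      t i = u (suc i) x₀ * w
      r : ℕ → Fin (suc m) → K
      r i x = u (suc i) x - t i * u 0 x
      r₀≈0 : ∀ i → r i x₀ ≈ 0#
      r₀≈0 i = begin
        u (suc i) x₀ - u (suc i) x₀ * w * u 0 x₀   ≈⟨ +-congˡ (-‿cong (≈-trans (*-assoc _ _ _) (≈-trans (*-congˡ wu≈1) (*-identityʳ _)))) ⟩
        u (suc i) x₀ - u (suc i) x₀                ≈⟨ -‿inverseʳ _ ⟩
        0#                                         ∎
      -- Since `r i` is `u (suc i)` minus `t i` times `u 0`, a relation of degree d among the r has
      -- degree d + 1 in u. Its new coefficient at index 0 collects all the subtracted multiples of
      -- `u 0`.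
      extend : ∀ d → (Fin d → K) → Fin (suc d) → K
      extend d p zero    = - (t d + sum (λ i → p i * t (toℕ i)))
      extend d p (suc i) = p i
      regroup : ∀ d p x → monic u (suc d) (extend d p) x ≈ monic r d p x
      regroup d p x = begin
        a + (- (t d + s) * b + sum (λ i → p i * u (suc (toℕ i)) x))
          ≈⟨ solve 5 (λ a td s b c → a :+ (:- (td :+ s) :* b :+ c) := (a :- td :* b) :+ (c :+ s :* (:- b)))
               ≈-refl a (t d) s b (sum (λ i → p i * u (suc (toℕ i)) x)) ⟩
        r d x + (sum (λ i → p i * u (suc (toℕ i)) x) + s * (- b))
          ≈⟨ +-congˡ (+-congˡ (*-distribʳ-sum (- b) (λ i → p i * t (toℕ i)))) ⟩
        r d x + (sum (λ i → p i * u (suc (toℕ i)) x) + sum (λ i → p i * t (toℕ i) * (- b)))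
          ≈⟨ +-congˡ (∑-distrib-+ (λ i → p i * u (suc (toℕ i)) x) _) ⟨
        r d x + sum (λ i → p i * u (suc (toℕ i)) x + p i * t (toℕ i) * (- b))
          ≈⟨ +-congˡ (sum-cong-≋ (λ i → solve 4 (λ p u t b → p :* u :+ p :* t :* (:- b) := p :* (u :- t :* b))
               ≈-refl (p i) (u (suc (toℕ i)) x) (t (toℕ i)) b)) ⟩
        r d x + sum (λ i → p i * r (toℕ i) x) ∎
        where
        a = u (suc d) x
        b = u 0 x
        s = sum (λ i → p i * t (toℕ i))
      relation : ∀ d p → (∀ y → monic (λ i y → r i (Fin.punchIn x₀ y)) d p y ≈ 0#) → ∀ x → monic r d p x ≈ 0#
      relation d p eq x with x₀ Fin.≟ x
      ... | no x₀≢x   = ≡.subst (λ x → monic r d p x ≈ 0#) (Fin.punchIn-punchOut x₀≢x) (eq (Fin.punchOut x₀≢x))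
      ... | yes refl = begin
        r d x₀ + sum (λ i → p i * r (toℕ i) x₀)
          ≈⟨ +-cong (r₀≈0 d) (sum-cong-≋ (λ i → ≈-trans (*-congˡ (r₀≈0 (toℕ i))) (zeroʳ (p i)))) ⟩
        0# + sum {d} (λ i → 0#)  ≈⟨ +-identityˡ _ ⟩
        sum {d} (λ i → 0#)       ≈⟨ sum-replicate-zero d ⟩
        0#                       ∎

  -- X is arbitrary so that a scalar counts as an operator on the one-dimensional space X = ⊤.
  -- Evaluating a polynomial at a scalar and applying it to an operator then share one Horner
  -- scheme.
  record LinearOperator {ℓ} (X : Set ℓ) : Set (c ⊔ ℓ₁ ⊔ ℓ) where
    field
      ⟦_⟧    : (X → K) → (X → K)
      ⟦⟧-cong : ∀ {v w} → (∀ x → v x ≈ w x) → ∀ x → ⟦ v ⟧ x ≈ ⟦ w ⟧ x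
      ⟦⟧-+    : ∀ v w x → ⟦ (λ y → v y + w y) ⟧ x ≈ ⟦ v ⟧ x + ⟦ w ⟧ x
      ⟦⟧-*    : ∀ a v x → ⟦ (λ y → a * v y) ⟧ x ≈ a * ⟦ v ⟧ x

    iterate : (X → K) → ℕ → X → K
    iterate w zero    = w
    iterate w (suc n) = ⟦ iterate w n ⟧

    -- p lists only the lower coefficients; the leading coefficient 1 is the bare w of the base
    -- case.
    horner : ∀ {d} → (Fin d → K) → (X → K) → (X → K)
    horner {zero}  p w = w
    horner {suc d} p w x = p zero * w x + ⟦ horner (p ∘ suc) w ⟧ x

    ⟦⟧-sum : ∀ {d} (v : Fin d → X → K) x → ⟦ (λ y → sum (λ i → v i y)) ⟧ x ≈ sum (λ i → ⟦ v i ⟧ x)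
    ⟦⟧-sum {zero}  v x = begin
      ⟦ (λ y → 0#) ⟧ x           ≈⟨ ⟦⟧-cong (λ y → zeroˡ 0#) x ⟨
      ⟦ (λ y → 0# * 0#) ⟧ x      ≈⟨ ⟦⟧-* 0# (λ y → 0#) x ⟩
      0# * ⟦ (λ y → 0#) ⟧ x      ≈⟨ zeroˡ _ ⟩
      0#                         ∎
    ⟦⟧-sum {suc d} v x = ≈-trans (⟦⟧-+ (v zero) _ x) (+-congˡ (⟦⟧-sum (v ∘ suc) x))

    horner≈monic : ∀ {d} (p : Fin d → K) w x → horner p w x ≈ monic (iterate w) d p x
    horner≈monic {zero}  p w x = ≈-sym (+-identityʳ _)
    horner≈monic {suc d} p w x = begin
      p zero * w x + ⟦ horner (p ∘ suc) w ⟧ x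
        ≈⟨ +-congˡ (⟦⟧-cong (horner≈monic (p ∘ suc) w) x) ⟩
      p zero * w x + ⟦ monic (iterate w) d (p ∘ suc) ⟧ x
        ≈⟨ +-congˡ (⟦⟧-+ _ _ x) ⟩
      p zero * w x + (iterate w (suc d) x + ⟦ (λ y → sum (λ i → p (suc i) * iterate w (toℕ i) y)) ⟧ x)
        ≈⟨ +-congˡ (+-congˡ (≈-trans (⟦⟧-sum (λ i y → p (suc i) * iterate w (toℕ i) y) x)
             (sum-cong-≋ (λ i → ⟦⟧-* (p (suc i)) (iterate w (toℕ i)) x)))) ⟩
      p zero * w x + (iterate w (suc d) x + sum (λ i → p (suc i) * iterate w (suc (toℕ i)) x))
        ≈⟨ solve 3 (λ a b c → a :+ (b :+ c) := b :+ (a :+ c)) ≈-refl _ _ _ ⟩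
      iterate w (suc d) x + (p zero * w x + sum (λ i → p (suc i) * iterate w (suc (toℕ i)) x)) ∎

    annihilate : List K → (X → K) → (X → K)
    annihilate []       w = w
    annihilate (a ∷ as) w x = ⟦ annihilate as w ⟧ x - a * annihilate as w x

    ⟦⟧-linear : ∀ b v w x → ⟦ (λ y → v y - b * w y) ⟧ x ≈ ⟦ v ⟧ x - b * ⟦ w ⟧ x
    ⟦⟧-linear b v w x = begin
      ⟦ (λ y → v y - b * w y) ⟧ x      ≈⟨ ⟦⟧-cong (λ y → +-congˡ (-‿distribˡ-* b (w y))) x ⟩
      ⟦ (λ y → v y + - b * w y) ⟧ x    ≈⟨ ⟦⟧-+ v _ x ⟩
      ⟦ v ⟧ x + ⟦ (λ y → - b * w y) ⟧ x ≈⟨ +-congˡ (⟦⟧-* (- b) w x) ⟩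
      ⟦ v ⟧ x + - b * ⟦ w ⟧ x          ≈⟨ +-congˡ (-‿distribˡ-* b _) ⟨
      ⟦ v ⟧ x - b * ⟦ w ⟧ x            ∎

    -- Polynomials in one operator commute. This lets a factor with integer root be absorbed into
    -- the vector w, so that the search for integer roots can go on with the shorter list.
    annihilate-comm : ∀ as b w x → annihilate as (λ y → ⟦ w ⟧ y - b * w y) x ≈ annihilate (b ∷ as) w x
    annihilate-comm []       b w x = ≈-refl
    annihilate-comm (a ∷ as) b w x = begin
      ⟦ annihilate as (λ y → ⟦ w ⟧ y - b * w y) ⟧ x - a * annihilate as (λ y → ⟦ w ⟧ y - b * w y) x
        ≈⟨ +-cong (⟦⟧-cong (annihilate-comm as b w) x) (-‿cong (*-congˡ (annihilate-comm as b w x))) ⟩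
      ⟦ annihilate (b ∷ as) w ⟧ x - a * (⟦ v ⟧ x - b * v x)
        ≈⟨ +-congʳ (⟦⟧-linear b ⟦ v ⟧ v x) ⟩
      ⟦ ⟦ v ⟧ ⟧ x - b * ⟦ v ⟧ x - a * (⟦ v ⟧ x - b * v x)
        ≈⟨ solve 5 (λ a b u v w → u :- b :* v :- a :* (v :- b :* w) := u :- a :* v :- b :* (v :- a :* w)) ≈-refl a b (⟦ ⟦ v ⟧ ⟧ x) (⟦ v ⟧ x) (v x) ⟩
      ⟦ ⟦ v ⟧ ⟧ x - a * ⟦ v ⟧ x - b * (⟦ v ⟧ x - a * v x)
        ≈⟨ +-congʳ (⟦⟧-linear a ⟦ v ⟧ v x) ⟨
      ⟦ annihilate (a ∷ as) w ⟧ x - b * annihilate (a ∷ as) w x ∎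
      where
      v = annihilate as w

  multiplication : K → LinearOperator ⊤
  multiplication r = record
    { ⟦_⟧     = λ w x → r * w x
    ; ⟦⟧-cong = λ eq x → *-congˡ (eq x)
    ; ⟦⟧-+    = λ v w x → distribˡ r (v x) (w x)
    ; ⟦⟧-*    = λ a v x → solve 3 (λ r a v → r :* (a :* v) := a :* (r :* v)) ≈-refl r a (v x)
    }

  evaluate : ∀ {d} → (Fin d → K) → K → K
  evaluate p r = LinearOperator.horner (multiplication r) p (λ _ → 1#) tt

  -- Synthetic division by X - r: the coefficients of the quotient are the Horner values of the
  -- tails of p, and the value of p itself is the remainder.
  quotient : ∀ {d} → (Fin (suc d) → K) → K → Fin d → K
  quotient {suc d} p r zero    = evaluate (p ∘ suc) r
  quotient {suc d} p r (suc i) = quotient (p ∘ suc) r i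

  module _ {ℓ} {X : Set ℓ} (f : LinearOperator X) where
    open LinearOperator f

    horner-quotient : ∀ {d} (p : Fin (suc d) → K) r w x → let q = horner (quotient p r) w in
      horner p w x ≈ ⟦ q ⟧ x - r * q x + evaluate p r * w x
    horner-quotient {zero}  p r w x = ≈-trans
      (solve 4 (λ p w fw r → p :* w :+ fw := fw :- r :* w :+ (p :* con (+ 1) :+ r :* con (+ 1)) :* w)
        ≈-refl (p zero) (w x) (⟦ w ⟧ x) r)
      (+-congˡ (*-congʳ (+-cong (*-congˡ fromℤ-1) (*-congˡ fromℤ-1))))
    horner-quotient {suc d} p r w x = begin
      p zero * w x + ⟦ horner (p ∘ suc) w ⟧ x
        ≈⟨ +-congˡ (⟦⟧-cong (horner-quotient (p ∘ suc) r w) x) ⟩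
      p zero * w x + ⟦ (λ y → ⟦ q ⟧ y - r * q y + s * w y) ⟧ x
        ≈⟨ +-congˡ (≈-trans (⟦⟧-+ _ _ x) (+-cong (⟦⟧-linear r ⟦ q ⟧ q x) (⟦⟧-* s w x))) ⟩
      p zero * w x + (⟦ ⟦ q ⟧ ⟧ x - r * ⟦ q ⟧ x + s * ⟦ w ⟧ x)
        ≈⟨ solve 7 (λ p w ffq r fq s fw → p :* w :+ (ffq :- r :* fq :+ s :* fw) :=
             s :* fw :+ ffq :- r :* (s :* w :+ fq) :+ (p :+ r :* s) :* w) ≈-refl
             (p zero) (w x) (⟦ ⟦ q ⟧ ⟧ x) r (⟦ q ⟧ x) s (⟦ w ⟧ x) ⟩
      s * ⟦ w ⟧ x + ⟦ ⟦ q ⟧ ⟧ x - r * (s * w x + ⟦ q ⟧ x) + (p zero + r * s) * w x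
        ≈⟨ +-cong (+-congʳ (≈-trans (⟦⟧-+ _ _ x) (+-congʳ (⟦⟧-* s w x)))) (*-congʳ (+-congʳ (*-identityʳ _))) ⟨
      ⟦ (λ y → s * w y + ⟦ q ⟧ y) ⟧ x - r * (s * w x + ⟦ q ⟧ x) + (p zero * 1# + r * s) * w x ∎
      where
      q = horner (quotient (p ∘ suc) r) w
      s = evaluate (p ∘ suc) r

  module _ (algebraicallyClosed : FieldDefs.AlgebraicallyClosed F) where

    root : ∀ {d} (p : Fin (suc d) → K) → ∃ λ r → evaluate p r ≈ 0#
    root {d} p with algebraicallyClosed d p
    ... | r , eq = r , ≈-trans (LinearOperator.horner≈monic (multiplication r) p (λ _ → 1#) tt)
      (≈-trans (+-cong (power (suc d)) (sum-cong-≋ (λ i → *-congˡ {p i} (power (toℕ i))))) eq)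
      where
      open FieldDefs F using (_^ᴷ_)
      power : ∀ n → LinearOperator.iterate (multiplication r) (λ _ → 1#) n tt ≈ r ^ᴷ n
      power zero    = ≈-refl
      power (suc n) = *-congˡ (power n)

    module _ {ℓ} {X : Set ℓ} (f : LinearOperator X) where
      open LinearOperator f

      splits : ∀ d (p : Fin d → K) → ∃ λ as → ∀ w x → horner p w x ≈ annihilate as w x
      splits zero    p = [] , λ w x → ≈-refl
      splits (suc d) p = r ∷ as , λ w x → begin
        horner p w x
          ≈⟨ horner-quotient f p r w x ⟩
        ⟦ horner (quotient p r) w ⟧ x - r * horner (quotient p r) w x + evaluate p r * w x
          ≈⟨ +-cong (+-cong (⟦⟧-cong (eq w) x) (-‿cong (*-congˡ (eq w x)))) (≈-trans (*-congʳ (proj₂ (root p))) (zeroˡ _)) ⟩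
        annihilate (r ∷ as) w x + 0#
          ≈⟨ +-identityʳ _ ⟩
        annihilate (r ∷ as) w x ∎
        where
        r  = proj₁ (root p)
        as = proj₁ (splits d (quotient p r))
        eq = proj₂ (splits d (quotient p r))

    module _ {m} (f : LinearOperator (Fin m)) where
      open LinearOperator f

      IntegralSpectrum : Set (c ⊔ ℓ₁ ⊔ ℓ₂)
      IntegralSpectrum = ∀ a v → (∃ λ x → v x # 0#) → (∀ x → ⟦ v ⟧ x ≈ a * v x) → ∃ λ z → a ≈ fromℤ z

      -- Each factor f − a either has an integer a, or can be dropped since the
      -- vector it kills is already zero.
      ¬¬integral-roots : IntegralSpectrum → ∀ as w → (∀ x → annihilate as w x ≈ 0#) →
        ¬ ¬ ∃ λ zs → ∀ x → annihilate (map fromℤ zs) w x ≈ 0#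
      ¬¬integral-roots int []       w eq k = k ([] , eq)
      ¬¬integral-roots int (a ∷ as) w eq k = ¬¬-excluded-middle λ
        { (no ≈0)         → ¬¬integral-roots int as w (λ x → ¬#⇒≈ (λ #0 → ≈0 (x , #0))) k
        ; (yes eigenvector) → eigenvalue eigenvector }
        where
        v = annihilate as w
        eigenvalue : ¬ (∃ λ x → v x # 0#)
        eigenvalue v#0 with int a v v#0 (λ x → begin
            ⟦ v ⟧ x                       ≈⟨ solve 2 (λ p q → p := p :- q :+ q) ≈-refl _ (a * v x) ⟩
            ⟦ v ⟧ x - a * v x + a * v x   ≈⟨ +-congʳ (eq x) ⟩
            0# + a * v x                  ≈⟨ +-identityˡ _ ⟩
            a * v x                       ∎)
        ... | z , a≈z = ¬¬integral-roots int as (λ y → ⟦ w ⟧ y - fromℤ z * w y)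
          (λ x → begin
            annihilate as (λ y → ⟦ w ⟧ y - fromℤ z * w y) x  ≈⟨ annihilate-comm as (fromℤ z) w x ⟩
            ⟦ v ⟧ x - fromℤ z * v x                          ≈⟨ +-congˡ (-‿cong (*-congʳ a≈z)) ⟨
            ⟦ v ⟧ x - a * v x                                ≈⟨ eq x ⟩
            0#                                               ∎)
          λ (zs , eq′) → k (z ∷ zs , λ x → ≈-trans (≈-sym (annihilate-comm (map fromℤ zs) (fromℤ z) w x)) (eq′ x))

      ¬¬integral-annihilator : IntegralSpectrum → ∀ w → ¬ ¬ ∃ λ zs → ∀ x → annihilate (map fromℤ zs) w x ≈ 0#
      ¬¬integral-annihilator int w k = ¬¬monic-relation m (iterate w) λ (d , p , eq) →
        let as , split = splits f d p in
        ¬¬integral-roots int as w (λ x → ≈-trans (≈-sym (split w x)) (≈-trans (horner≈monic p w x) (eq x))) k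

-- The group ring modulo p

ℤ-ring : CommutativeRing 0ℓ 0ℓ
ℤ-ring = ℤ.+-*-commutativeRing

module IntegersModulo (m : ℕ) where
  infix 4 _≡ₘ_
  -- A record, so that i and j can be inferred from a proof.
  record _≡ₘ_ (i j : ℤ) : Set where
    constructor mk
    field m∣i-j : + m ∣ℤ i ℤ.- j
  open _≡ₘ_ public

  reflexiveₘ : ∀ {i j} → i ≡ j → i ≡ₘ j
  reflexiveₘ {i} refl = mk (dividesℤ (+ 0) (ℤ.+-inverseʳ i))

  -- ℤ/m is ℤ with a coarser equality. Integer-valued functions on G thus belong to both group
  -- rings, and reduction modulo p leaves them as they are.
  ring : CommutativeRing 0ℓ 0ℓ
  ring = record
    { Carrier = ℤ ; _≈_ = _≡ₘ_ ; _+_ = ℤ._+_ ; _*_ = ℤ._*_ ; -_ = ℤ.-_ ; 0# = + 0 ; 1# = + 1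
    ; isCommutativeRing = record
      { isRing = record
        { +-isAbelianGroup = record
          { isGroup = record
            { isMonoid = record
              { isSemigroup = record
                { isMagma = record
                  { isEquivalence = record
                    { refl  = reflexiveₘ refl
                    ; sym   = λ {i} {j} (mk d) → mk (≡.subst (+ m ∣ℤ_) (neg-minus i j) (ℤ∣.∣m⇒∣-m d))
                    ; trans = λ {i} {j} {k} (mk d) (mk e) → mk (≡.subst (+ m ∣ℤ_) (minus-trans i j k) (ℤ∣.∣m∣n⇒∣m+n d e))
                    }
                  ; ∙-cong = λ {i} {j} {k} {l} (mk d) (mk e) → mk (≡.subst (+ m ∣ℤ_) (minus-+ i j k l) (ℤ∣.∣m∣n⇒∣m+n d e))
                  }
                ; assoc = λ i j k → reflexiveₘ (ℤ.+-assoc i j k) }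
              ; identity = (λ i → reflexiveₘ (ℤ.+-identityˡ i)) , (λ i → reflexiveₘ (ℤ.+-identityʳ i)) }
            ; inverse = (λ i → reflexiveₘ (ℤ.+-inverseˡ i)) , (λ i → reflexiveₘ (ℤ.+-inverseʳ i))
            ; ⁻¹-cong = λ {i} {j} (mk d) → mk (≡.subst (+ m ∣ℤ_) (minus-neg i j) (ℤ∣.∣m⇒∣-m d)) }
          ; comm = λ i j → reflexiveₘ (ℤ.+-comm i j) }
        ; *-cong = λ {i} {j} {k} {l} (mk d) (mk e) → mk (≡.subst (+ m ∣ℤ_) (minus-* i j k l)
            (ℤ∣.∣m∣n⇒∣m+n (ℤ∣.∣m⇒∣m*n k d) (ℤ∣.∣n⇒∣m*n j e)))
        ; *-assoc = λ i j k → reflexiveₘ (ℤ.*-assoc i j k)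
        ; *-identity = (λ i → reflexiveₘ (ℤ.*-identityˡ i)) , (λ i → reflexiveₘ (ℤ.*-identityʳ i))
        ; distrib = (λ i j k → reflexiveₘ (ℤ.*-distribˡ-+ i j k)) , (λ i j k → reflexiveₘ (ℤ.*-distribʳ-+ i j k)) }
      ; *-comm = λ i j → reflexiveₘ (ℤ.*-comm i j) } }
    where
    infixl 6 _+_ _-_
    infixl 7 _*_
    infix 8 -_
    _+_ _-_ _*_ : ℤ → ℤ → ℤ
    _+_ = ℤ._+_
    _-_ = ℤ._-_
    _*_ = ℤ._*_
    -_ : ℤ → ℤ
    -_ = ℤ.-_
    neg-minus : ∀ i j → - (i - j) ≡ j - i
    neg-minus = ℤ-Solver.solve-∀
    minus-trans : ∀ i j k → i - j + (j - k) ≡ i - k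
    minus-trans = ℤ-Solver.solve-∀
    minus-+ : ∀ i j k l → i - j + (k - l) ≡ (i + k) - (j + l)
    minus-+ = ℤ-Solver.solve-∀
    minus-neg : ∀ i j → - (i - j) ≡ - i - (- j)
    minus-neg = ℤ-Solver.solve-∀
    minus-* : ∀ i j k l → (i - j) * k + j * (k - l) ≡ i * k - j * l
    minus-* = ℤ-Solver.solve-∀

module ModPGroupRing {p} (p-prime : Prime p) (G : FiniteGroup) where
  open IntegersModulo p using (_≡ₘ_; mk; m∣i-j; reflexiveₘ) renaming (ring to ℤ/p) public
  open FiniteGroup G using (ε) renaming (Carrier to 𝔾)
  open GroupRing ℤ/p G public
  open CommutativeRing ℤ/p using () renaming (sym to ≈-sym; trans to ≈-trans; +-cong to +ₘ-cong; setoid to ℤ/p-setoid) public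
  private
    module R = Ring ring
  open SemiringExp R.semiring using (_^_) public
  open SemiringMult R.semiring using () renaming (_×_ to _·_)

  private
    ·-pointwise : ∀ k u x → (k · u) x ≡ + k ℤ.* u x
    ·-pointwise zero    u x = ≡.sym (ℤ.*-zeroˡ (u x))
    ·-pointwise (suc k) u x = ≡.trans (cong (λ i → u x ℤ.+ i) (·-pointwise k u x)) (≡.sym (ℤ.suc-* (+ k) (u x)))

    characteristic : ∀ u → p · u ≋ 𝟘
    characteristic u x = mk (dividesℤ (u x) (≡.trans (ℤ.+-identityʳ _) (≡.trans (·-pointwise p u x) (ℤ.*-comm (+ p) (u x)))))

  open Commuting ring public
  open Frobenius ring p-prime characteristic public

  ¬1≡ₘ0 : ¬ (+ 1 ≡ₘ + 0)
  ¬1≡ₘ0 (mk d) = ¬prime[1] (≡.subst Prime (∣1⇒≡1 (ℤ∣.∣⇒∣ᵤ d)) p-prime)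

  scalar : ℤ → A
  scalar z = z ·ᵥ δ ε

  scalar-⋆ : ∀ z u → scalar z ⋆ u ≋ z ·ᵥ u
  scalar-⋆ z u = R.trans (·ᵥ-⋆ z (δ ε) u) (·ᵥ-congˡ z (⋆-identityˡ u))

  scalar-commute : ∀ u z → Commute u (scalar z)
  scalar-commute u z = R.trans (⋆-·ᵥ u z (δ ε)) (R.trans (·ᵥ-congˡ z (⋆-identityʳ u)) (R.sym (scalar-⋆ z u)))

  private
    fixed-cong : ∀ {u v} → u ≋ v → ^p-fixed u → ^p-fixed v
    fixed-cong e fu = R.trans (SemiringExp.^-congˡ R.semiring p (R.sym e)) (R.trans fu e)

    1^ : ∀ q → (δ ε ^ q) ≋ δ ε
    1^ zero    = R.refl
    1^ (suc q) = R.trans (R.*-identityˡ _) (1^ q)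

    -- Fermat's little theorem, by induction through (k + 1)^p = k^p + 1.
    scalar-fixedℕ : ∀ k → ^p-fixed (scalar (+ k))
    scalar-fixedℕ zero    = fixed-cong (λ x → reflexiveₘ (≡.sym (ℤ.*-zeroˡ (δ ε x))))
      (≡.subst (λ q → (𝟘 ^ q) ≋ 𝟘) (ℕ.*-identityʳ p) (0^p^i≈0 1))
    scalar-fixedℕ (suc k) = fixed-cong (λ x → reflexiveₘ (≡.sym (ℤ.suc-* (+ k) (δ ε x))))
      (^p-fixed-+ (scalar-commute (δ ε) (+ k)) (1^ p) (scalar-fixedℕ k))

  scalar-fixed : ∀ z → ^p-fixed (scalar z)
  scalar-fixed (+ k)    = scalar-fixedℕ k
  scalar-fixed -[1+ k ] = fixed-cong (λ x → reflexiveₘ (ℤ.neg-distribˡ-* (+ suc k) (δ ε x)))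
    (^p-fixed-neg (scalar-fixedℕ (suc k)))

-- Integer annihilators of an integral Cayley graph

module IntegralCayleyGraph {c ℓ₁ ℓ₂} (𝕂 : AlgebraicallyClosedField₀ c ℓ₁ ℓ₂) (G : FiniteGroup)
  (S : Pred (FiniteGroup.Carrier G) 0ℓ) (S? : Decidable S) (isConn : FiniteGroup.IsConnectionSet G S) where
  open AlgebraicallyClosedField₀ 𝕂 using (heytingField; characteristicZero; algebraicallyClosed)
  open HeytingFieldProperties heytingField
  open LinearAlgebra heytingField
  open SemiringSum semiring using (sum; sum-cong-≋; ∑-distrib-+; *-distribˡ-sum)
  open FiniteGroup G hiding (_^_) renaming (Carrier to 𝔾; order to N)
  open Inverse elements using (to; from; strictlyInverseˡ)
  open SetoidReasoning setoid

  private
    module ℤG = GroupRing ℤ-ring G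
    M = adjacencyMatrix 𝕂 (Cay G S S? isConn)

  adjacencyOperator : LinearOperator (Fin N)
  adjacencyOperator = record
    { ⟦_⟧     = λ v i → sum (λ j → M i j * v j)
    ; ⟦⟧-cong = λ eq i → sum-cong-≋ (λ j → *-congˡ (eq j))
    ; ⟦⟧-+    = λ v w i → ≈-trans (sum-cong-≋ (λ j → distribˡ (M i j) (v j) (w j))) (∑-distrib-+ (λ j → M i j * v j) (λ j → M i j * w j))
    ; ⟦⟧-*    = λ a v i → ≈-trans (sum-cong-≋ (λ j → solve 3 (λ a m v → m :* (a :* v) := a :* (m :* v)) ≈-refl a (M i j) (v j)))
                  (≈-sym (*-distribˡ-sum a (λ j → M i j * v j)))
    }
    where open Solver using (solve; _:*_; _:=_)

  open LinearOperator adjacencyOperator using (annihilate; ⟦_⟧; ⟦⟧-cong)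

  1ₛ : 𝔾 → ℤ
  1ₛ x = ℤG.ind (S? x)

  -- Applied to `δ ε`, the product of the operators 1ₛ - zᵢ is that product as an element of the
  -- group ring. To kill this single vector is therefore a polynomial identity for `1ₛ`.
  annihilateℤ : List ℤ → 𝔾 → ℤ
  annihilateℤ []       x = ℤG.δ ε x
  annihilateℤ (z ∷ zs) x = (1ₛ ℤG.⋆ annihilateℤ zs) x ℤ.- z ℤ.* annihilateℤ zs x

  private
    fromℤ-sum : ∀ {m} (h : Fin m → ℤ) → fromℤ (SemiringSum.sum (CommutativeRing.semiring ℤ-ring) h) ≈ sum (fromℤ ∘ h)
    fromℤ-sum {zero}  h = ≈-refl
    fromℤ-sum {suc m} h = ≈-trans (fromℤ-+ (h zero) _) (+-congˡ (fromℤ-sum (h ∘ suc)))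

    fromℤ-ind : ∀ {P : Set} (d : Dec P) → (if does d then 1# else 0#) ≈ fromℤ (ℤG.ind d)
    fromℤ-ind (yes _) = ≈-sym fromℤ-1
    fromℤ-ind (no _)  = ≈-refl

  fromℤ-⋆ : ∀ u i → ⟦ (λ j → fromℤ (u (to j))) ⟧ i ≈ fromℤ ((1ₛ ℤG.⋆ u) (to i))
  fromℤ-⋆ u i = begin
    sum (λ j → M i j * fromℤ (u (to j)))
      ≈⟨ sum-cong-≋ (λ j → ≈-trans (*-congʳ (fromℤ-ind (S? (to i ∙ to j ⁻¹)))) (≈-sym (fromℤ-* (1ₛ (to i ∙ to j ⁻¹)) (u (to j))))) ⟩
    sum (λ j → fromℤ (1ₛ (to i ∙ to j ⁻¹) ℤ.* u (to j)))
      ≈⟨ fromℤ-sum (λ j → 1ₛ (to i ∙ to j ⁻¹) ℤ.* u (to j)) ⟨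
    fromℤ (SemiringSum.sum (CommutativeRing.semiring ℤ-ring) (λ j → 1ₛ (to i ∙ to j ⁻¹) ℤ.* u (to j)))
      ≡⟨ cong fromℤ (ℤG.∑-def (λ y → 1ₛ (to i ∙ y ⁻¹) ℤ.* u y)) ⟨
    fromℤ ((1ₛ ℤG.⋆ u) (to i)) ∎

  fromℤ-annihilate : ∀ zs i → annihilate (map fromℤ zs) (λ j → fromℤ (ℤG.δ ε (to j))) i ≈ fromℤ (annihilateℤ zs (to i))
  fromℤ-annihilate []       i = ≈-refl
  fromℤ-annihilate (z ∷ zs) i = begin
    ⟦ v ⟧ i - fromℤ z * v i
      ≈⟨ +-cong (≈-trans (⟦⟧-cong (fromℤ-annihilate zs) i) (fromℤ-⋆ u i)) (-‿cong (≈-trans (*-congˡ (fromℤ-annihilate zs i)) (≈-sym (fromℤ-* z (u (to i)))))) ⟩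
    fromℤ ((1ₛ ℤG.⋆ u) (to i)) - fromℤ (z ℤ.* u (to i))
      ≈⟨ +-congˡ (fromℤ-neg (z ℤ.* u (to i))) ⟨
    fromℤ ((1ₛ ℤG.⋆ u) (to i)) + fromℤ (ℤ.- (z ℤ.* u (to i)))
      ≈⟨ fromℤ-+ ((1ₛ ℤG.⋆ u) (to i)) (ℤ.- (z ℤ.* u (to i))) ⟨
    fromℤ (annihilateℤ (z ∷ zs) (to i)) ∎
    where
    u = annihilateℤ zs
    v = annihilate (map fromℤ zs) (λ j → fromℤ (ℤG.δ ε (to j)))

  module _ (integral : Integral 𝕂 (Cay G S S? isConn)) where

    -- The entries of the annihilated vector are images of integers, and in characteristic zero an
    -- integer whose image vanishes is 0.
    ¬¬integer-annihilator : ¬ ¬ ∃ λ zs → ∀ x → annihilateℤ zs x ≡ + 0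
    ¬¬integer-annihilator k = ¬¬integral-annihilator algebraicallyClosed adjacencyOperator
      (λ a v v#0 eq → integral a (v , v#0 , eq)) (λ j → fromℤ (ℤG.δ ε (to j))) λ (zs , eq) →
      k (zs , λ x → ≡.subst (λ y → annihilateℤ zs y ≡ + 0) (strictlyInverseˡ x)
        (fromℤ≈0⇒≡0 characteristicZero _ (≈-trans (≈-sym (fromℤ-annihilate zs (from x))) (eq (from x)))))

    module _ {p} (p-prime : Prime p) where
      private
        module 𝔽G = ModPGroupRing p-prime G
        module R = Ring 𝔽G.ring
      open 𝔽G using (_^_; _≋_; scalar; reflexiveₘ)

      private
        annihilator≋ : ∀ zs → 𝔽G.annihilator 1ₛ (map scalar zs) ≋ annihilateℤ zs
        annihilator≋ []       = R.refl
        annihilator≋ (z ∷ zs) = R.trans (R.*-congˡ {1ₛ R.- scalar z} (annihilator≋ zs))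
          (R.trans (R.distribʳ (annihilateℤ zs) 1ₛ (𝔽G.⊖ scalar z))
            (R.+-cong (λ x → reflexiveₘ (≡.trans (𝔽G.∑-def _) (≡.sym (ℤG.∑-def _))))
              (R.trans (R.sym (RP.-‿distribˡ-* (scalar z) (annihilateℤ zs))) (R.-‿cong (𝔽G.scalar-⋆ z (annihilateℤ zs))))))
          where import Algebra.Properties.Ring 𝔽G.ring as RP

      ¬¬1ₛ^p^i-stable : ¬ ¬ ∃ λ i → (1ₛ ^ (p ℕ.^ suc i)) ≋ (1ₛ ^ (p ℕ.^ i))
      ¬¬1ₛ^p^i-stable k = ¬¬integer-annihilator λ (zs , eq) →
        k (length (map scalar zs) , 𝔽G.annihilated⇒^p^i-stable 1ₛ (map scalar zs)
          (All.map⁺ (All.universal (λ z → 𝔽G.scalar-commute 1ₛ z , 𝔽G.scalar-fixed z) zs))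
          (R.trans (annihilator≋ zs) (λ x → reflexiveₘ (eq x))))

-- Powers in finite groups, and gradings with abelian even part

module Powers (G : FiniteGroup) where
  open FiniteGroup G renaming (Carrier to 𝔾)
  private
    module Mult = MonoidMult (Group.monoid group)

  ^-+ : ∀ x m n → x ^ (m ℕ.+ n) ≡ x ^ m ∙ x ^ n
  ^-+ = Mult.×-homo-+

  ^-^ : ∀ x m n → (x ^ m) ^ n ≡ x ^ (n ℕ.* m)
  ^-^ x m n = Mult.×-assocˡ x n m

  x^1≡x : ∀ x → x ^ 1 ≡ x
  x^1≡x = identityʳ

  ε^ : ∀ n → ε ^ n ≡ ε
  ε^ zero    = refl
  ε^ (suc n) = ≡.trans (identityˡ _) (ε^ n)

  ^-periodic : ∀ {x M} → x ^ M ≡ ε → ∀ r q → x ^ (r ℕ.+ q ℕ.* M) ≡ x ^ r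
  ^-periodic {x} {M} x^M≡ε r q = begin
    x ^ (r ℕ.+ q ℕ.* M)     ≡⟨ ^-+ x r (q ℕ.* M) ⟩
    x ^ r ∙ x ^ (q ℕ.* M)   ≡⟨ cong (x ^ r ∙_) (^-^ x M q) ⟨
    x ^ r ∙ (x ^ M) ^ q     ≡⟨ cong (λ y → x ^ r ∙ y ^ q) x^M≡ε ⟩
    x ^ r ∙ ε ^ q           ≡⟨ cong (x ^ r ∙_) (ε^ q) ⟩
    x ^ r ∙ ε               ≡⟨ identityʳ _ ⟩
    x ^ r                   ∎
    where open ≡.≡-Reasoning

  ^-root : ∀ {M k} → gcd k M ≡ 1 → ∃ λ j → ∀ x → x ^ M ≡ ε → (x ^ k) ^ j ≡ x
  ^-root {M} {k} coprime with Bézout.identity (≡.subst (GCD k M) coprime (gcd-GCD k M))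
  ... | Bézout.+- i j 1+jM≡ik = i , λ x x^M≡ε →
    ≡.trans (^-^ x k i) (≡.trans (cong (x ^_) (≡.sym 1+jM≡ik)) (≡.trans (^-periodic x^M≡ε 1 j) (x^1≡x x)))
  -- In this case ik ≡ -1 modulo M, so (ik)² ≡ 1 and iki is inverse to k.
  ... | Bézout.-+ i j 1+ik≡jM = i ℕ.* k ℕ.* i , λ x x^M≡ε → begin
    (x ^ k) ^ (i ℕ.* k ℕ.* i)                    ≡⟨ ^-^ x k (i ℕ.* k ℕ.* i) ⟩
    x ^ (i ℕ.* k ℕ.* i ℕ.* k)                    ≡⟨ ^-periodic {x} {M} x^M≡ε (i ℕ.* k ℕ.* i ℕ.* k) j ⟨
    x ^ (i ℕ.* k ℕ.* i ℕ.* k ℕ.+ j ℕ.* M)        ≡⟨ cong (λ m → x ^ (i ℕ.* k ℕ.* i ℕ.* k ℕ.+ m)) 1+ik≡jM ⟨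
    x ^ (i ℕ.* k ℕ.* i ℕ.* k ℕ.+ (1 ℕ.+ i ℕ.* k)) ≡⟨ cong (x ^_) (rearrange i k) ⟩
    x ^ (1 ℕ.+ i ℕ.* k ℕ.* (1 ℕ.+ i ℕ.* k))      ≡⟨ cong (λ m → x ^ (1 ℕ.+ i ℕ.* k ℕ.* m)) 1+ik≡jM ⟩
    x ^ (1 ℕ.+ i ℕ.* k ℕ.* (j ℕ.* M))            ≡⟨ cong (λ m → x ^ (1 ℕ.+ m)) (ℕ.*-assoc (i ℕ.* k) j M) ⟨
    x ^ (1 ℕ.+ i ℕ.* k ℕ.* j ℕ.* M)              ≡⟨ ^-periodic x^M≡ε 1 (i ℕ.* k ℕ.* j) ⟩
    x ^ 1                                        ≡⟨ x^1≡x x ⟩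
    x                                            ∎
    where
    open ≡.≡-Reasoning
    rearrange : ∀ i k → i ℕ.* k ℕ.* i ℕ.* k ℕ.+ (1 ℕ.+ i ℕ.* k) ≡ 1 ℕ.+ i ℕ.* k ℕ.* (1 ℕ.+ i ℕ.* k)
    rearrange = ℕ-Solver.solve-∀

  ^-injective : ∀ {M k} → gcd k M ≡ 1 → ∀ {x y} → x ^ M ≡ ε → y ^ M ≡ ε → x ^ k ≡ y ^ k → x ≡ y
  ^-injective {M} {k} coprime {x} {y} x^M≡ε y^M≡ε eq with ^-root {M} {k} coprime
  ... | j , root = ≡.trans (≡.sym (root x x^M≡ε)) (≡.trans (cong (_^ j) eq) (root y y^M≡ε))

  ⟨⟩-trans : ∀ {x y z} → ⟨ x ⟩ y → ⟨ y ⟩ z → ⟨ x ⟩ z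
  ⟨⟩-trans {x} (i , refl) (j , refl) = j ℕ.* i , ^-^ x i j

  ⟨⟩-refl : ∀ x → ⟨ x ⟩ x
  ⟨⟩-refl x = 1 , ≡.sym (x^1≡x x)

record AbelianByParity (G : FiniteGroup) : Set where
  open FiniteGroup G
  field
    degree        : Carrier → Parity
    degree-∙      : ∀ x y → degree (x ∙ y) ≡ degree x ℙ.+ degree y
    exponent      : ℕ
    exponent≢0    : ℕ.NonZero exponent
    even-comm     : ∀ x y → degree x ≡ 0ℙ → degree y ≡ 0ℙ → x ∙ y ≡ y ∙ x
    even-exponent : ∀ x → degree x ≡ 0ℙ → x ^ exponent ≡ ε

  degree-ε : degree ε ≡ 0ℙ
  degree-ε = p≡p+p⇒p≡0 (degree ε) (≡.trans (cong degree (≡.sym (identityˡ ε))) (degree-∙ ε ε))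
    where
    p≡p+p⇒p≡0 : ∀ p → p ≡ p ℙ.+ p → p ≡ 0ℙ
    p≡p+p⇒p≡0 0ℙ _ = refl

  degree-⁻¹ : ∀ x → degree (x ⁻¹) ≡ degree x
  degree-⁻¹ x = p+q≡0⇒p≡q (degree (x ⁻¹)) (degree x)
    (≡.trans (≡.sym (degree-∙ (x ⁻¹) x)) (≡.trans (cong degree (inverseˡ x)) degree-ε))
    where
    p+q≡0⇒p≡q : ∀ p q → p ℙ.+ q ≡ 0ℙ → p ≡ q
    p+q≡0⇒p≡q 0ℙ 0ℙ _ = refl
    p+q≡0⇒p≡q 1ℙ 1ℙ _ = refl

  even-^ : ∀ {x} → degree x ≡ 0ℙ → ∀ n → degree (x ^ n) ≡ 0ℙ
  even-^ _ zero    = degree-ε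
  even-^ {x} e (suc n) = ≡.trans (degree-∙ x (x ^ n)) (cong₂ ℙ._+_ e (even-^ e n))

-- Integrality forces closure of the even part under p-th powers

module PrimePowerClosure {c ℓ₁ ℓ₂} (𝕂 : AlgebraicallyClosedField₀ c ℓ₁ ℓ₂) (G : FiniteGroup) (grading : AbelianByParity G)
  (S₁ S₂ : Pred (FiniteGroup.Carrier G) 0ℓ) (S₁? : Decidable S₁) (S₂? : Decidable S₂)
  (isConn : FiniteGroup.IsConnectionSet G (S₁ ∪ S₂)) where
  open FiniteGroup G renaming (Carrier to 𝔾; order to N; _^_ to _^ᴳ_; assoc to ∙-assoc)
  open FiniteGroupProperties G
  open Powers G
  open AbelianByParity grading
  open Inverse elements using (to)

  module _ (integral : Integral 𝕂 (Cay G (S₁ ∪ S₂) (S₁? ∪? S₂?) isConn))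
    (S₁-even : ∀ x → S₁ x → degree x ≡ 0ℙ) (S₂-odd : ∀ x → S₂ x → degree x ≡ 1ℙ)
    (S₁-conj : ∀ x h → S₁ x → S₁ (h ⁻¹ ∙ x ∙ h))
    {p} (p-prime : Prime p) (p-coprime : ∀ i → gcd (p ℕ.^ i) exponent ≡ 1) (p-odd : parity p ≡ 1ℙ) where
    open ModPGroupRing p-prime G
    private
      module R = Ring ring
      module RS = SemiringSum R.semiring
    open SemiringExp R.semiring using (^-congˡ)
    open CommutativeRing ℤ/p using () renaming (refl to ≈-refl; reflexive to ≈-reflexive; _≈_ to _≈_;
      *-congʳ to ·-congʳ; *-congˡ to ·-congˡ; zeroˡ to ·-zeroˡ; zeroʳ to ·-zeroʳ; +-identityʳ to ℤ+-identityʳ; +-congˡ to ℤ+-congˡ)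
    open SemiringSum (CommutativeRing.semiring ℤ/p) using (sum)

    Homogeneous : Parity → A → Set
    Homogeneous d u = ∀ x → degree x ≢ d → u x ≈ + 0

    homogeneous-⋆ : ∀ {d e u v} → Homogeneous d u → Homogeneous e v → Homogeneous (d ℙ.+ e) (u ⋆ v)
    homogeneous-⋆ {d} {e} {u} {v} hu hv x x≢ = ∑-zero λ y → vanish y
      where
      vanish : ∀ y → u (x ∙ y ⁻¹) ℤ.* v y ≈ + 0
      vanish y with degree y ℙ.≟ e
      ... | no y≢e = ≈-trans (·-congˡ {u (x ∙ y ⁻¹)} (hv y y≢e)) (·-zeroʳ (u (x ∙ y ⁻¹)))
      ... | yes refl = ≈-trans (·-congʳ {v y} (hu _ λ eq → x≢ (≡.trans (cong degree (≡.sym (x∙y⁻¹∙y≡x x y)))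
          (≡.trans (degree-∙ (x ∙ y ⁻¹) y) (cong (ℙ._+ degree y) eq))))) (·-zeroˡ (v y))

    homogeneous-δε : Homogeneous 0ℙ (δ ε)
    homogeneous-δε x x≢0 = ≈-reflexive (ind-no (x ≟ ε) λ { refl → x≢0 degree-ε })

    odd-^ : ∀ {u} → Homogeneous 1ℙ u → ∀ n → Homogeneous (parity n) (u ^ n)
    odd-^ hu zero          = homogeneous-δε
    odd-^ {u} hu (suc n) = ≡.subst (λ d → Homogeneous d (u ^ suc n)) (step n) (homogeneous-⋆ {u = u} {u ^ n} hu (odd-^ hu n))
      where
      step : ∀ n → 1ℙ ℙ.+ parity n ≡ parity (suc n)
      step n = ≡.sym (ℙ.+-homo-+ 1 n)

    f f₁ f₂ : A
    f x = ind ((S₁? ∪? S₂?) x)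
    f₁ x = ind (S₁? x)
    f₂ x = ind (S₂? x)

    f≋f₁⊕f₂ : f ≋ f₁ ⊕ f₂
    f≋f₁⊕f₂ x with S₁? x | S₂? x
    ... | yes s₁ | yes s₂ = contradiction (≡.trans (≡.sym (S₁-even x s₁)) (S₂-odd x s₂)) λ ()
    ... | yes _  | no _   = ≈-refl
    ... | no _   | yes _  = ≈-refl
    ... | no _   | no _   = ≈-refl

    f₁-central : ∀ u → Commute u f₁
    f₁-central = classFunction-central f₁ λ x h → ≈-reflexive (ind-cong (S₁? _) (S₁? x)
      (λ s → ≡.subst S₁ (conj-conj x h) (S₁-conj _ (h ⁻¹) s)) (S₁-conj x h))

    -- The index runs over the whole group and membership is a coefficient, which presents f₁ as a
    -- sum of fixed length N, the shape wanted by `frobeniusⁱ-sum`.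
    term : ∀ q → Fin N → A
    term q i = ind (S₁? (to i)) ·ᵥ δ (to i ^ᴳ q)

    sum-pointwise : ∀ {m} (u : Fin m → A) x → RS.sum u x ≡ sum (λ i → u i x)
    sum-pointwise {zero}  u x = refl
    sum-pointwise {suc m} u x = cong (λ t → u zero x ℤ.+ t) (sum-pointwise (u ∘ suc) x)

    sum-term : ∀ q x → RS.sum (term q) x ≈ ∑ (λ y → ind (S₁? y) ℤ.* δ (y ^ᴳ q) x)
    sum-term q x = ≈-reflexive (≡.trans (sum-pointwise (term q) x) (≡.sym (∑-def _)))

    f₁≋sum : f₁ ≋ RS.sum (term 1)
    f₁≋sum x = ≈-sym (≈-trans (sum-term 1 x) (≈-trans
      (∑-single _ x (λ y y≢x → ≈-trans (·-congˡ {ind (S₁? y)} (≈-reflexive (ind-no (x ≟ y ^ᴳ 1) (λ eq → y≢x (≡.sym (≡.trans eq (x^1≡x y)))))))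
        (·-zeroʳ (ind (S₁? y)))))
      (≈-reflexive (≡.trans (cong (λ t → f₁ x ℤ.* t) (ind-yes (x ≟ x ^ᴳ 1) (≡.sym (x^1≡x x)))) (ℤ.*-identityʳ (f₁ x))))))

    δ-^ : ∀ g n → (δ g ^ n) ≋ δ (g ^ᴳ n)
    δ-^ g zero    = R.refl
    δ-^ g (suc n) = R.trans (R.*-congˡ {δ g} (δ-^ g n)) (δ-⋆-δ g (g ^ᴳ n))

    -- The coefficients 0 and 1 equal their own positive powers; a zero exponent has to be excluded
    -- because of 0⁰ = 1.
    term-^ : ∀ n i → (term 1 i ^ suc n) ≋ term (suc n) i
    term-^ n i with S₁? (to i)
    ... | no _  = R.trans (R.*-congʳ {(+ 0 ·ᵥ δ (to i ^ᴳ 1)) ^ n} {+ 0 ·ᵥ δ (to i ^ᴳ 1)} {𝟘} (λ x → ≈-reflexive (ℤ.*-zeroˡ (δ (to i ^ᴳ 1) x))))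
                    (R.trans (R.zeroˡ ((+ 0 ·ᵥ δ (to i ^ᴳ 1)) ^ n)) (λ x → ≈-reflexive (≡.sym (ℤ.*-zeroˡ (δ (to i ^ᴳ suc n) x)))))
    ... | yes _ = R.trans (^-congˡ (suc n) (1· (δ (to i ^ᴳ 1))))
                    (R.trans (δ-^ (to i ^ᴳ 1) (suc n))
                      (R.trans (R.reflexive (cong (λ y → δ (y ^ᴳ suc n)) (x^1≡x (to i)))) (R.sym (1· (δ (to i ^ᴳ suc n))))))
      where
      1· : ∀ u → + 1 ·ᵥ u ≋ u
      1· u x = ≈-reflexive (ℤ.*-identityˡ (u x))

    commute-0 : ∀ u v → Commute u (+ 0 ·ᵥ v)
    commute-0 u v x = ≈-trans (≈-trans (⋆-·ᵥ u (+ 0) v x) (≈-reflexive (ℤ.*-zeroˡ ((u ⋆ v) x))))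
      (≈-sym (≈-trans (·ᵥ-⋆ (+ 0) v u x) (≈-reflexive (ℤ.*-zeroˡ ((v ⋆ u) x)))))

    term-commute : ∀ i j → Commute (term 1 i) (term 1 j)
    term-commute i j with S₁? (to i) | S₁? (to j)
    ... | no _  | d     = R.sym (commute-0 (ind d ·ᵥ δ (to j ^ᴳ 1)) (δ (to i ^ᴳ 1)))
    ... | yes _ | no _  = commute-0 (+ 1 ·ᵥ δ (to i ^ᴳ 1)) (δ (to j ^ᴳ 1))
    ... | yes s | yes t = R.trans (scale (δ g) (δ h)) (R.trans (R.trans (δ-⋆-δ g h) (R.trans (R.reflexive (cong δ gh≡hg)) (R.sym (δ-⋆-δ h g)))) (R.sym (scale (δ h) (δ g))))
      where
      g = to i ^ᴳ 1
      h = to j ^ᴳ 1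
      gh≡hg : g ∙ h ≡ h ∙ g
      gh≡hg = even-comm g h (even-^ (S₁-even _ s) 1) (even-^ (S₁-even _ t) 1)
      scale : ∀ u v → (+ 1 ·ᵥ u) ⋆ (+ 1 ·ᵥ v) ≋ u ⋆ v
      scale u v = R.*-cong {x = + 1 ·ᵥ u} {u} {+ 1 ·ᵥ v} {v} (λ x → ≈-reflexive (ℤ.*-identityˡ (u x))) (λ x → ≈-reflexive (ℤ.*-identityˡ (v x)))

    f₁^p^i : ∀ i x → (f₁ ^ (p ℕ.^ i)) x ≈ ∑ (λ y → ind (S₁? y) ℤ.* δ (y ^ᴳ (p ℕ.^ i)) x)
    f₁^p^i i x = ≈-trans (R.trans (^-congˡ (p ℕ.^ i) f₁≋sum)
      (R.trans (frobeniusⁱ-sum i (term 1) term-commute) (RS.sum-cong-≋ (λ j → powers j))) x) (sum-term (p ℕ.^ i) x)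
      where
      powers : ∀ j → (term 1 j ^ (p ℕ.^ i)) ≋ term (p ℕ.^ i) j
      powers j with p ℕ.^ i | ℕ.m^n≢0 p i {{prime⇒nonZero p-prime}}
      ... | suc q | _ = term-^ q j

    -- Centrality of f₁ splits the power of f₁ + f₂, and an odd power of the odd function f₂
    -- vanishes at even elements.
    even-part : ∀ i x → degree x ≡ 0ℙ → (f ^ (p ℕ.^ i)) x ≈ (f₁ ^ (p ℕ.^ i)) x
    even-part i x x-even = ≈-trans (R.trans (^-congˡ (p ℕ.^ i) f≋f₁⊕f₂) (frobeniusⁱ-+ i (R.sym (f₁-central f₂))) x)
      (≈-trans (ℤ+-congˡ {(f₁ ^ (p ℕ.^ i)) x} (odd-^ f₂-odd (p ℕ.^ i) x
        (λ eq → contradiction (≡.trans (≡.sym x-even) (≡.trans eq (p^i-odd i))) λ ()))) (ℤ+-identityʳ _))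
      where
      f₂-odd : Homogeneous 1ℙ f₂
      f₂-odd y y≢1 = ≈-reflexive (ind-no (S₂? y) (λ s → y≢1 (S₂-odd y s)))
      p^i-odd : ∀ i → parity (p ℕ.^ i) ≡ 1ℙ
      p^i-odd zero    = refl
      p^i-odd (suc i) = ≡.trans (ℙ.*-homo-* p (p ℕ.^ i)) (cong₂ ℙ._*_ p-odd (p^i-odd i))

    -- Compare coefficients of g = s^(p^(i+1)) in two equal powers of f. In the power p^(i+1) only y
    -- = s contributes, with 1. In the power p^i a contributing y satisfies y^(p^i) = (s^p)^(p^i),
    -- hence y = s^p, which was assumed to lie outside S₁. So 1 ≡ 0 modulo p.
    prime-power-closed : ∀ s → S₁ s → S₁ (s ^ᴳ p)
    prime-power-closed s s∈S₁ = decidable-stable (S₁? (s ^ᴳ p)) λ s^p∉S₁ →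
      IntegralCayleyGraph.¬¬1ₛ^p^i-stable 𝕂 G (S₁ ∪ S₂) (S₁? ∪? S₂?) isConn integral p-prime λ (i , eq) →
      let
        g      = s ^ᴳ (p ℕ.^ suc i)
        s-even = S₁-even s s∈S₁
        g-even = even-^ s-even (p ℕ.^ suc i)

        only-s : ∀ y → y ≢ s → ind (S₁? y) ℤ.* δ (y ^ᴳ (p ℕ.^ suc i)) g ≈ + 0
        only-s y y≢s = lem (S₁? y) λ y∈S₁ → ≈-reflexive (ind-no (g ≟ _)
          (λ g≡ → y≢s (^-injective {exponent} {p ℕ.^ suc i} (p-coprime (suc i)) (even-exponent y (S₁-even y y∈S₁)) (even-exponent s s-even) (≡.sym g≡))))

        none : ∀ y → ind (S₁? y) ℤ.* δ (y ^ᴳ (p ℕ.^ i)) g ≈ + 0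
        none y = lem (S₁? y) λ y∈S₁ → ≈-reflexive (ind-no (g ≟ _) λ g≡ → s^p∉S₁ (≡.subst S₁
          (^-injective {exponent} {p ℕ.^ i} (p-coprime i) (even-exponent y (S₁-even y y∈S₁)) (even-exponent (s ^ᴳ p) (even-^ s-even p))
            (≡.trans (≡.sym g≡) (≡.trans (cong (s ^ᴳ_) (ℕ.*-comm p (p ℕ.^ i))) (≡.sym (^-^ s p (p ℕ.^ i))))))
          y∈S₁))

        1≈0 : + 1 ≈ + 0
        1≈0 = ≈-trans (≈-reflexive (≡.sym (cong₂ ℤ._*_ (ind-yes (S₁? s) s∈S₁) (ind-yes (g ≟ s ^ᴳ (p ℕ.^ suc i)) refl))))
          (≈-trans (≈-sym (∑-single (λ y → ind (S₁? y) ℤ.* δ (y ^ᴳ (p ℕ.^ suc i)) g) s only-s))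
          (≈-trans (≈-sym (f₁^p^i (suc i) g)) (≈-trans (≈-sym (even-part (suc i) g g-even))
          (≈-trans (eq g) (≈-trans (even-part i g g-even) (≈-trans (f₁^p^i i g) (∑-zero none)))))))
      in ¬1≡ₘ0 1≈0
      where
      lem : ∀ {P : Set} (d : Dec P) {t} → (P → t ≈ + 0) → ind d ℤ.* t ≈ + 0
      lem (yes p) {t} t≈0 = ≈-trans (≈-reflexive (ℤ.*-identityˡ t)) (t≈0 p)
      lem (no _)  {t} _   = ≈-reflexive (ℤ.*-zeroˡ t)

-- Cardinalities of decidable sets

count : ∀ {m} {P : Pred (Fin m) 0ℓ} → Decidable P → ℕ
count {zero}  P? = 0
count {suc m} P? = (if does (P? zero) then 1 else 0) ℕ.+ count (P? ∘ suc)

module _ where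
  private
    indicator-≤ : ∀ {P Q : Set} (p : Dec P) (q : Dec Q) → (P → Q) →
                  (if does p then 1 else 0) ℕ.≤ (if does q then 1 else 0)
    indicator-≤ (no _)  q       f = ℕ.z≤n
    indicator-≤ (yes p) (yes q) f = ℕ.≤-refl
    indicator-≤ (yes p) (no ¬q) f = contradiction (f p) ¬q

    indicator-< : ∀ {P Q : Set} (p : Dec P) (q : Dec Q) → ¬ P → Q →
                  (if does p then 1 else 0) ℕ.< (if does q then 1 else 0)
    indicator-< (yes p) _       ¬p _ = contradiction p ¬p
    indicator-< (no _)  (yes _) _  _ = ℕ.≤-refl
    indicator-< (no _)  (no ¬q) _  q = contradiction q ¬q

  count-≤ : ∀ {m} {P Q : Pred (Fin m) 0ℓ} (P? : Decidable P) (Q? : Decidable Q) →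
            (∀ i → P i → Q i) → count P? ℕ.≤ count Q?
  count-≤ {zero}  P? Q? P⊆Q = ℕ.z≤n
  count-≤ {suc m} P? Q? P⊆Q =
    ℕ.+-mono-≤ (indicator-≤ (P? zero) (Q? zero) (P⊆Q zero)) (count-≤ (P? ∘ suc) (Q? ∘ suc) (P⊆Q ∘ suc))

  count-< : ∀ {m} {P Q : Pred (Fin m) 0ℓ} (P? : Decidable P) (Q? : Decidable Q) →
            (∀ i → P i → Q i) → ∀ i → ¬ P i → Q i → count P? ℕ.< count Q?
  count-< {suc m} P? Q? P⊆Q zero    ¬p q =
    ℕ.+-mono-<-≤ (indicator-< (P? zero) (Q? zero) ¬p q) (count-≤ (P? ∘ suc) (Q? ∘ suc) (P⊆Q ∘ suc))
  count-< {suc m} P? Q? P⊆Q (suc i) ¬p q =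
    ℕ.+-mono-≤-< (indicator-≤ (P? zero) (Q? zero) (P⊆Q zero)) (count-< (P? ∘ suc) (Q? ∘ suc) (P⊆Q ∘ suc) i ¬p q)

-- Eigenvalues of integral combinations of subgroups

module SubgroupCombinations (G : FiniteGroup) (grading : AbelianByParity G) where
  open FiniteGroup G renaming (Carrier to 𝔾; order to N; assoc to ∙-assoc)
  open FiniteGroupProperties G
  open AbelianByParity grading

  -- The indicator functions of any two such subgroups commute.
  record NiceSubgroup : Set₁ where
    field
      mem     : Pred 𝔾 0ℓ
      mem?    : Decidable mem
      ε∈      : mem ε
      ∙-mem   : ∀ {x y} → mem x → mem y → mem (x ∙ y)
      ⁻¹-mem  : ∀ {x} → mem x → mem (x ⁻¹)
      nice    : (∀ x → mem x → degree x ≡ 0ℙ) ⊎ (∀ x h → mem x → mem (h ⁻¹ ∙ x ∙ h))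

    mem-∙⁻ʳ : ∀ {x y} → mem y → mem (x ∙ y ⁻¹) → mem x
    mem-∙⁻ʳ {x} {y} y∈ xy⁻¹∈ = ≡.subst mem (x∙y⁻¹∙y≡x x y) (∙-mem xy⁻¹∈ y∈)

  Combination : Set₁
  Combination = List (ℤ × NiceSubgroup)

  scale : ℤ → Combination → Combination
  scale z = map λ (c , H) → z ℤ.* c , H

  module _ {c ℓ₁ ℓ₂} (𝕂 : AlgebraicallyClosedField₀ c ℓ₁ ℓ₂) where
    open AlgebraicallyClosedField₀ 𝕂 using (heytingField; characteristicZero)
    open HeytingFieldProperties heytingField hiding (ring)
    open GroupRing commutativeRing G
    open SemiringSum semiring using (sum; sum-cong-≋)
    private
      module R = Ring ring
    open Commuting ring
    open Inverse elements using (to; from; strictlyInverseˡ; strictlyInverseʳ)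
    open SetoidReasoning setoid

    indicator : NiceSubgroup → A
    indicator H x = ind (NiceSubgroup.mem? H x)

    value : Combination → A
    value []            = 𝟘
    value ((c , H) ∷ L) = fromℤ c ·ᵥ indicator H ⊕ value L

    value-++ : ∀ L L′ → value (L ++ L′) ≋ value L ⊕ value L′
    value-++ []            L′ x = ≈-sym (+-identityˡ _)
    value-++ ((c , H) ∷ L) L′ x = ≈-trans (+-congˡ (value-++ L L′ x)) (≈-sym (+-assoc _ _ _))

    value-scale : ∀ z L → value (scale z L) ≋ fromℤ z ·ᵥ value L
    value-scale z []            x = ≈-sym (zeroʳ _)
    value-scale z ((c , H) ∷ L) x = ≈-trans
      (+-cong (≈-trans (*-congʳ (fromℤ-* z c)) (*-assoc _ _ _)) (value-scale z L x)) (≈-sym (distribˡ _ _ _))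

    sum-ind : ∀ {m} {P : Pred (Fin m) 0ℓ} (P? : Decidable P) → sum (λ i → ind (P? i)) ≈ count P? · 1#
    sum-ind {zero}  P? = ≈-refl
    sum-ind {suc m} P? with P? zero
    ... | yes _ = +-congˡ (sum-ind (P? ∘ suc))
    ... | no _  = ≈-trans (+-identityˡ _) (sum-ind (P? ∘ suc))

    module _ (H : NiceSubgroup) where
      open NiceSubgroup H

      -- |H| - 1, because `characteristicZero` speaks of successors.
      order-1 : ℕ
      order-1 = ℕ.pred (count (λ i → mem? (to i)))

      ∑-indicator : ∑ (indicator H) ≈ suc order-1 · 1#
      ∑-indicator = ≈-trans (reflexive (∑-def (indicator H))) (≈-trans (sum-ind (λ i → mem? (to i)))
        (reflexive (cong (_· 1#) (≡.sym (ℕ.suc-pred _ {{ℕ.>-nonZero 0<count}})))))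
        where
        0<count : 0 ℕ.< count (λ i → mem? (to i))
        0<count = ℕ.≤-<-trans ℕ.z≤n (count-< {P = λ _ → ⊥} (λ _ → no λ ()) (λ i → mem? (to i)) (λ _ ()) (from ε)
          (λ ()) (≡.subst mem (≡.sym (strictlyInverseˡ ε)) ε∈))

      indicator-⋆ : indicator H ⋆ indicator H ≋ (suc order-1 · 1#) ·ᵥ indicator H
      indicator-⋆ x with mem? x
      ... | yes x∈ = ≈-trans (∑-cong inside) (≈-trans ∑-indicator (≈-sym (*-identityʳ _)))
        where
        inside : ∀ y → indicator H (x ∙ y ⁻¹) * indicator H y ≈ indicator H y
        inside y with mem? y
        ... | no _   = zeroʳ _
        ... | yes y∈ = ≈-trans (*-identityʳ _) (reflexive (ind-yes (mem? (x ∙ y ⁻¹)) (∙-mem x∈ (⁻¹-mem y∈))))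
      ... | no x∉  = ≈-trans (∑-zero outside) (≈-sym (zeroʳ _))
        where
        outside : ∀ y → indicator H (x ∙ y ⁻¹) * indicator H y ≈ 0#
        outside y with mem? y
        ... | no _   = zeroʳ _
        ... | yes y∈ = ≈-trans (*-identityʳ _) (reflexive (ind-no (mem? (x ∙ y ⁻¹)) (x∉ ∘ mem-∙⁻ʳ y∈)))

    private
      normal-central : ∀ H → (∀ x h → NiceSubgroup.mem H x → NiceSubgroup.mem H (h ⁻¹ ∙ x ∙ h)) →
                       ∀ u → Commute u (indicator H)
      normal-central H normal = classFunction-central (indicator H) λ x h →
        reflexive (ind-cong (mem? _) (mem? x) (λ m → ≡.subst mem (conj-conj x h) (normal _ (h ⁻¹) m)) (normal x h))
        where open NiceSubgroup H

    indicator-commute : ∀ H H′ → Commute (indicator H) (indicator H′)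
    indicator-commute H H′ with NiceSubgroup.nice H | NiceSubgroup.nice H′
    ... | _           | inj₂ normal = normal-central H′ normal (indicator H)
    ... | inj₂ normal | inj₁ _      = R.sym (normal-central H normal (indicator H′))
    ... | inj₁ even   | inj₁ even′  = ⋆-comm (indicator H) (indicator H′) λ x y → swap x y
      where
      module H  = NiceSubgroup H
      module H′ = NiceSubgroup H′
      swap : ∀ x y → indicator H y * indicator H′ (y ⁻¹ ∙ x) ≈ indicator H y * indicator H′ (x ∙ y ⁻¹)
      swap x y with H.mem? y
      ... | no _   = ≈-trans (zeroˡ _) (≈-sym (zeroˡ _))
      -- Evenness of x is not given, but membership of either y⁻¹x or xy⁻¹ in H′ implies it, and
      -- then y⁻¹ and x commute.
      ... | yes y∈ = *-congˡ (reflexive (ind-cong (H′.mem? _) (H′.mem? _)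
        (λ m → ≡.subst H′.mem (commute (even-∙ y (y ⁻¹ ∙ x) (x∙[x⁻¹∙y]≡y y x) (even y y∈) (even′ _ m))) m)
        (λ m → ≡.subst H′.mem (≡.sym (commute (even-∙ (x ∙ y ⁻¹) y (x∙y⁻¹∙y≡x x y) (even′ _ m) (even y y∈)))) m)))
        where
        commute : degree x ≡ 0ℙ → y ⁻¹ ∙ x ≡ x ∙ y ⁻¹
        commute x-even = even-comm (y ⁻¹) x (≡.trans (degree-⁻¹ y) (even y y∈)) x-even
        even-∙ : ∀ u v {w} → u ∙ v ≡ w → degree u ≡ 0ℙ → degree v ≡ 0ℙ → degree w ≡ 0ℙ
        even-∙ u v refl e e′ = ≡.trans (degree-∙ u v) (cong₂ ℙ._+_ e e′)

    commute-·ᵥ : ∀ {u} a {v} → Commute u v → Commute u (a ·ᵥ v)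
    commute-·ᵥ {u} a {v} uv = R.trans (⋆-·ᵥ u a v) (R.trans (·ᵥ-congˡ a uv) (R.sym (·ᵥ-⋆ a v u)))

    value-commute : ∀ H L → Commute (indicator H) (value L)
    value-commute H []             = R.trans (R.zeroʳ (indicator H)) (R.sym (R.zeroˡ (indicator H)))
    value-commute H ((c , H′) ∷ L) = commute-+ {indicator H} {fromℤ c ·ᵥ indicator H′} {value L}
      (commute-·ᵥ {indicator H} (fromℤ c) {indicator H′} (indicator-commute H H′)) (value-commute H L)

    module _ (c : ℤ) (H : NiceSubgroup) (L : Combination) {a : K} where
      open Solver using (solve; _:+_; _:*_; _:-_; :-_; _:=_)
      private
        e = indicator H
        T = value ((c , H) ∷ L)
        m = fromℤ (+ suc (order-1 H))

      -- An eigenvector v of T is split into the eigenvectors 1_H v and |H|v − 1_H v of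
      -- 1_H, one of which is nonzero.
      split-eigenvector : ∀ v → (∃ λ g → v g # 0#) → T ⋆ v ≋ a ·ᵥ v →
        ∃ λ z → ∃ λ w → (∃ λ g → w g # 0#) × T ⋆ w ≋ a ·ᵥ w × e ⋆ w ≋ fromℤ z ·ᵥ w
      split-eigenvector v (g , v#0) eq = choose (x+y#0⇒
        (#-congʳ (solve 2 (λ p q → p := q :+ (p :- q)) ≈-refl (m * v g) ((e ⋆ v) g)) (x#0y#0→xy#0 (characteristicZero (order-1 H)) v#0)))
        where
        T-e⋆v : T ⋆ (e ⋆ v) ≋ a ·ᵥ (e ⋆ v)
        T-e⋆v = R.trans (R.sym (R.*-assoc T e v)) (R.trans (R.*-congʳ {v} (R.sym (value-commute H ((c , H) ∷ L))))
          (R.trans (R.*-assoc e T v) (R.trans (R.*-congˡ {e} eq) (⋆-·ᵥ e a v))))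

        e-e⋆v : e ⋆ (e ⋆ v) ≋ m ·ᵥ (e ⋆ v)
        e-e⋆v = R.trans (R.sym (R.*-assoc e e v)) (R.trans (R.*-congʳ {v} (indicator-⋆ H)) (·ᵥ-⋆ m e v))

        w : A
        w x = m * v x - (e ⋆ v) x

        ⋆-w : ∀ u → u ⋆ w ≋ m ·ᵥ (u ⋆ v) ⊕ ⊖ (u ⋆ (e ⋆ v))
        ⋆-w u = R.trans (⋆-distribˡ u (m ·ᵥ v) (⊖ (e ⋆ v)))
          (R.+-cong (⋆-·ᵥ u m v) (R.sym (RingProperties.-‿distribʳ-* ring u (e ⋆ v))))

        T-w : T ⋆ w ≋ a ·ᵥ w
        T-w x = begin
          (T ⋆ w) x                            ≈⟨ ⋆-w T x ⟩
          m * (T ⋆ v) x - (T ⋆ (e ⋆ v)) x      ≈⟨ +-cong (*-congˡ (eq x)) (-‿cong (T-e⋆v x)) ⟩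
          m * (a * v x) - a * (e ⋆ v) x        ≈⟨ solve 4 (λ m a v w → m :* (a :* v) :- a :* w := a :* (m :* v :- w)) ≈-refl m a (v x) ((e ⋆ v) x) ⟩
          a * w x                              ∎

        e-w : e ⋆ w ≋ 0# ·ᵥ w
        e-w x = begin
          (e ⋆ w) x                            ≈⟨ ⋆-w e x ⟩
          m * (e ⋆ v) x - (e ⋆ (e ⋆ v)) x      ≈⟨ +-congˡ (-‿cong (e-e⋆v x)) ⟩
          m * (e ⋆ v) x - m * (e ⋆ v) x        ≈⟨ -‿inverseʳ _ ⟩
          0#                                   ≈⟨ zeroˡ _ ⟨
          0# * w x                             ∎

        choose : (e ⋆ v) g # 0# ⊎ w g # 0# → _
        choose (inj₁ #0) = + suc (order-1 H) , e ⋆ v , (g , #0) , T-e⋆v , e-e⋆v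
        choose (inj₂ #0) = + 0 , w , (g , #0) , T-w , e-w

      value-tail : ∀ b w → T ⋆ w ≋ a ·ᵥ w → e ⋆ w ≋ b ·ᵥ w → value L ⋆ w ≋ (a - fromℤ c * b) ·ᵥ w
      value-tail b w Tw ew x = begin
        (value L ⋆ w) x
          ≈⟨ solve 2 (λ p q → q := p :+ q :- p) ≈-refl (((fromℤ c ·ᵥ e) ⋆ w) x) ((value L ⋆ w) x) ⟩
        ((fromℤ c ·ᵥ e) ⋆ w) x + (value L ⋆ w) x - ((fromℤ c ·ᵥ e) ⋆ w) x
          ≈⟨ +-cong (≈-trans (≈-sym (⋆-distribʳ w (fromℤ c ·ᵥ e) (value L) x)) (Tw x)) (-‿cong (≈-trans (·ᵥ-⋆ (fromℤ c) e w x) (*-congˡ (ew x)))) ⟩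
        a * w x - fromℤ c * (b * w x)
          ≈⟨ solve 4 (λ a w c b → a :* w :- c :* (b :* w) := (a :- c :* b) :* w) ≈-refl a (w x) (fromℤ c) b ⟩
        (a - fromℤ c * b) * w x ∎

      shift-integer : ∀ b z → a - fromℤ c * fromℤ b ≈ fromℤ z → a ≈ fromℤ (z ℤ.+ c ℤ.* b)
      shift-integer b z eq = begin
        a                                             ≈⟨ solve 2 (λ a b → a := a :- b :+ b) ≈-refl a (fromℤ c * fromℤ b) ⟩
        a - fromℤ c * fromℤ b + fromℤ c * fromℤ b     ≈⟨ +-cong eq (≈-sym (fromℤ-* c b)) ⟩
        fromℤ z + fromℤ (c ℤ.* b)                     ≈⟨ fromℤ-+ z (c ℤ.* b) ⟨
        fromℤ (z ℤ.+ c ℤ.* b)                         ∎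

    -- The eigenvalue is peeled term by term. Once the head has contributed its integer, the new
    -- vector has to be an eigenvector of the tail only, so the recursion may replace it again
    -- without regard to the head.
    integral-eigenvalue : ∀ L a v → (∃ λ g → v g # 0#) → value L ⋆ v ≋ a ·ᵥ v → ∃ λ z → a ≈ fromℤ z
    integral-eigenvalue []            a v (g , v#0) eq =
      + 0 , *-cancelʳ-#0 v#0 (≈-trans (≈-sym (eq g)) (≈-trans (R.zeroˡ v g) (≈-sym (zeroˡ _))))
    integral-eigenvalue ((c , H) ∷ L) a v v#0 eq =
      let b , w , w#0 , Tw , ew = split-eigenvector c H L v v#0 eq
          z , eq′               = integral-eigenvalue L (a - fromℤ c * fromℤ b) w w#0 (value-tail c H L (fromℤ b) w Tw ew)
      in z ℤ.+ c ℤ.* b , shift-integer c H L b z eq′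

    integral-Cay : ∀ (S : Pred 𝔾 0ℓ) (S? : Decidable S) (isConn : IsConnectionSet S) L →
                   (∀ x → ind (S? x) ≈ value L x) → Integral 𝕂 (Cay G S S? isConn)
    integral-Cay S S? isConn L S≋L a (v , (i , v#0) , eq) = integral-eigenvalue L a (v ∘ from)
      (to i , #-congʳ (reflexive (cong v (≡.sym (strictlyInverseʳ i)))) v#0) λ x → begin
        (value L ⋆ (v ∘ from)) x
          ≈⟨ ∑-cong (λ y → *-congʳ (≈-sym (S≋L (x ∙ y ⁻¹)))) ⟩
        ∑ (λ y → ind (S? (x ∙ y ⁻¹)) * v (from y))
          ≈⟨ reflexive (∑-def _) ⟩
        sum (λ j → ind (S? (x ∙ to j ⁻¹)) * v (from (to j)))
          ≈⟨ sum-cong-≋ (λ j → *-cong (reflexive (cong (λ g → ind (S? (g ∙ to j ⁻¹))) (≡.sym (strictlyInverseˡ x)))) (reflexive (cong v (strictlyInverseʳ j)))) ⟩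
        sum (λ j → ind (S? (to (from x) ∙ to j ⁻¹)) * v j)
          ≈⟨ eq (from x) ⟩
        a * v (from x) ∎

-- Unions of generator classes as combinations of cyclic subgroups

module CyclicSubgroups (G : FiniteGroup) (grading : AbelianByParity G) where
  open FiniteGroup G renaming (Carrier to 𝔾; order to N; assoc to ∙-assoc)
  open FiniteGroupProperties G
  open GroupProperties group using (inverseʳ-unique)
  open Powers G
  open AbelianByParity grading
  open SubgroupCombinations G grading
  open Inverse elements using (to; from; strictlyInverseˡ; strictlyInverseʳ)

  module _ (x : 𝔾) (x-even : degree x ≡ 0ℙ) where
    private
      instance
        _ = exponent≢0

    ⟨⟩-bounded : ∀ {y} → ⟨ x ⟩ y → ∃ λ (i : Fin exponent) → y ≡ x ^ toℕ i
    ⟨⟩-bounded (k , refl) = k mod exponent , (begin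
      x ^ k                                                ≡⟨ cong (x ^_) (m≡m%n+[m/n]*n k exponent) ⟩
      x ^ (k ℕ.% exponent ℕ.+ k ℕ./ exponent ℕ.* exponent) ≡⟨ ^-periodic (even-exponent x x-even) (k ℕ.% exponent) (k ℕ./ exponent) ⟩
      x ^ (k ℕ.% exponent)                                 ≡⟨ cong (x ^_) (Fin.toℕ-fromℕ< (m%n<n k exponent)) ⟨
      x ^ toℕ (k mod exponent)                           ∎)
      where open ≡.≡-Reasoning

    _∈⟨⟩? : Decidable ⟨ x ⟩
    y ∈⟨⟩? = map′ (λ (i , eq) → toℕ i , eq) ⟨⟩-bounded (Fin.any? (λ i → y ≟ x ^ toℕ i))

    ⟨⟩-⁻¹ : ∀ {y} → ⟨ x ⟩ y → ⟨ x ⟩ (y ⁻¹)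
    ⟨⟩-⁻¹ {y} (k , refl) = ℕ.pred exponent ℕ.* k , ≡.sym (inverseʳ-unique (x ^ k) (x ^ (ℕ.pred exponent ℕ.* k)) (begin
      x ^ k ∙ x ^ (ℕ.pred exponent ℕ.* k)       ≡⟨ ^-+ x k (ℕ.pred exponent ℕ.* k) ⟨
      x ^ (suc (ℕ.pred exponent) ℕ.* k)         ≡⟨ cong (λ m → x ^ (m ℕ.* k)) (ℕ.suc-pred exponent) ⟩
      x ^ (exponent ℕ.* k)                      ≡⟨ cong (x ^_) (ℕ.*-comm exponent k) ⟩
      x ^ (k ℕ.* exponent)                      ≡⟨ ^-periodic (even-exponent x x-even) 0 k ⟩
      ε                                         ∎))
      where open ≡.≡-Reasoning

    cyclic : NiceSubgroup
    cyclic = record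
      { mem    = ⟨ x ⟩
      ; mem?   = _∈⟨⟩?
      ; ε∈     = 0 , refl
      ; ∙-mem  = λ { (i , refl) (j , refl) → i ℕ.+ j , ≡.sym (^-+ x i j) }
      ; ⁻¹-mem = ⟨⟩-⁻¹
      ; nice   = inj₁ λ { y (k , refl) → even-^ x-even k }
      }

  EquigeneratedClosed : Pred 𝔾 0ℓ → Set
  EquigeneratedClosed P = ∀ {x y} → ⟨ y ⟩ x → ⟨ x ⟩ y → P x → P y

  module _ {c ℓ₁ ℓ₂} (𝕂 : AlgebraicallyClosedField₀ c ℓ₁ ℓ₂) where
    open AlgebraicallyClosedField₀ 𝕂 using (heytingField)
    open HeytingFieldProperties heytingField hiding (ring)
    open GroupRing commutativeRing G
    open SetoidReasoning setoid

    IsCombination : ∀ {P : Pred 𝔾 0ℓ} → Decidable P → Set _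
    IsCombination P? = ∃ λ L → ∀ x → ind (P? x) ≈ value 𝕂 L x

    private
      difference : ∀ {P Q R : Set} (p : Dec P) (q : Dec Q) (r : Dec R) → (P → Q) → (Q → ¬ P → R) → (R → Q) → (R → ¬ P) →
                   ind p ≈ ind q - ind r
      difference (yes p) (yes q) (yes r) f g h i = contradiction p (i r)
      difference (yes p) (yes q) (no ¬r) f g h i = ≈-sym (≈-trans (+-congˡ -0#≈0#) (+-identityʳ 1#))
      difference (yes p) (no ¬q) r       f g h i = contradiction (f p) ¬q
      difference (no ¬p) (yes q) (yes r) f g h i = ≈-sym (-‿inverseʳ 1#)
      difference (no ¬p) (yes q) (no ¬r) f g h i = contradiction (g q ¬p) ¬r
      difference (no ¬p) (no ¬q) (yes r) f g h i = contradiction (h r) ¬q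
      difference (no ¬p) (no ¬q) (no ¬r) f g h i = ≈-sym (-‿inverseʳ 0#)

      fromℤ[-1]* : ∀ x → fromℤ (ℤ.- + 1) * x ≈ - x
      fromℤ[-1]* x = ≈-trans (*-congʳ (-‿cong fromℤ-1)) (≈-trans (≈-sym (-‿distribˡ-* 1# x)) (-‿cong (*-identityˡ x)))

    combination-difference : ∀ {P Q R : Pred 𝔾 0ℓ} (P? : Decidable P) (Q? : Decidable Q) (R? : Decidable R) →
      (∀ {x} → P x → Q x) → (∀ {x} → Q x → ¬ P x → R x) → (∀ {x} → R x → Q x) → (∀ {x} → R x → ¬ P x) →
      IsCombination Q? → IsCombination R? → IsCombination P?
    combination-difference P? Q? R? f g h i (L , eq) (L′ , eq′) = L ++ scale (ℤ.- + 1) L′ , λ x → begin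
      ind (P? x)                                  ≈⟨ difference (P? x) (Q? x) (R? x) f g h i ⟩
      ind (Q? x) - ind (R? x)                     ≈⟨ +-cong (eq x) (-‿cong (eq′ x)) ⟩
      value 𝕂 L x - value 𝕂 L′ x                  ≈⟨ +-congˡ (fromℤ[-1]* _) ⟨
      value 𝕂 L x + fromℤ (ℤ.- + 1) * value 𝕂 L′ x ≈⟨ +-congˡ (value-scale 𝕂 (ℤ.- + 1) L′ x) ⟨
      value 𝕂 L x + value 𝕂 (scale (ℤ.- + 1) L′) x ≈⟨ value-++ 𝕂 L _ x ⟨
      value 𝕂 (L ++ scale (ℤ.- + 1) L′) x         ∎

    subgroup-combination : ∀ H → IsCombination (NiceSubgroup.mem? H)
    subgroup-combination H = (+ 1 , H) ∷ [] , λ x →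
      ≈-sym (≈-trans (+-identityʳ _) (≈-trans (*-congʳ fromℤ-1) (*-identityˡ _)))

    combination-∪ : ∀ {P Q R : Pred 𝔾 0ℓ} (P? : Decidable P) (Q? : Decidable Q) (R? : Decidable R) →
      (∀ {x} → P x → Q x ⊎ R x) → (∀ {x} → Q x → P x) → (∀ {x} → R x → P x) → (∀ {x} → Q x → ¬ R x) →
      IsCombination Q? → IsCombination R? → IsCombination P?
    combination-∪ P? Q? R? f g h i (L , eq) (L′ , eq′) = L ++ L′ , λ x →
      ≈-trans (disjoint (P? x) (Q? x) (R? x) f g h i) (≈-trans (+-cong (eq x) (eq′ x)) (≈-sym (value-++ 𝕂 L L′ x)))
      where
      disjoint : ∀ {P Q R : Set} (p : Dec P) (q : Dec Q) (r : Dec R) → (P → Q ⊎ R) → (Q → P) → (R → P) → (Q → ¬ R) →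
                 ind p ≈ ind q + ind r
      disjoint p       (yes q) (yes r) f g h i = contradiction r (i q)
      disjoint p       (yes q) (no ¬r) f g h i = ≈-trans (reflexive (ind-yes p (g q))) (≈-sym (+-identityʳ 1#))
      disjoint p       (no ¬q) (yes r) f g h i = ≈-trans (reflexive (ind-yes p (h r))) (≈-sym (+-identityˡ 1#))
      disjoint p       (no ¬q) (no ¬r) f g h i = ≈-trans (reflexive (ind-no p λ p → lem (f p))) (≈-sym (+-identityˡ 0#))
        where
        lem : ¬ (_ ⊎ _)
        lem (inj₁ q) = ¬q q
        lem (inj₂ r) = ¬r r

    ∅-combination : ∀ {P : Pred 𝔾 0ℓ} (P? : Decidable P) → (∀ x → ¬ P x) → IsCombination P?
    ∅-combination P? ¬P = [] , λ x → reflexive (ind-no (P? x) (¬P x))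

    module _ (x : 𝔾) (x-even : degree x ≡ 0ℙ) where
      Generates : Pred 𝔾 0ℓ
      Generates y = ⟨ x ⟩ y × ⟨ y ⟩ x

      generates? : Decidable Generates
      generates? y with _∈⟨⟩? x x-even y
      ... | no ¬p = no (¬p ∘ proj₁)
      ... | yes p@(k , refl) = map′ (p ,_) proj₂ (_∈⟨⟩? y (even-^ x-even k) x)

    private
      -- Whenever the head of l lies in P, its whole generator class is split off; what remains is
      -- again closed. The combinations for single classes come in as `gen`, because
      -- `generators-combination` uses this lemma in its own recursion, on smaller cyclic groups.
      from-list : ∀ (l : List 𝔾) {P : Pred 𝔾 0ℓ} (P? : Decidable P) (P-even : ∀ {x} → P x → degree x ≡ 0ℙ) →
        EquigeneratedClosed P → (∀ {x} (p : P x) → IsCombination (generates? x (P-even p))) →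
        (∀ {x} → P x → x ∈ˡ l) → IsCombination P?
      from-list []      P? P-even closed gen P⊆l = ∅-combination P? λ x p → case (P⊆l p)
        where
        case : ∀ {x} → ¬ (x ∈ˡ [])
        case ()
      from-list (x ∷ l) {P} P? P-even closed gen P⊆l with P? x
      ... | no ¬p = from-list l P? P-even closed gen (λ q → tail q (P⊆l q))
        where
        tail : ∀ {y} → P y → y ∈ˡ (x ∷ l) → y ∈ˡ l
        tail q (here refl) = contradiction q ¬p
        tail q (there m)   = m
      ... | yes p = combination-∪ P? (generates? x (P-even p)) (λ y → P? y ×-dec ¬? (generates? x (P-even p) y))
        (λ {y} q → split q (generates? x (P-even p) y))
        (λ (a , b) → closed b a p) proj₁ (λ q r → proj₂ r q) (gen p)
        (from-list l (λ y → P? y ×-dec ¬? (generates? x (P-even p) y)) (P-even ∘ proj₁)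
          (λ { a b (q , ¬g) → closed a b q , λ (u , v) → ¬g (⟨⟩-trans u a , ⟨⟩-trans b v) })
          (λ r → gen (proj₁ r))
          (λ { (q , ¬g) → tail ¬g (P⊆l q) }))
        where
        split : ∀ {y} → P y → Dec (Generates x (P-even p) y) → Generates x (P-even p) y ⊎ (P y × ¬ Generates x (P-even p) y)
        split q (yes g) = inj₁ g
        split q (no ¬g) = inj₂ (q , ¬g)
        tail : ∀ {y} → ¬ Generates x (P-even p) y → y ∈ˡ (x ∷ l) → y ∈ˡ l
        tail ¬g (here refl) = contradiction (⟨⟩-refl x , ⟨⟩-refl x) ¬g
        tail ¬g (there m)   = m

      all-elements : ∀ x → x ∈ˡ map to (allFin N)
      all-elements x = ≡.subst (_∈ˡ map to (allFin N)) (strictlyInverseˡ x) (∈-map⁺ to (∈-allFin (from x)))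

      size : ∀ x → degree x ≡ 0ℙ → ℕ
      size x e = count (λ i → _∈⟨⟩? x e (to i))

      -- The non-generators in ⟨x⟩ form a union of generator classes of strictly smaller cyclic
      -- groups; subtracting them from ⟨x⟩ is Möbius inversion over the cyclic subgroups, carried
      -- out recursively.
      generators-combination : ∀ x (e : degree x ≡ 0ℙ) → Acc ℕ._<_ (size x e) → IsCombination (generates? x e)
      generators-combination x e (acc rec) = combination-difference (generates? x e) (_∈⟨⟩? x e) rest?
        proj₁ (λ m ¬g → m , λ x∈⟨y⟩ → ¬g (m , x∈⟨y⟩)) proj₁ (λ (_ , ¬m) (_ , m) → ¬m m)
        (subgroup-combination (cyclic x e))
        (from-list (map to (allFin N)) rest? rest-even
          (λ { a b (m , ¬m) → ⟨⟩-trans m b , λ m′ → ¬m (⟨⟩-trans b m′) })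
          (λ {y} r → generators-combination y (rest-even r) (rec (smaller y r)))
          (λ {y} _ → all-elements y))
        where
        Rest : Pred 𝔾 0ℓ
        Rest y = ⟨ x ⟩ y × ¬ ⟨ y ⟩ x
        rest-even : ∀ {y} → Rest y → degree y ≡ 0ℙ
        rest-even ((k , refl) , _) = even-^ e k
        rest? : Decidable Rest
        rest? y with _∈⟨⟩? x e y
        ... | no ¬m = no (¬m ∘ proj₁)
        ... | yes m@(k , refl) = map′ (m ,_) proj₂ (¬? (_∈⟨⟩? y (even-^ e k) x))
        smaller : ∀ y (r : Rest y) → size y (rest-even r) ℕ.< size x e
        smaller y r@(m , ¬m) = count-< (λ i → _∈⟨⟩? y (rest-even r) (to i)) (λ i → _∈⟨⟩? x e (to i))
          (λ i → ⟨⟩-trans m) (from x) (λ m′ → ¬m (≡.subst ⟨ y ⟩ (strictlyInverseˡ x) m′))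
          (≡.subst ⟨ x ⟩ (≡.sym (strictlyInverseˡ x)) (⟨⟩-refl x))

    equigenerated-combination : ∀ {P : Pred 𝔾 0ℓ} (P? : Decidable P) → (∀ {x} → P x → degree x ≡ 0ℙ) →
      EquigeneratedClosed P → IsCombination P?
    equigenerated-combination P? P-even closed = from-list (map to (allFin N)) P? P-even closed
      (λ {x} p → generators-combination x (P-even p) (<-wellFounded _)) (λ {x} _ → all-elements x)

-- Coprime exponents and generators of one cyclic group

module Coprimality where
  open import Data.Nat.Base using (_+_; _*_; _^_; _<_; _≤_)

  prime-divisor : ∀ n → .{{NonZero n}} → n ≢ 1 → ∃ λ q → Prime q × q ∣ n
  prime-divisor n n≢1 with factorise n
  ... | record { factors = []     ; isFactorisation = refl } = contradiction refl n≢1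
  ... | record { factors = q ∷ qs ; isFactorisation = eq ; factorsPrime = q-prime ∷ _ } =
    q , q-prime , ≡.subst (q ∣_) (≡.sym eq) (m∣m*n (product qs))

  gcd≡1 : ∀ a b → .{{NonZero b}} → (∀ q → Prime q → q ∣ a → ¬ q ∣ b) → gcd a b ≡ 1
  gcd≡1 a b none with gcd a b ℕ.≟ 1
  ... | yes eq = eq
  ... | no ≢1  with prime-divisor (gcd a b) {{ℕ.≢-nonZero gcd≢0}} ≢1
    where
    gcd≢0 : gcd a b ≢ 0
    gcd≢0 eq = ℕ.≢-nonZero⁻¹ b (0∣⇒≡0 (≡.subst (_∣ b) eq (gcd[m,n]∣n a b)))
  ...   | q , q-prime , q∣g = contradiction (∣-trans q∣g (gcd[m,n]∣n a b)) (none q q-prime (∣-trans q∣g (gcd[m,n]∣m a b)))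

  prime∣gcd⇒≢1 : ∀ {q a b} → Prime q → q ∣ a → q ∣ b → gcd a b ≢ 1
  prime∣gcd⇒≢1 {q} q-prime q∣a q∣b eq = ¬prime[1] (≡.subst Prime (∣1⇒≡1 (≡.subst (q ∣_) eq (gcd-greatest q∣a q∣b))) q-prime)

  gcd[p^i,m]≡1 : ∀ {p m} → .{{NonZero m}} → Prime p → p ∤ m → ∀ i → gcd (p ^ i) m ≡ 1
  gcd[p^i,m]≡1 {p} {m} p-prime p∤m i = gcd≡1 (p ^ i) m λ q q-prime q∣p^i q∣m → p∤m (≡.subst (_∣ m) (q≡p q q-prime (∣p q q-prime i q∣p^i)) q∣m)
    where
    ∣p : ∀ q → Prime q → ∀ i → q ∣ p ^ i → q ∣ p
    ∣p q q-prime zero    q∣1 = contradiction (≡.subst Prime (∣1⇒≡1 q∣1) q-prime) ¬prime[1]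
    ∣p q q-prime (suc i) q∣  with euclidsLemma p (p ^ i) q-prime q∣
    ... | inj₁ q∣p   = q∣p
    ... | inj₂ q∣p^i = ∣p q q-prime i q∣p^i
    q≡p : ∀ q → Prime q → q ∣ p → q ≡ p
    q≡p q q-prime q∣p with q ℕ.≟ p
    ... | yes eq = eq
    ... | no q≢p = contradiction (hasNonTrivialDivisor {{prime⇒nonTrivial q-prime}} (ℕ.≤∧≢⇒< (∣⇒≤ {{prime⇒nonZero p-prime}} q∣p) q≢p) q∣p) (Prime.notComposite p-prime)

  -- c collects the primes of M which do not divide k.
  coprime-part : ∀ k M → .{{NonZero M}} → Acc _<_ M →
    ∃ λ c → 1 ≤ c × gcd k c ≡ 1 × (∀ q → Prime q → q ∣ M → q ∣ k ⊎ q ∣ c)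
  coprime-part k M (acc rec) with gcd k M ℕ.≟ 1
  ... | yes eq = M , ℕ.>-nonZero⁻¹ M , eq , λ q _ q∣M → inj₂ q∣M
  ... | no g≢1 with gcd[m,n]∣n k M
  ...   | divides m M≡m*g with coprime-part k m {{m≢0}} (rec m<M)
    where
    m≢0 : NonZero m
    m≢0 = ℕ.≢-nonZero λ { refl → ℕ.≢-nonZero⁻¹ M M≡m*g }
    1<g : 1 < gcd k M
    1<g = ℕ.≤∧≢⇒< (ℕ.n≢0⇒n>0 λ eq → ℕ.≢-nonZero⁻¹ M (≡.trans M≡m*g (≡.trans (cong (m *_) eq) (ℕ.*-zeroʳ m)))) (λ eq → g≢1 (≡.sym eq))
    m<M : m < M
    m<M = ≡.subst (m <_) (≡.sym M≡m*g) (ℕ.m<m*n m (gcd k M) {{m≢0}} 1<g)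
  ...     | c , 1≤c , coprime , cover = c , 1≤c , coprime , λ q q-prime q∣M →
    case-⊎ q q-prime (euclidsLemma m (gcd k M) q-prime (≡.subst (q ∣_) M≡m*g q∣M))
    where
    case-⊎ : ∀ q → Prime q → q ∣ m ⊎ q ∣ gcd k M → q ∣ k ⊎ q ∣ c
    case-⊎ q q-prime (inj₁ q∣m) = cover q q-prime q∣m
    case-⊎ q q-prime (inj₂ q∣g) = inj₁ (∣-trans q∣g (gcd[m,n]∣m k M))

  -- Units modulo m lift to units modulo M. With c from `coprime-part`, a prime divisor of M divides
  -- exactly one of k and cm, hence not their sum.
  coprime-lift : ∀ k m M → .{{NonZero m}} → .{{NonZero M}} → gcd k m ≡ 1 →
    ∃ λ c → 1 ≤ k + c * m × gcd (k + c * m) M ≡ 1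
  coprime-lift k m M coprime with coprime-part k M (<-wellFounded M)
  ... | c , 1≤c , k⊥c , cover = c , ℕ.≤-trans (ℕ.*-mono-≤ 1≤c (ℕ.>-nonZero⁻¹ m)) (ℕ.m≤n+m (c * m) k) ,
    gcd≡1 (k + c * m) M λ q q-prime q∣sum q∣M → excluded q q-prime q∣sum (cover q q-prime q∣M)
    where
    excluded : ∀ q → Prime q → q ∣ k + c * m → ¬ (q ∣ k ⊎ q ∣ c)
    excluded q q-prime q∣sum (inj₁ q∣k) with euclidsLemma c m q-prime (∣m+n∣m⇒∣n q∣sum q∣k)
    ... | inj₁ q∣c = prime∣gcd⇒≢1 q-prime q∣k q∣c k⊥c
    ... | inj₂ q∣m = prime∣gcd⇒≢1 q-prime q∣k q∣m coprime
    excluded q q-prime q∣sum (inj₂ q∣c) = prime∣gcd⇒≢1 q-prime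
      (∣m+n∣m⇒∣n (≡.subst (q ∣_) (ℕ.+-comm k (c * m)) q∣sum) (∣m⇒∣m*n m q∣c)) q∣c k⊥c

  4∣m*d⇒4∣m : ∀ {m d} → 2 ∤ d → 4 ∣ m * d → 4 ∣ m
  4∣m*d⇒4∣m {m} {d} 2∤d 4∣md with euclidsLemma m d prime[2] (∣-trans (divides 2 refl) 4∣md)
  ... | inj₂ 2∣d = contradiction 2∣d 2∤d
  ... | inj₁ (divides c m≡c*2) with euclidsLemma c d prime[2] (*-cancelˡ-∣ 2 (≡.subst (4 ∣_) (≡.trans (cong (_* d) m≡c*2) (c*2*d≡ c d)) 4∣md))
    where
    c*2*d≡ : ∀ c d → c * 2 * d ≡ 2 * (c * d)
    c*2*d≡ c d = ≡.trans (cong (_* d) (ℕ.*-comm c 2)) (ℕ.*-assoc 2 c d)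
  ...   | inj₂ 2∣d = contradiction 2∣d 2∤d
  ...   | inj₁ (divides c′ c≡c′*2) = divides c′ (≡.trans m≡c*2 (≡.trans (cong (_* 2) c≡c′*2) (ℕ.*-assoc c′ 2 2)))

open Coprimality

module EquigeneratedPowers (G : FiniteGroup) where
  open FiniteGroup G renaming (Carrier to 𝔾; _^_ to _^ᴳ_)
  open FiniteGroupProperties G
  open Powers G
  open import Data.Nat.Base using (_+_; _*_; _≤_)

  x^gcd≡ε : ∀ {x i j} → x ^ᴳ i ≡ ε → x ^ᴳ j ≡ ε → x ^ᴳ gcd i j ≡ ε
  x^gcd≡ε {x} {i} {j} x^i≡ε x^j≡ε with Bézout.identity (gcd-GCD i j)
  ... | Bézout.+- u v eq = ≡.trans (≡.sym (^-periodic x^j≡ε (gcd i j) v)) (≡.trans (cong (x ^ᴳ_) eq) (^-periodic x^i≡ε 0 u))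
  ... | Bézout.-+ u v eq = ≡.trans (≡.sym (^-periodic x^i≡ε (gcd i j) u)) (≡.trans (cong (x ^ᴳ_) eq) (^-periodic x^j≡ε 0 v))

  -- From x = y^k and y = x^j follows y^t = ε for t = jk - 1, and k is prime to t. So k is prime to
  -- gcd t M, which also kills y, and adding multiples of it makes k prime to M. If jk = 0 then y =
  -- ε, and the exponent 1 serves.
  equigenerated⇒coprime-power : ∀ {x y} M → .{{NonZero M}} → y ^ᴳ M ≡ ε → ⟨ y ⟩ x → ⟨ x ⟩ y →
    ∃ λ k → 1 ≤ k × gcd k M ≡ 1 × x ≡ y ^ᴳ k
  equigenerated⇒coprime-power {y = y} M y^M≡ε (k , refl) (j , y≡) with j * k in eq
  ... | zero  = 1 , ℕ.≤-refl , 1⊥M , ≡.trans (cong (_^ᴳ k) y≡ε) (≡.trans (ε^ k) (≡.sym (≡.trans (x^1≡x y) y≡ε)))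
    where
    y≡ε : y ≡ ε
    y≡ε = ≡.trans y≡ (≡.trans (^-^ y k j) (cong (y ^ᴳ_) eq))
    1⊥M : gcd 1 M ≡ 1
    1⊥M = ∣1⇒≡1 (gcd[m,n]∣m 1 M)
  ... | suc t with coprime-lift k (gcd t M) M {{gcd≢0}} k⊥g
    where
    gcd≢0 : NonZero (gcd t M)
    gcd≢0 = ℕ.≢-nonZero λ eq → ℕ.≢-nonZero⁻¹ M (0∣⇒≡0 (≡.subst (_∣ M) eq (gcd[m,n]∣n t M)))
    k⊥g : gcd k (gcd t M) ≡ 1
    k⊥g = ∣1⇒≡1 (∣m+n∣m⇒∣n {gcd k (gcd t M)} {t} {1} (≡.subst (gcd k (gcd t M) ∣_) (≡.trans eq (ℕ.+-comm 1 t)) (∣n⇒∣m*n j (gcd[m,n]∣m k (gcd t M))))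
      (∣-trans (gcd[m,n]∣n k (gcd t M)) (gcd[m,n]∣m t M)))
  ...   | c , 1≤ , coprime = k + c * gcd t M , 1≤ , coprime , ≡.sym (^-periodic (x^gcd≡ε {y} {t} {M} y^t≡ε y^M≡ε) k c)
    where
    y∙y^t≡y : y ∙ y ^ᴳ t ≡ y
    y∙y^t≡y = ≡.sym (≡.trans y≡ (≡.trans (^-^ y k j) (cong (y ^ᴳ_) eq)))
    y^t≡ε : y ^ᴳ t ≡ ε
    y^t≡ε = ≡.trans (≡.sym (x⁻¹∙[x∙y]≡y y (y ^ᴳ t))) (≡.trans (cong (y ⁻¹ ∙_) y∙y^t≡y) (inverseˡ y))

-- Congruences and words in T₈ₙ

module Congruences where
  open import Data.Nat.Base using (_+_; _*_; _∸_; _%_; _/_)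

  toℕ-mod : ∀ p d .{{_ : NonZero d}} → toℕ (p mod d) ≡ p % d
  toℕ-mod p d = Fin.toℕ-fromℕ< (m%n<n p d)

  mod-cong : ∀ {p q} d .{{_ : NonZero d}} → p % d ≡ q % d → p mod d ≡ q mod d
  mod-cong {p} {q} d eq = Fin.toℕ-injective (≡.trans (toℕ-mod p d) (≡.trans eq (≡.sym (toℕ-mod q d))))

  +-mod-cong : ∀ {p p′ q q′} d .{{_ : NonZero d}} → p % d ≡ p′ % d → q % d ≡ q′ % d → (p + q) % d ≡ (p′ + q′) % d
  +-mod-cong {p} {p′} {q} {q′} d e f = ≡.trans (%-distribˡ-+ p q d)
    (≡.trans (cong₂ (λ x y → (x + y) % d) e f) (≡.sym (%-distribˡ-+ p′ q′ d)))

  *-mod-cong : ∀ {p p′ q q′} d .{{_ : NonZero d}} → p % d ≡ p′ % d → q % d ≡ q′ % d → (p * q) % d ≡ (p′ * q′) % d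
  *-mod-cong {p} {p′} {q} {q′} d e f = ≡.trans (%-distribˡ-* p q d)
    (≡.trans (cong₂ (λ x y → (x * y) % d) e f) (≡.sym (%-distribˡ-* p′ q′ d)))

  +-mod-cancelʳ : ∀ {p q} c d .{{_ : NonZero d}} → (p + c) % d ≡ (q + c) % d → p % d ≡ q % d
  +-mod-cancelʳ {p} {q} c d eq = ≡.trans (≡.sym (shift p)) (≡.trans (+-mod-cong {p + c} {q + c} d eq (refl {x = (d ∸ c % d) % d})) (shift q))
    where
    shift : ∀ p → (p + c + (d ∸ c % d)) % d ≡ p % d
    shift p = ≡.trans (cong (_% d) (≡.trans (cong (λ c′ → p + c′ + (d ∸ c % d)) (m≡m%n+[m/n]*n c d))
      (≡.trans (rearrange p (c % d) (c / d * d) (d ∸ c % d)) (cong (λ x → p + (x + c / d * d)) (ℕ.m+[n∸m]≡n (ℕ.<⇒≤ (m%n<n c d)))))))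
      ([m+kn]%n≡m%n p (suc (c / d)) d)
      where
      rearrange : ∀ p x y z → p + (x + y) + z ≡ p + (x + z + y)
      rearrange = ℕ-Solver.solve-∀

open Congruences

module T₈Words (n : ℕ) .{{_ : NonZero n}} where
  open T₈ n
  open import Data.Nat.Base using (_+_; _*_; _<_; _%_; _/_)
  open Powers T₈ₙ

  instance
    2n≢0 : NonZero (2 * n)
    2n≢0 = ℕ.m*n≢0 2 n

  n≡ : suc (pred n) ≡ n
  n≡ = ℕ.suc-pred n

  σ≡ : σ ≡ suc (2 * pred n)
  σ≡ = ℕ.suc-injective (≡.trans (ℕ.suc-pred (2 * n)) (≡.trans (cong (2 *_) (≡.sym n≡)) (lemma (pred n))))
    where
    lemma : ∀ m → 2 * suc m ≡ suc (suc (2 * m))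
    lemma = ℕ-Solver.solve-∀

  ≋-multiple : ∀ p k → p + k * (2 * n) ≋ p
  ≋-multiple p k = [m+kn]%n≡m%n p k (2 * n)

  σσ≋ : ∀ x → σ * (σ * x) ≋ x
  σσ≋ x = ≡.trans (cong (_% (2 * n)) (≡.trans (cong (λ s → s * (s * x)) σ≡)
    (≡.trans (lemma (pred n) x) (cong (λ m → x + 2 * pred n * x * (2 * m)) n≡)))) (≋-multiple x (2 * pred n * x))
    where
    lemma : ∀ m x → suc (2 * m) * (suc (2 * m) * x) ≡ x + 2 * m * x * (2 * suc m)
    lemma = ℕ-Solver.solve-∀

  σ^even≋ : ∀ e x → σ ℕ.^ (e * 2) * x ≋ x
  σ^even≋ zero    x = cong (_% (2 * n)) (ℕ.*-identityˡ x)
  σ^even≋ (suc e) x = ≡.trans (cong (_% (2 * n)) (lemma σ (σ ℕ.^ (e * 2)) x)) (≡.trans (σσ≋ _) (σ^even≋ e x))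
    where
    lemma : ∀ s t x → s * (s * t) * x ≡ s * (s * (t * x))
    lemma = ℕ-Solver.solve-∀

  -- b inverts a, so b² is central.
  word-even-∙ : ∀ e p p′ q′ → word p (e * 2) ∙ word p′ q′ ≡ word (p + p′) (e * 2 + q′)
  word-even-∙ e p p′ q′ = ≡.trans (word-∙ p (e * 2) p′ q′)
    (word-cong (e * 2 + q′) (+-mod-cong {p} (2 * n) refl (σ^even≋ e p′)))

  word-+4 : ∀ p q → word p (4 + q) ≡ word (p + n) q
  word-+4 p q = cong₂ _,_ (cong (_mod (2 * n)) (≡.trans (cong (λ d → p + n * d) (+-distrib-/-∣ˡ q (∣-refl {4}))) (lemma p n (q / 4))))
    (mod-cong {4 + q} {q} 4 (≡.trans (cong (_% 4) (ℕ.+-comm 4 q)) ([m+n]%n≡m%n q 4)))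
    where
    lemma : ∀ p n d → p + n * (1 + d) ≡ p + n + n * d
    lemma = ℕ-Solver.solve-∀

  word-+8 : ∀ k p q → word p (k * 8 + q) ≡ word p q
  word-+8 zero    p q = refl
  word-+8 (suc k) p q = ≡.trans (word-+4 p (4 + (k * 8 + q))) (≡.trans (word-+4 (p + n) (k * 8 + q))
    (≡.trans (word-+8 k (p + n + n) q) (word-cong q (≡.trans (cong (_% (2 * n)) (lemma p n)) (≋-multiple p 1)))))
    where
    lemma : ∀ p n → p + n + n ≡ p + 1 * (2 * n)
    lemma = ℕ-Solver.solve-∀

  word-^ : ∀ e p k → word p (e * 2) ^ k ≡ word (k * p) (k * (e * 2))
  word-^ e p zero    = refl
  word-^ e p (suc k) = ≡.trans (cong (word p (e * 2) ∙_) (word-^ e p k)) (word-even-∙ e p (k * p) (k * (e * 2)))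

  word-injective : ∀ {p p′} q → word p q ≡ word p′ q → p ≋ p′
  word-injective {p} {p′} q eq = +-mod-cancelʳ (n * (q / 4)) (2 * n)
    (≡.trans (≡.sym (toℕ-mod _ (2 * n))) (≡.trans (cong (toℕ ∘ proj₁) eq) (toℕ-mod _ (2 * n))))

  a^∙b^ : ∀ r s → a ^ r ∙ b ^ s ≡ word r s
  a^∙b^ r s = ≡.trans (cong₂ _∙_ (a^-word r) (b^-word s)) (≡.trans (word-even-∙ 0 r 0 s) (cong (λ k → word k s) (ℕ.+-identityʳ r)))

  a^∙b : ∀ r → a ^ r ∙ b ≡ word r 1
  a^∙b r = ≡.trans (cong (a ^ r ∙_) (≡.sym (x^1≡x b))) (a^∙b^ r 1)

  degree : T → Parity
  degree (r , s) = parity (toℕ s)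

  degree-word : ∀ p q → degree (word p q) ≡ parity q
  degree-word p q = begin
    parity (toℕ (q mod 4))                       ≡⟨ cong parity (toℕ-mod q 4) ⟩
    parity (q % 4)                               ≡⟨ ℙ.+-identityʳ (parity (q % 4)) ⟨
    parity (q % 4) ℙ.+ 0ℙ                        ≡⟨ cong (parity (q % 4) ℙ.+_) (≡.trans (ℙ.*-homo-* (q / 4) 4) (ℙ.*-zeroʳ (parity (q / 4)))) ⟨
    parity (q % 4) ℙ.+ parity (q / 4 * 4)        ≡⟨ ℙ.+-homo-+ (q % 4) (q / 4 * 4) ⟨
    parity (q % 4 + q / 4 * 4)                   ≡⟨ cong parity (m≡m%n+[m/n]*n q 4) ⟨
    parity q                                     ∎
    where open ≡.≡-Reasoning

  even-shape : ∀ x → degree x ≡ 0ℙ → (∃ λ r → r < 2 * n × x ≡ word r 0) ⊎ (∃ λ r → r < 2 * n × x ≡ word r 2)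
  even-shape (r , 0F) _ = inj₁ (toℕ r , Fin.toℕ<n r , ≡.sym (word-normal r 0F))
  even-shape (r , 3F) ()
  even-shape (r , 2F) _ = inj₂ (toℕ r , Fin.toℕ<n r , ≡.sym (word-normal r 2F))

  odd-shape : ∀ x → degree x ≡ 1ℙ → (∃ λ r → r < 2 * n × x ≡ word r 1) ⊎ (∃ λ r → r < 2 * n × x ≡ word r 3)
  odd-shape (r , 1F) _ = inj₁ (toℕ r , Fin.toℕ<n r , ≡.sym (word-normal r 1F))
  odd-shape (r , 3F) _ = inj₂ (toℕ r , Fin.toℕ<n r , ≡.sym (word-normal r 3F))

  even-word : ∀ x → degree x ≡ 0ℙ → ∃ λ e → ∃ λ r → x ≡ word r (e * 2)
  even-word x x-even with even-shape x x-even
  ... | inj₁ (r , _ , eq) = 0 , r , eq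
  ... | inj₂ (r , _ , eq) = 1 , r , eq

  -- The exponent 4n kills both a, of order 2n, and b², of order 4.
  grading : AbelianByParity T₈ₙ
  grading = record
    { degree        = degree
    ; degree-∙      = λ { (r , s) (r′ , s′) → ≡.trans (degree-word (toℕ r + σ ℕ.^ toℕ s * toℕ r′) (toℕ s + toℕ s′)) (ℙ.+-homo-+ (toℕ s) (toℕ s′)) }
    ; exponent      = 4 * n
    ; exponent≢0    = ℕ.m*n≢0 4 n
    ; even-comm     = comm
    ; even-exponent = λ x x-even → exponent (even-word x x-even)
    }
    where
    comm : ∀ x y → degree x ≡ 0ℙ → degree y ≡ 0ℙ → x ∙ y ≡ y ∙ x
    comm x y x-even y-even with even-word x x-even | even-word y y-even
    ... | e , p , refl | e′ , p′ , refl = ≡.trans (word-even-∙ e p p′ (e′ * 2))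
      (≡.trans (cong₂ word (ℕ.+-comm p p′) (ℕ.+-comm (e * 2) (e′ * 2))) (≡.sym (word-even-∙ e′ p′ p (e * 2))))
    exponent : ∀ {x} → (∃ λ e → ∃ λ r → x ≡ word r (e * 2)) → x ^ (4 * n) ≡ ε
    exponent (e , r , refl) = begin
      word r (e * 2) ^ (4 * n)                  ≡⟨ word-^ e r (4 * n) ⟩
      word (4 * n * r) (4 * n * (e * 2))        ≡⟨ cong₂ word (lemma n r) (lemma′ n e) ⟩
      word (0 + 2 * r * (2 * n)) (n * e * 8 + 0) ≡⟨ word-+8 (n * e) (0 + 2 * r * (2 * n)) 0 ⟩
      word (0 + 2 * r * (2 * n)) 0              ≡⟨ word-cong 0 (≋-multiple 0 (2 * r)) ⟩
      ε                                         ∎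
      where
      open ≡.≡-Reasoning
      lemma : ∀ n r → 4 * n * r ≡ 0 + 2 * r * (2 * n)
      lemma = ℕ-Solver.solve-∀
      lemma′ : ∀ n e → 4 * n * (e * 2) ≡ n * e * 8 + 0
      lemma′ = ℕ-Solver.solve-∀

-- The sets [aʳ] and [aʳb²] as generator classes

module GeneratorClasses (n : ℕ) .{{_ : NonZero n}} where
  open T₈ n
  open import Data.Nat.Base using (_+_; _*_; _<_; _≤_; _%_; _/_)
  open T₈Words n
  open Powers T₈ₙ
  open EquigeneratedPowers T₈ₙ

  private
    gcd≢0 : ∀ r → NonZero (gcd r (2 * n))
    gcd≢0 r = ℕ.≢-nonZero (gcd[m,n]≢0 r (2 * n) (inj₂ (ℕ.≢-nonZero⁻¹ (2 * n))))

    o*gcd : ∀ r → o r * gcd r (2 * n) ≡ 2 * n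
    o*gcd r = m/n*n≡m {{gcd≢0 r}} (gcd[m,n]∣n r (2 * n))

  o≢0 : ∀ r → NonZero (o r)
  o≢0 r = ℕ.>-nonZero (proj₁ (o-isOrder r))

  2n∣⇒o∣ : ∀ {r m} → 2 * n ∣ m * r → o r ∣ m
  2n∣⇒o∣ {r} {m} 2n∣mr = *-cancelʳ-∣ (gcd r (2 * n)) {{gcd≢0 r}}
    (≡.subst₂ _∣_ (≡.sym (o*gcd r)) (≡.sym (c*gcd[m,n]≡gcd[cm,cn] m r (2 * n))) (gcd-greatest 2n∣mr (n∣m*n m)))

  o∣⇒2n∣ : ∀ {r m} → o r ∣ m → 2 * n ∣ m * r
  o∣⇒2n∣ {r} (divides c refl) with gcd[m,n]∣m r (2 * n)
  ... | divides q r≡qg = divides (c * q) (≡.trans (cong (c * o r *_) r≡qg)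
    (≡.trans (lemma c (o r) q (gcd r (2 * n))) (cong (c * q *_) (o*gcd r))))
    where
    lemma : ∀ c o q g → c * o * (q * g) ≡ c * q * (o * g)
    lemma = ℕ-Solver.solve-∀

  word≡ε : ∀ {m} → 2 * n ∣ m → word m 0 ≡ ε
  word≡ε (divides q refl) = word-cong 0 (≋-multiple 0 q)

  word≡ε⇒∣ : ∀ {m} → word m 0 ≡ ε → 2 * n ∣ m
  word≡ε⇒∣ {m} eq = m%n≡0⇒n∣m m (2 * n) (≡.trans (word-injective 0 eq) (n∣m⇒m%n≡0 0 (2 * n) ((2 * n) ∣0)))

  word-0-^ : ∀ r k → word r 0 ^ k ≡ word (k * r) 0
  word-0-^ r k = ≡.trans (word-^ 0 r k) (cong (word (k * r)) (ℕ.*-zeroʳ k))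

  word-2-^[4t+1] : ∀ r t → word r 2 ^ (4 * t + 1) ≡ word ((4 * t + 1) * r) 2
  word-2-^[4t+1] r t = ≡.trans (word-^ 1 r (4 * t + 1)) (≡.trans (cong (word ((4 * t + 1) * r)) (lemma t)) (word-+8 t ((4 * t + 1) * r) 2))
    where
    lemma : ∀ t → (4 * t + 1) * 2 ≡ t * 8 + 2
    lemma = ℕ-Solver.solve-∀

  -- Here b² contributes b^(8t+6) = b⁴b² = aⁿb², the origin of the summand n in `[a^_b²]`.
  word-2-^[4t+3] : ∀ r t → word r 2 ^ (4 * t + 3) ≡ word ((4 * t + 3) * r + n) 2
  word-2-^[4t+3] r t = ≡.trans (word-^ 1 r (4 * t + 3)) (≡.trans (cong (word ((4 * t + 3) * r)) (lemma t))
    (≡.trans (word-+8 t ((4 * t + 3) * r) 6) (word-+4 ((4 * t + 3) * r) 2)))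
    where
    lemma : ∀ t → (4 * t + 3) * 2 ≡ t * 8 + 6
    lemma = ℕ-Solver.solve-∀

  word-2-^4∣ : ∀ r {m} → 4 ∣ m → word r 2 ^ m ≡ word (m * r) 0
  word-2-^4∣ r (divides c refl) = ≡.trans (word-^ 1 r (c * 4)) (≡.trans (cong (word (c * 4 * r)) (lemma c)) (word-+8 c (c * 4 * r) 0))
    where
    lemma : ∀ c → c * 4 * 2 ≡ c * 8 + 0
    lemma = ℕ-Solver.solve-∀

  word-2-^lcm≡ε : ∀ r → word r 2 ^ lcm (o r) 4 ≡ ε
  word-2-^lcm≡ε r = ≡.trans (word-2-^4∣ r {lcm (o r) 4} (n∣lcm[m,n] (o r) 4)) (word≡ε {lcm (o r) 4 * r} (o∣⇒2n∣ {r} {lcm (o r) 4} (m∣lcm[m,n] (o r) 4)))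

  private
    ⟨⟩-^≡ε : ∀ {x y m} → ⟨ x ⟩ y → x ^ m ≡ ε → y ^ m ≡ ε
    ⟨⟩-^≡ε {x} {m = m} (j , refl) x^m≡ε = begin
      (x ^ j) ^ m    ≡⟨ ^-^ x j m ⟩
      x ^ (m * j)    ≡⟨ cong (x ^_) (ℕ.*-comm m j) ⟩
      x ^ (j * m)    ≡⟨ ^-^ x m j ⟨
      (x ^ m) ^ j    ≡⟨ cong (_^ j) x^m≡ε ⟩
      ε ^ j          ≡⟨ ε^ j ⟩
      ε              ∎
      where open ≡.≡-Reasoning

    lcm≢0 : ∀ r → lcm (o r) 4 ≢ 0
    lcm≢0 r eq = ℕ.≢-nonZero⁻¹ (o r * 4) {{ℕ.m*n≢0 (o r) 4 {{o≢0 r}}}}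
      (0∣⇒≡0 (≡.subst (_∣ o r * 4) eq (lcm-least {o r} {4} {o r * 4} (m∣m*n 4) (n∣m*n (o r)))))

    -- What kills `word l 2` kills its powers. An exponent divisible by 4 turns `word r 2` into a
    -- power of a, where triviality means divisibility by `o r`.
    lcm-∣ : ∀ {r l} → ⟨ word l 2 ⟩ (word r 2) → lcm (o r) 4 ∣ lcm (o l) 4
    lcm-∣ {r} {l} y∈ = lcm-least {o r} {4} {lcm (o l) 4} (2n∣⇒o∣ {r} {lcm (o l) 4} (word≡ε⇒∣ {lcm (o l) 4 * r} (≡.trans (≡.sym (word-2-^4∣ r {lcm (o l) 4} (n∣lcm[m,n] (o l) 4)))
      (⟨⟩-^≡ε {word l 2} {word r 2} {lcm (o l) 4} y∈ (word-2-^lcm≡ε l))))) (n∣lcm[m,n] (o l) 4)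

  -- If d divides k and L = lcm (o r) 4, then L/d still kills word l 2, where
  -- l ≋ k r + e n; hence d = 1 when lcm (o l) 4 is not smaller than L.
  exponent-coprime : ∀ {k r l} e → ¬ 2 ∣ k → l ≋ k * r + e * n → lcm (o r) 4 ≡ lcm (o l) 4 → gcd k (lcm (o r) 4) ≡ 1
  exponent-coprime {k} {r} {l} e 2∤k l≋ same with gcd[m,n]∣m k (lcm (o r) 4) | gcd[m,n]∣n k (lcm (o r) 4)
  ... | divides k′ k≡ | divides m L≡ = ℕ.≤-antisym d≤1 (ℕ.n≢0⇒n>0 d≢0)
    where
    L d : ℕ
    L = lcm (o r) 4
    d = gcd k L
    d≢0 : d ≢ 0
    d≢0 eq = lcm≢0 r (≡.trans L≡ (≡.trans (cong (m *_) eq) (ℕ.*-zeroʳ m)))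
    m≢0 : NonZero m
    m≢0 = ℕ.≢-nonZero λ { refl → lcm≢0 r L≡ }
    4∣m : 4 ∣ m
    4∣m = 4∣m*d⇒4∣m {m} {d} (λ 2∣d → 2∤k (∣-trans 2∣d (gcd[m,n]∣m k L))) (≡.subst (4 ∣_) L≡ (n∣lcm[m,n] (o r) 4))
    2n∣m[kr+en] : 2 * n ∣ m * (k * r + e * n)
    2n∣m[kr+en] = ≡.subst (2 * n ∣_) (≡.sym m[kr+en]≡) (∣m∣n⇒∣m+n (∣n⇒∣m*n k′ (o∣⇒2n∣ {r} {lcm (o r) 4} (m∣lcm[m,n] (o r) 4)))
      (∣n⇒∣m*n e (*-monoˡ-∣ n (∣-trans {2} {4} {m} (divides 2 refl) 4∣m))))
      where
      lemma : ∀ m k′ d r e n → m * (k′ * d * r + e * n) ≡ k′ * (m * d * r) + e * (m * n)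
      lemma = ℕ-Solver.solve-∀
      m[kr+en]≡ : m * (k * r + e * n) ≡ k′ * (L * r) + e * (m * n)
      m[kr+en]≡ = ≡.trans (cong (λ k → m * (k * r + e * n)) k≡)
        (≡.trans (lemma m k′ d r e n) (cong (λ L → k′ * (L * r) + e * (m * n)) (≡.sym L≡)))
    2n∣ml : 2 * n ∣ m * l
    2n∣ml = m%n≡0⇒n∣m (m * l) (2 * n) (≡.trans (*-mod-cong {m} {m} {l} (2 * n) refl l≋) (n∣m⇒m%n≡0 _ (2 * n) 2n∣m[kr+en]))
    L∣m : L ∣ m
    L∣m = ≡.subst (_∣ m) (≡.sym same) (lcm-least {o l} {4} {m} (2n∣⇒o∣ {l} {m} 2n∣ml) 4∣m)
    d≤1 : d ≤ 1
    d≤1 = ℕ.*-cancelˡ-≤ m {{m≢0}} (≡.subst₂ _≤_ L≡ (≡.sym (ℕ.*-identityʳ m)) (∣⇒≤ {{m≢0}} L∣m))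

  private
    2∤4t+1 : ∀ t → ¬ 2 ∣ 4 * t + 1
    2∤4t+1 t 2∣ = contradiction (∣1⇒≡1 (∣m+n∣m⇒∣n {2} {4 * t} {1} 2∣ (∣m⇒∣m*n t (divides 2 refl)))) λ ()

    2∤4t+3 : ∀ t → ¬ 2 ∣ 4 * t + 3
    2∤4t+3 t 2∣ = contradiction (∣1⇒≡1 (∣m+n∣m⇒∣n {2} {2} {1} (∣m+n∣m⇒∣n {2} {4 * t} {3} 2∣ (∣m⇒∣m*n t (divides 2 refl))) (divides 1 refl))) λ ()

  [a^]⇒equigenerated : ∀ {r x} → [a^ r ] x → ⟨ word r 0 ⟩ x × ⟨ x ⟩ (word r 0)
  [a^]⇒equigenerated {r} (l , refl , x∈ , k , _ , coprime , l≋) with ^-root {o r} {k} coprime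
  ... | j , root = ≡.subst (λ y → ⟨ y ⟩ (a ^ l)) (a^-word r) x∈ , j , ≡.sym (≡.trans (cong (_^ j) x≡)
      (root (word r 0) (≡.trans (word-0-^ r (o r)) (word≡ε {o r * r} (o∣⇒2n∣ {r} {o r} ∣-refl)))))
    where
    x≡ : a ^ l ≡ word r 0 ^ k
    x≡ = ≡.trans (a^-word l) (≡.trans (word-cong 0 l≋) (≡.sym (word-0-^ r k)))

  equigenerated⇒[a^] : ∀ {r x} → ⟨ word r 0 ⟩ x → ⟨ x ⟩ (word r 0) → [a^ r ] x
  equigenerated⇒[a^] {r} x∈ ∈x with equigenerated⇒coprime-power (o r) {{o≢0 r}}
    (≡.trans (word-0-^ r (o r)) (word≡ε {o r * r} (o∣⇒2n∣ {r} {o r} ∣-refl))) x∈ ∈x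
  ... | k , 1≤k , coprime , x≡ = k * r , ≡.trans x≡ (≡.trans (word-0-^ r k) (≡.sym (a^-word (k * r)))) ,
    ≡.subst (λ y → ⟨ y ⟩ _) (≡.sym (a^-word r)) x∈ , k , 1≤k , coprime , refl

  [a^b²]⇒equigenerated : ∀ {r x} → [a^ r b²] x → ⟨ word r 2 ⟩ x × ⟨ x ⟩ (word r 2)
  [a^b²]⇒equigenerated {r} (l , refl , x∈ , same , t , _ , l≋) =
    ≡.subst (λ y → ⟨ y ⟩ (a ^ l ∙ b ^ 2)) (a^∙b^ r 2) x∈ , generates l≋
    where
    power : ∀ k → gcd k (lcm (o r) 4) ≡ 1 → word l 2 ≡ word r 2 ^ k → ⟨ a ^ l ∙ b ^ 2 ⟩ (word r 2)
    power k coprime x≡ with ^-root {lcm (o r) 4} {k} coprime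
    ... | j , root = j , ≡.sym (≡.trans (cong (_^ j) (≡.trans (a^∙b^ l 2) x≡)) (root (word r 2) (word-2-^lcm≡ε r)))
    generates : l ≋ r * (4 * t + 1) ⊎ l ≋ r * (4 * t + 3) + n → ⟨ a ^ l ∙ b ^ 2 ⟩ (word r 2)
    generates (inj₁ l≋) = power (4 * t + 1)
      (exponent-coprime {4 * t + 1} {r} {l} 0 (2∤4t+1 t) (≡.trans l≋ (cong (_% (2 * n)) (lemma r (4 * t + 1) n))) same)
      (≡.trans (word-cong 2 (≡.trans l≋ (cong (_% (2 * n)) (ℕ.*-comm r (4 * t + 1))))) (≡.sym (word-2-^[4t+1] r t)))
      where
      lemma : ∀ r k n → r * k ≡ k * r + 0 * n
      lemma = ℕ-Solver.solve-∀
    generates (inj₂ l≋) = power (4 * t + 3)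
      (exponent-coprime {4 * t + 3} {r} {l} 1 (2∤4t+3 t) (≡.trans l≋ (cong (_% (2 * n)) (lemma r (4 * t + 3) n))) same)
      (≡.trans (word-cong 2 (≡.trans l≋ (cong (λ m → (m + n) % (2 * n)) (ℕ.*-comm r (4 * t + 3))))) (≡.sym (word-2-^[4t+3] r t)))
      where
      lemma : ∀ r k n → r * k + n ≡ k * r + 1 * n
      lemma = ℕ-Solver.solve-∀

  equigenerated⇒[a^b²] : ∀ {r x} → ⟨ word r 2 ⟩ x → ⟨ x ⟩ (word r 2) → [a^ r b²] x
  equigenerated⇒[a^b²] {r} {x} x∈ ∈x with equigenerated⇒coprime-power (4 * n) {{ℕ.m*n≢0 4 n}}
    (AbelianByParity.even-exponent grading (word r 2) (degree-word r 2)) x∈ ∈x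
  ... | k , _ , coprime , x≡ = residue (k % 4) (m%n<n k 4) refl
    where
    -- k / 4 may be 0, but t has to be positive. Adding n to it adds 4n to the exponent of
    -- `word r 2`, which changes nothing.
    t : ℕ
    t = k / 4 + n
    1≤t : 1 ≤ t
    1≤t = ℕ.≤-trans (ℕ.>-nonZero⁻¹ n) (ℕ.m≤n+m n (k / 4))
    2∤k : ¬ 2 ∣ k
    2∤k 2∣k = prime∣gcd⇒≢1 prime[2] 2∣k (∣m⇒∣m*n n (divides 2 refl)) coprime
    k+4n≡ : ∀ s → k % 4 ≡ s → k + 1 * (4 * n) ≡ 4 * t + s
    k+4n≡ s refl = ≡.trans (cong (_+ 1 * (4 * n)) (m≡m%n+[m/n]*n k 4)) (lemma (k % 4) (k / 4) n)
      where
      lemma : ∀ s q n → s + q * 4 + 1 * (4 * n) ≡ 4 * (q + n) + s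
      lemma = ℕ-Solver.solve-∀
    x≡^ : ∀ s → k % 4 ≡ s → x ≡ word r 2 ^ (4 * t + s)
    x≡^ s eq = ≡.trans x≡ (≡.trans (≡.sym (^-periodic {M = 4 * n} (AbelianByParity.even-exponent grading (word r 2) (degree-word r 2)) k 1))
      (cong (word r 2 ^_) (k+4n≡ s eq)))
    member : ∀ l → x ≡ word l 2 → (l ≋ r * (4 * t + 1) ⊎ l ≋ r * (4 * t + 3) + n) → [a^ r b²] x
    member l refl l≋ = l , ≡.sym (a^∙b^ l 2) , ≡.subst (λ y → ⟨ y ⟩ x) (≡.sym (a^∙b^ r 2)) x∈ ,
      ∣-antisym (lcm-∣ {r} {l} ∈x) (lcm-∣ {l} {r} x∈) , t , 1≤t , l≋
    even : ∀ s → k % 4 ≡ s → 2 ∣ s → 2 ∣ k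
    even s refl 2∣s = ≡.subst (2 ∣_) (≡.sym (m≡m%n+[m/n]*n k 4)) (∣m∣n⇒∣m+n 2∣s (∣n⇒∣m*n (k / 4) (divides 2 refl)))
    residue : ∀ s → s < 4 → k % 4 ≡ s → [a^ r b²] x
    residue 0 _ eq = contradiction (even 0 eq (divides 0 refl)) 2∤k
    residue 1 _ eq = member (r * (4 * t + 1)) (≡.trans (x≡^ 1 eq) (≡.trans (word-2-^[4t+1] r t)
      (cong (λ m → word m 2) (ℕ.*-comm (4 * t + 1) r)))) (inj₁ refl)
    residue 2 _ eq = contradiction (even 2 eq (divides 1 refl)) 2∤k
    residue 3 _ eq = member (r * (4 * t + 3) + n) (≡.trans (x≡^ 3 eq) (≡.trans (word-2-^[4t+3] r t)
      (cong (λ m → word (m + n) 2) (ℕ.*-comm (4 * t + 3) r)))) (inj₂ refl)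
    residue (suc (suc (suc (suc s)))) s<4 _ = contradiction s<4 (ℕ.≤⇒≯ (ℕ.m≤m+n 4 s))

-- Normal connection sets in T₈ₙ

2∣⇒parity : ∀ {m} → 2 ∣ m → parity m ≡ 0ℙ
2∣⇒parity (divides q refl) = ≡.trans (ℙ.*-homo-* q 2) (ℙ.*-zeroʳ (parity q))

parity⇒2∣ : ∀ m → parity m ≡ 0ℙ → 2 ∣ m
parity⇒2∣ zero          _  = 2 ∣0
parity⇒2∣ (suc (suc m)) eq = ∣m∣n⇒∣m+n ∣-refl (parity⇒2∣ m eq)

2∤⇒parity : ∀ {m} → 2 ∤ m → parity m ≡ 1ℙ
2∤⇒parity {m} 2∤m with parity m in eq
... | 0ℙ = contradiction (parity⇒2∣ m eq) 2∤m
... | 1ℙ = refl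

conj-closed : ∀ G {S} → IsNormalCayley G S → ∀ x h → S x → S (FiniteGroup._∙_ G (FiniteGroup._∙_ G (FiniteGroup._⁻¹ G h) x) h)
conj-closed G {S} (R , S⊆⋃ , ⋃⊆S) x h x∈S with S⊆⋃ x∈S
... | g , k , refl = ⋃⊆S (g , k ∙ h , (begin
  h ⁻¹ ∙ (k ⁻¹ ∙ proj₁ g ∙ k) ∙ h     ≡⟨ assoc _ _ _ ⟩
  h ⁻¹ ∙ (k ⁻¹ ∙ proj₁ g ∙ k ∙ h)     ≡⟨ cong (h ⁻¹ ∙_) (assoc _ _ _) ⟩
  h ⁻¹ ∙ (k ⁻¹ ∙ proj₁ g ∙ (k ∙ h))   ≡⟨ cong (h ⁻¹ ∙_) (assoc _ _ _) ⟩
  h ⁻¹ ∙ (k ⁻¹ ∙ (proj₁ g ∙ (k ∙ h))) ≡⟨ assoc _ _ _ ⟨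
  h ⁻¹ ∙ k ⁻¹ ∙ (proj₁ g ∙ (k ∙ h))   ≡⟨ cong (_∙ (proj₁ g ∙ (k ∙ h))) (⁻¹-anti-homo-∙ k h) ⟨
  (k ∙ h) ⁻¹ ∙ (proj₁ g ∙ (k ∙ h))    ≡⟨ assoc _ _ _ ⟨
  (k ∙ h) ⁻¹ ∙ proj₁ g ∙ (k ∙ h)      ∎))
  where
  open FiniteGroup G
  open FiniteGroupProperties G
  open ≡.≡-Reasoning

module ConnectionSets (n : ℕ) .{{_ : NonZero n}}
  (S₁ S₂ : Pred (T₈.T n) 0ℓ) (S₁? : Decidable S₁) (S₂? : Decidable S₂)
  (S₁⊆ : S₁ ⊆ T₈.⟨a⟩∪⟨a⟩b² n) (S₂⊆ : S₂ ⊆ T₈.⟨a⟩b∪⟨a⟩b³ n) where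
  open T₈ n
  open import Data.Nat.Base using (_+_; _*_; _%_)
  open T₈Words n
  open GeneratorClasses n
  open Powers T₈ₙ
  open FiniteGroupProperties T₈ₙ using (x⁻¹∙[x∙y]≡y; x∙[x⁻¹∙y]≡y)
  open AbelianByParity grading using (degree-∙; degree-⁻¹; even-exponent; exponent)
  open CyclicSubgroups T₈ₙ grading
  open SubgroupCombinations T₈ₙ grading

  S₁-even : ∀ x → S₁ x → degree x ≡ 0ℙ
  S₁-even x x∈ with S₁⊆ x∈
  ... | inj₁ (k , refl)               = ≡.trans (cong degree (a^-word k)) (degree-word k 0)
  ... | inj₂ (_ , (k , refl) , refl)  = ≡.trans (cong degree (a^∙b^ k 2)) (degree-word k 2)

  S₂-odd : ∀ x → S₂ x → degree x ≡ 1ℙ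
  S₂-odd x x∈ with S₂⊆ x∈
  ... | inj₁ (_ , (k , refl) , refl) = ≡.trans (cong degree (a^∙b k)) (degree-word k 1)
  ... | inj₂ (_ , (k , refl) , refl) = ≡.trans (cong degree (a^∙b^ k 3)) (degree-word k 3)

  even⇒S₁ : ∀ {x} → degree x ≡ 0ℙ → (S₁ ∪ S₂) x → S₁ x
  even⇒S₁ _ (inj₁ x∈)      = x∈
  even⇒S₁ x-even (inj₂ x∈) = contradiction (≡.trans (≡.sym x-even) (S₂-odd _ x∈)) λ ()

  odd⇒S₂ : ∀ {x} → degree x ≡ 1ℙ → (S₁ ∪ S₂) x → S₂ x
  odd⇒S₂ _ (inj₂ x∈)     = x∈
  odd⇒S₂ x-odd (inj₁ x∈) = contradiction (≡.trans (≡.sym (S₁-even _ x∈)) x-odd) λ ()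

  Condition₁⇒closed : Condition₁ S₁ → EquigeneratedClosed S₁
  Condition₁⇒closed (rs , rs′ , S₁⊆∪ , ∪⊆S₁) {x} {y} x∈⟨y⟩ y∈⟨x⟩ x∈ = ∪⊆S₁ (move (S₁⊆∪ x∈))
    where
    move : Any (λ r → [a^ r ] x) rs ⊎ Any (λ r → [a^ r b²] x) rs′ → Any (λ r → [a^ r ] y) rs ⊎ Any (λ r → [a^ r b²] y) rs′
    move (inj₁ any) = inj₁ (Any.map (λ {r} x∈[] → let u , v = [a^]⇒equigenerated {r} x∈[] in
      equigenerated⇒[a^] {r} (⟨⟩-trans u y∈⟨x⟩) (⟨⟩-trans x∈⟨y⟩ v)) any)
    move (inj₂ any) = inj₂ (Any.map (λ {r} x∈[] → let u , v = [a^b²]⇒equigenerated {r} x∈[] in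
      equigenerated⇒[a^b²] {r} (⟨⟩-trans u y∈⟨x⟩) (⟨⟩-trans x∈⟨y⟩ v)) any)

  closed⇒Condition₁ : EquigeneratedClosed S₁ → Condition₁ S₁
  closed⇒Condition₁ closed = rs 0 , rs 2 , to , from
    where
    P? : ∀ s → Decidable (λ r → S₁ (word r s))
    P? s r = S₁? (word r s)
    rs : ℕ → List ℕ
    rs s = filter (P? s) (upTo (2 * n))
    to : ∀ {x} → S₁ x → Any (λ r → [a^ r ] x) (rs 0) ⊎ Any (λ r → [a^ r b²] x) (rs 2)
    to {x} x∈ with even-shape x (S₁-even x x∈)
    ... | inj₁ (r , r<2n , refl) = inj₁ (lose (∈-filter⁺ (P? 0) (∈-upTo⁺ r<2n) x∈) (equigenerated⇒[a^] {r} (⟨⟩-refl x) (⟨⟩-refl x)))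
    ... | inj₂ (r , r<2n , refl) = inj₂ (lose (∈-filter⁺ (P? 2) (∈-upTo⁺ r<2n) x∈) (equigenerated⇒[a^b²] {r} (⟨⟩-refl x) (⟨⟩-refl x)))
    from : ∀ {x} → Any (λ r → [a^ r ] x) (rs 0) ⊎ Any (λ r → [a^ r b²] x) (rs 2) → S₁ x
    from (inj₁ any) with find any
    ... | r , r∈ , x∈[] with [a^]⇒equigenerated {r} x∈[]
    ...   | u , v = closed v u (proj₂ (∈-filter⁻ (P? 0) {xs = upTo (2 * n)} r∈))
    from (inj₂ any) with find any
    ... | r , r∈ , x∈[] with [a^b²]⇒equigenerated {r} x∈[]
    ...   | u , v = closed v u (proj₂ (∈-filter⁻ (P? 2) {xs = upTo (2 * n)} r∈))

  module _ (isConn : FiniteGroup.IsConnectionSet T₈ₙ (S₁ ∪ S₂)) (normal : IsNormalCayley T₈ₙ (S₁ ∪ S₂)) where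
    open FiniteGroup.IsConnectionSet isConn
    open GroupProperties (FiniteGroup.group T₈ₙ) using (inverseʳ-unique)
    open FiniteGroup T₈ₙ using (assoc; identityʳ; inverseˡ)

    S₁-conj : ∀ x h → S₁ x → S₁ (h ⁻¹ ∙ x ∙ h)
    S₁-conj x h x∈ = even⇒S₁ (begin
      degree (h ⁻¹ ∙ x ∙ h)                     ≡⟨ degree-∙ (h ⁻¹ ∙ x) h ⟩
      degree (h ⁻¹ ∙ x) ℙ.+ degree h            ≡⟨ cong (ℙ._+ degree h) (degree-∙ (h ⁻¹) x) ⟩
      degree (h ⁻¹) ℙ.+ degree x ℙ.+ degree h   ≡⟨ cong₂ (λ p q → p ℙ.+ q ℙ.+ degree h) (degree-⁻¹ h) (S₁-even x x∈) ⟩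
      degree h ℙ.+ 0ℙ ℙ.+ degree h              ≡⟨ p+0+p≡0 (degree h) ⟩
      0ℙ                                        ∎) (conj-closed T₈ₙ normal x h (inj₁ x∈))
      where
      open ≡.≡-Reasoning
      p+0+p≡0 : ∀ p → p ℙ.+ 0ℙ ℙ.+ p ≡ 0ℙ
      p+0+p≡0 0ℙ = refl
      p+0+p≡0 1ℙ = refl

    private
      σ+2≋ : ∀ r → r + σ * σ ≋ σ + (r + 2)
      σ+2≋ r = ≡.trans (+-mod-cong {r} {r} {σ * σ} {1} (2 * n) refl (≡.trans (cong (λ s → (σ * s) % (2 * n)) (≡.sym (ℕ.*-identityʳ σ))) (σσ≋ 1)))
        (≡.trans (≡.sym (≋-multiple (r + 1) 1)) (cong (_% (2 * n)) (≡.trans (cong (λ m → r + 1 + 1 * m) (≡.sym (ℕ.suc-pred (2 * n)))) (lemma r σ))))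
        where
        lemma : ∀ r s → r + 1 + 1 * suc s ≡ s + (r + 2)
        lemma = ℕ-Solver.solve-∀

    -- The coset ⟨a⟩b determines S₂, since inversion carries it to ⟨a⟩b³. Conjugation by powers of a
    -- shifts r by even numbers, so only Q 0 and Q 1 remain free.
    Q : ℕ → Set
    Q r = S₂ (word r 1)

    Q-cong : ∀ {r r′} → r ≋ r′ → Q r → Q r′
    Q-cong r≋r′ = ≡.subst S₂ (word-cong 1 r≋r′)

    -- Conjugate by a^σ = a⁻¹.
    Q-+2 : ∀ {r} → Q r → Q (r + 2)
    Q-+2 {r} q = odd⇒S₂ (degree-word (r + 2) 1) (≡.subst (S₁ ∪ S₂) (begin
      h ⁻¹ ∙ word r 1 ∙ h         ≡⟨ assoc (h ⁻¹) (word r 1) h ⟩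
      h ⁻¹ ∙ (word r 1 ∙ h)       ≡⟨ cong (h ⁻¹ ∙_) xh≡hy ⟩
      h ⁻¹ ∙ (h ∙ word (r + 2) 1) ≡⟨ x⁻¹∙[x∙y]≡y h (word (r + 2) 1) ⟩
      word (r + 2) 1              ∎) (conj-closed T₈ₙ normal (word r 1) h (inj₂ q)))
      where
      open ≡.≡-Reasoning
      h = word σ 0
      xh≡hy : word r 1 ∙ h ≡ h ∙ word (r + 2) 1
      xh≡hy = ≡.trans (word-∙ r 1 σ 0) (≡.trans (word-cong 1 (≡.trans (cong (λ s → (r + s * σ) % (2 * n)) (ℕ.*-identityʳ σ)) (σ+2≋ r)))
        (≡.sym (word-even-∙ 0 σ (r + 2) 1)))

    Q-+even : ∀ k {r} → Q r → Q (r + k * 2)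
    Q-+even zero    {r} q = ≡.subst Q (≡.sym (ℕ.+-identityʳ r)) q
    Q-+even (suc k) {r} q = ≡.subst Q (ℕ.+-assoc r 2 (k * 2)) (Q-+even k (Q-+2 q))

    -- Going on around the cycle replaces going back: k and k(n - 1) steps of 2 add up to a multiple
    -- of 2n.
    Q-−even : ∀ k {r} → Q (r + k * 2) → Q r
    Q-−even k {r} q = Q-cong (≡.trans (cong (_% (2 * n)) (≡.trans (lemma r k (pred n)) (cong (λ m → r + k * (2 * m)) n≡))) (≋-multiple r k))
      (Q-+even (k * pred n) q)
      where
      lemma : ∀ r k m → r + k * 2 + k * m * 2 ≡ r + k * (2 * suc m)
      lemma = ℕ-Solver.solve-∀

    word-⁻¹ : ∀ r → word r 1 ⁻¹ ≡ word (r + n) 3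
    word-⁻¹ r = ≡.sym (inverseʳ-unique (word r 1) (word (r + n) 3) (begin
      word r 1 ∙ word (r + n) 3               ≡⟨ word-∙ r 1 (r + n) 3 ⟩
      word (r + σ ℕ.^ 1 * (r + n)) 4          ≡⟨ word-+4 (r + σ ℕ.^ 1 * (r + n)) 0 ⟩
      word (r + σ ℕ.^ 1 * (r + n) + n) 0      ≡⟨ word-cong 0 (≡.trans (cong (_% (2 * n)) (≡.trans (lemma r σ n) (cong (λ m → 0 + (r + n) * m) (ℕ.suc-pred (2 * n))))) (≋-multiple 0 (r + n))) ⟩
      ε                                       ∎))
      where
      open ≡.≡-Reasoning
      lemma : ∀ r s n → r + s * 1 * (r + n) + n ≡ 0 + (r + n) * suc s
      lemma = ℕ-Solver.solve-∀

    Q⇒b³ : ∀ {r} → Q r → S₂ (word (r + n) 3)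
    Q⇒b³ {r} q = odd⇒S₂ (degree-word (r + n) 3) (≡.subst (S₁ ∪ S₂) (word-⁻¹ r) (proj₁ inverseClosed (inj₂ q)))

    b³⇒Q : ∀ {r} → S₂ (word (r + n) 3) → Q r
    b³⇒Q {r} s = odd⇒S₂ (degree-word r 1) (proj₂ inverseClosed (≡.subst (S₁ ∪ S₂) (≡.sym (word-⁻¹ r)) (inj₂ s)))

    Q? : Decidable Q
    Q? r = S₂? (word r 1)

    private
      even-or-odd : ∀ r → (∃ λ k → r ≡ 0 + k * 2 × 2 ∣ r) ⊎ (∃ λ k → r ≡ 1 + k * 2 × 2 ∤ r)
      even-or-odd zero = inj₁ (0 , refl , 2 ∣0)
      even-or-odd (suc r) with even-or-odd r
      ... | inj₁ (k , refl , _) = inj₂ (k , refl , λ 2∣ → contradiction (∣1⇒≡1 (∣m+n∣m⇒∣n {2} {k * 2} {1} (≡.subst (2 ∣_) (ℕ.+-comm 1 (k * 2)) 2∣) (n∣m*n k))) λ ())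
      ... | inj₂ (k , refl , _) = inj₁ (suc k , refl , n∣m*n (suc k))

    Q-parity : ∀ r → (2 ∣ r × Q r ⇔ Q 0) ⊎ (2 ∤ r × Q r ⇔ Q 1)
    Q-parity r with even-or-odd r
    ... | inj₁ (k , refl , 2∣r) = inj₁ (2∣r , mk⇔ (Q-−even k) (Q-+even k))
    ... | inj₂ (k , refl , 2∤r) = inj₂ (2∤r , mk⇔ (Q-−even k) (Q-+even k))

    Q⇔ : ∀ {P : Pred ℕ 0ℓ} → (∀ {r} → 2 ∣ r → P r ⇔ Q 0) → (∀ {r} → 2 ∤ r → P r ⇔ Q 1) → ∀ r → P r ⇔ Q r
    Q⇔ even odd r with Q-parity r
    ... | inj₁ (2∣r , q⇔) = mk⇔ (Equivalence.from q⇔ ∘ Equivalence.to (even 2∣r)) (Equivalence.from (even 2∣r) ∘ Equivalence.to q⇔)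
    ... | inj₂ (2∤r , q⇔) = mk⇔ (Equivalence.from q⇔ ∘ Equivalence.to (odd 2∤r)) (Equivalence.from (odd 2∤r) ∘ Equivalence.to q⇔)

    S₂≐ : ∀ {P : Pred ℕ 0ℓ} → (∀ r → P r ⇔ Q r) → (∀ r → S₂ (word r 3) ⇔ Q r) → S₂ ≐ a^rb,a^rb³ P
    S₂≐ P⇔Q b³⇔Q = to , from
      where
      to : ∀ {x} → S₂ x → a^rb,a^rb³ _ x
      to {x} x∈ with odd-shape x (S₂-odd x x∈)
      ... | inj₁ (r , r<2n , refl) = r , r<2n , Equivalence.from (P⇔Q r) x∈ , inj₁ (≡.sym (a^∙b r))
      ... | inj₂ (r , r<2n , refl) = r , r<2n , Equivalence.from (P⇔Q r) (Equivalence.to (b³⇔Q r) x∈) , inj₂ (≡.sym (a^∙b^ r 3))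
      from : ∀ {x} → a^rb,a^rb³ _ x → S₂ x
      from (r , _ , p , inj₁ refl) = ≡.subst S₂ (≡.sym (a^∙b r)) (Equivalence.to (P⇔Q r) p)
      from (r , _ , p , inj₂ refl) = ≡.subst S₂ (≡.sym (a^∙b^ r 3)) (Equivalence.from (b³⇔Q r) (Equivalence.to (P⇔Q r) p))

    -- The shift by n separates the two halves of condition (2). For even n it respects the parity
    -- of r. For odd n it reverses it, so a set with exactly one of Q 0 and Q 1 is normal and closed
    -- under inverses, yet not among those listed.
    b³⇔Q+n : ∀ r → S₂ (word r 3) ⇔ Q (r + n)
    b³⇔Q+n r = mk⇔ (λ s → b³⇒Q (≡.subst S₂ (≡.sym r+n+n) s)) (λ q → ≡.subst S₂ r+n+n (Q⇒b³ q))
      where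
      lemma : ∀ r n → r + n + n ≡ r + 1 * (2 * n)
      lemma = ℕ-Solver.solve-∀
      r+n+n : word (r + n + n) 3 ≡ word r 3
      r+n+n = word-cong 3 (≡.trans (cong (_% (2 * n)) (lemma r n)) (≋-multiple r 1))

    private
      Q⇔U : Q 0 → Q 1 → ∀ r → U r ⇔ Q r
      Q⇔U q₀ q₁ = Q⇔ (λ _ → mk⇔ (λ _ → q₀) _) (λ _ → mk⇔ (λ _ → q₁) _)

      Q⇔∅ : ¬ Q 0 → ¬ Q 1 → ∀ r → ∅ r ⇔ Q r
      Q⇔∅ ¬q₀ ¬q₁ = Q⇔ (λ _ → mk⇔ (λ ()) ¬q₀) (λ _ → mk⇔ (λ ()) ¬q₁)

      S₂≐∅ : S₂ ≐ a^rb,a^rb³ ∅ → S₂ ≐ ∅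
      S₂≐∅ (f , _) = (λ x∈ → proj₁ (proj₂ (proj₂ (f x∈)))) , λ ()

    condition₂-even : 2 ∣ n → S₂ ≐ ∅ ⊎ S₂ ≐ EvenCase ⊎ S₂ ≐ OddCase ⊎ S₂ ≐ AllCase
    condition₂-even (divides k n≡k*2) = cases (Q? 0) (Q? 1)
      where
      b³⇔Q : ∀ r → S₂ (word r 3) ⇔ Q r
      b³⇔Q r = mk⇔ (λ s → Q-−even k (≡.subst (λ m → Q (r + m)) n≡k*2 (Equivalence.to (b³⇔Q+n r) s)))
        (λ q → Equivalence.from (b³⇔Q+n r) (≡.subst (λ m → Q (r + m)) (≡.sym n≡k*2) (Q-+even k q)))
      cases : Dec (Q 0) → Dec (Q 1) → S₂ ≐ ∅ ⊎ S₂ ≐ EvenCase ⊎ S₂ ≐ OddCase ⊎ S₂ ≐ AllCase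
      cases (yes q₀) (yes q₁) = inj₂ (inj₂ (inj₂ (S₂≐ (Q⇔U q₀ q₁) b³⇔Q)))
      cases (yes q₀) (no ¬q₁) = inj₂ (inj₁ (S₂≐ (Q⇔ (λ 2∣r → mk⇔ (λ _ → q₀) (λ _ → 2∣r))
        (λ 2∤r → mk⇔ (λ 2∣r → contradiction 2∣r 2∤r) (λ q₁ → contradiction q₁ ¬q₁))) b³⇔Q))
      cases (no ¬q₀) (yes q₁) = inj₂ (inj₂ (inj₁ (S₂≐ (Q⇔ (λ 2∣r → mk⇔ (λ 2∤r → contradiction 2∣r 2∤r) (λ q₀ → contradiction q₀ ¬q₀))
        (λ 2∤r → mk⇔ (λ _ → q₁) (λ _ → 2∤r))) b³⇔Q)))
      cases (no ¬q₀) (no ¬q₁) = inj₁ (S₂≐∅ (S₂≐ (Q⇔∅ ¬q₀ ¬q₁) b³⇔Q))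

    condition₂-odd : (Q 0 ⇔ Q 1) → S₂ ≐ ∅ ⊎ S₂ ≐ AllCase
    condition₂-odd q₀⇔q₁ with Q? 0
    ... | yes q₀ = inj₂ (S₂≐ all (λ r → mk⇔ (λ _ → Equivalence.to (all r) _) (λ _ → Equivalence.from (b³⇔Q+n r) (Equivalence.to (all (r + n)) _))))
      where
      all : ∀ r → U r ⇔ Q r
      all = Q⇔U q₀ (Equivalence.to q₀⇔q₁ q₀)
    ... | no ¬q₀ = inj₁ (S₂≐∅ (S₂≐ none (λ r → mk⇔ (λ s → contradiction (Equivalence.to (b³⇔Q+n r) s) (none′ (r + n))) (λ q → contradiction q (none′ r)))))
      where
      none : ∀ r → ∅ r ⇔ Q r
      none = Q⇔∅ ¬q₀ (¬q₀ ∘ Equivalence.from q₀⇔q₁)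
      none′ : ∀ r → ¬ Q r
      none′ r q = Equivalence.from (none r) q

-- From prime powers to all coprime powers of S₁

module Necessity {c ℓ₁ ℓ₂} (𝕂 : AlgebraicallyClosedField₀ c ℓ₁ ℓ₂) (n : ℕ) .{{_ : NonZero n}}
  (S₁ S₂ : Pred (T₈.T n) 0ℓ) (S₁? : Decidable S₁) (S₂? : Decidable S₂)
  (isConn : FiniteGroup.IsConnectionSet (T₈.T₈ₙ n) (S₁ ∪ S₂))
  (S₁⊆ : S₁ ⊆ T₈.⟨a⟩∪⟨a⟩b² n) (S₂⊆ : S₂ ⊆ T₈.⟨a⟩b∪⟨a⟩b³ n)
  (normal : IsNormalCayley (T₈.T₈ₙ n) (S₁ ∪ S₂))
  (integral : Integral 𝕂 (Cay (T₈.T₈ₙ n) (S₁ ∪ S₂) (S₁? ∪? S₂?) isConn)) where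
  open T₈ n
  open import Data.Nat.Base using (_*_; _≤_)
  open T₈Words n
  open Powers T₈ₙ
  open EquigeneratedPowers T₈ₙ
  open AbelianByParity grading using (even-exponent)
  open ConnectionSets n S₁ S₂ S₁? S₂? S₁⊆ S₂⊆
  open CyclicSubgroups T₈ₙ grading using (EquigeneratedClosed)

  private
    instance
      4n≢0 : NonZero (4 * n)
      4n≢0 = ℕ.m*n≢0 4 n

  S₁-prime-power : ∀ {p} → Prime p → p ∤ 4 * n → ∀ {x} → S₁ x → S₁ (x ^ p)
  S₁-prime-power {p} p-prime p∤4n {x} = PrimePowerClosure.prime-power-closed 𝕂 T₈ₙ grading S₁ S₂ S₁? S₂? isConn integral
    S₁-even S₂-odd (S₁-conj isConn normal) p-prime (gcd[p^i,m]≡1 p-prime p∤4n) (2∤⇒parity 2∤p) x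
    where
    2∤p : 2 ∤ p
    2∤p 2∣p = prime∣gcd⇒≢1 {2} {p ℕ.^ 1} {4 * n} prime[2] (∣-trans 2∣p (m∣m*n 1)) (∣m⇒∣m*n n (divides 2 refl)) (gcd[p^i,m]≡1 p-prime p∤4n 1)

  S₁-coprime-power : ∀ k → 1 ≤ k → gcd k (4 * n) ≡ 1 → ∀ {x} → S₁ x → S₁ (x ^ k)
  S₁-coprime-power k 1≤k coprime {x} x∈ with factorise k {{ℕ.>-nonZero 1≤k}}
  ... | record { factors = ps ; isFactorisation = refl ; factorsPrime = primes } = go ps primes
    (λ q q-prime q∣ q∣4n → prime∣gcd⇒≢1 {q} {product ps} {4 * n} q-prime q∣ q∣4n coprime)
    where
    go : ∀ qs → All Prime qs → (∀ q → Prime q → q ∣ product qs → q ∤ 4 * n) → S₁ (x ^ product qs)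
    go []       []               _ = ≡.subst S₁ (≡.sym (x^1≡x x)) x∈
    go (q ∷ qs) (q-prime ∷ rest) f = ≡.subst S₁ (^-^ x (product qs) q)
      (S₁-prime-power q-prime (f q q-prime (m∣m*n (product qs))) (go qs rest (λ q′ pr d → f q′ pr (∣n⇒∣m*n q d))))

  S₁-closed : EquigeneratedClosed S₁
  S₁-closed {x} {y} x∈⟨y⟩ y∈⟨x⟩ x∈ with equigenerated⇒coprime-power {y} {x} (4 * n) (even-exponent x (S₁-even x x∈)) y∈⟨x⟩ x∈⟨y⟩
  ... | k , 1≤k , coprime , refl = S₁-coprime-power k 1≤k coprime x∈

-- The sets of condition (2) as combinations of subgroups

module Sufficiency {c ℓ₁ ℓ₂} (𝕂 : AlgebraicallyClosedField₀ c ℓ₁ ℓ₂) (n : ℕ) .{{_ : NonZero n}}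
  (S₁ S₂ : Pred (T₈.T n) 0ℓ) (S₁? : Decidable S₁) (S₂? : Decidable S₂)
  (isConn : FiniteGroup.IsConnectionSet (T₈.T₈ₙ n) (S₁ ∪ S₂))
  (S₁⊆ : S₁ ⊆ T₈.⟨a⟩∪⟨a⟩b² n) (S₂⊆ : S₂ ⊆ T₈.⟨a⟩b∪⟨a⟩b³ n) where
  open T₈ n
  open import Data.Nat.Base using (_+_; _*_; _%_; _/_)
  open T₈Words n
  open AbelianByParity grading using (degree-∙)
  open FiniteGroup T₈ₙ using (identityˡ; inverseˡ)
  open ConnectionSets n S₁ S₂ S₁? S₂? S₁⊆ S₂⊆
  open CyclicSubgroups T₈ₙ grading
  open SubgroupCombinations T₈ₙ grading

  module _ (χ : T → Parity) (χ-∙ : ∀ x y → χ (x ∙ y) ≡ χ x ℙ.+ χ y) where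
    private
      p+p≡0 : ∀ p → p ℙ.+ p ≡ 0ℙ
      p+p≡0 0ℙ = refl
      p+p≡0 1ℙ = refl

      χ-ε : χ ε ≡ 0ℙ
      χ-ε = ≡.trans (cong χ (≡.sym (identityˡ ε))) (≡.trans (χ-∙ ε ε) (p+p≡0 (χ ε)))

      χ-⁻¹ : ∀ x → χ (x ⁻¹) ≡ χ x
      χ-⁻¹ x = ℙ.+-cancelʳ-≡ (χ x) (χ (x ⁻¹)) (χ x)
        (≡.trans (≡.sym (χ-∙ (x ⁻¹) x)) (≡.trans (cong χ (inverseˡ x)) (≡.trans χ-ε (≡.sym (p+p≡0 (χ x))))))

    kernel : NiceSubgroup
    kernel = record
      { mem    = λ x → χ x ≡ 0ℙ
      ; mem?   = λ x → χ x ℙ.≟ 0ℙ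
      ; ε∈     = χ-ε
      ; ∙-mem  = λ {x} {y} p q → ≡.trans (χ-∙ x y) (cong₂ ℙ._+_ p q)
      ; ⁻¹-mem = λ {x} p → ≡.trans (χ-⁻¹ x) p
      ; nice   = inj₂ λ x h p → ≡.trans (χ-∙ (h ⁻¹ ∙ x) h) (≡.trans (cong (ℙ._+ χ h) (χ-∙ (h ⁻¹) x))
          (≡.trans (cong₂ (λ u v → u ℙ.+ v ℙ.+ χ h) (χ-⁻¹ h) p) (≡.trans (cong (ℙ._+ χ h) (ℙ.+-identityʳ (χ h))) (p+p≡0 (χ h)))))
      }

    even-kernel : NiceSubgroup
    even-kernel = record
      { mem    = λ x → degree x ≡ 0ℙ × χ x ≡ 0ℙ
      ; mem?   = λ x → degree x ℙ.≟ 0ℙ ×-dec χ x ℙ.≟ 0ℙ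
      ; ε∈     = degree-word 0 0 , χ-ε
      ; ∙-mem  = λ {x} {y} (p , p′) (q , q′) → ≡.trans (degree-∙ x y) (cong₂ ℙ._+_ p q) , NiceSubgroup.∙-mem kernel {x} {y} p′ q′
      ; ⁻¹-mem = λ {x} (p , p′) → ≡.trans (AbelianByParity.degree-⁻¹ grading x) p , NiceSubgroup.⁻¹-mem kernel {x} p′
      ; nice   = inj₁ λ x → proj₁
      }

    -- Each nonempty case of condition (2) is the odd part of the kernel of a character of order at
    -- most 2: the trivial one, `ρ`, or `degree` + `ρ`.
    kernel-combination : ∀ {P : Pred T 0ℓ} (P? : Decidable P) → (∀ {x} → P x → degree x ≡ 1ℙ × χ x ≡ 0ℙ) →
      (∀ {x} → degree x ≡ 1ℙ → χ x ≡ 0ℙ → P x) → IsCombination 𝕂 P?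
    kernel-combination {P} P? f g = combination-difference 𝕂 P? (NiceSubgroup.mem? kernel) (NiceSubgroup.mem? even-kernel)
      (λ p → proj₂ (f p)) rest proj₂ (λ (d , _) p → contradiction (≡.trans (≡.sym d) (proj₁ (f p))) λ ())
      (subgroup-combination 𝕂 kernel) (subgroup-combination 𝕂 even-kernel)
      where
      rest : ∀ {x} → χ x ≡ 0ℙ → ¬ P x → degree x ≡ 0ℙ × χ x ≡ 0ℙ
      rest {x} p ¬p with degree x in eq
      ... | 0ℙ = refl , p
      ... | 1ℙ = contradiction (g eq p) ¬p

  private
    coset-degree : ∀ {P x} → a^rb,a^rb³ P x → degree x ≡ 1ℙ
    coset-degree (r , _ , _ , inj₁ refl) = ≡.trans (cong degree (a^∙b r)) (degree-word r 1)
    coset-degree (r , _ , _ , inj₂ refl) = ≡.trans (cong degree (a^∙b^ r 3)) (degree-word r 3)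

    coset-intro : ∀ {P : Pred ℕ 0ℓ} x → degree x ≡ 1ℙ → (∀ r s → x ≡ word r s → P r) → a^rb,a^rb³ P x
    coset-intro x x-odd p with odd-shape x x-odd
    ... | inj₁ (r , r<2n , refl) = r , r<2n , p r 1 refl , inj₁ (≡.sym (a^∙b r))
    ... | inj₂ (r , r<2n , refl) = r , r<2n , p r 3 refl , inj₂ (≡.sym (a^∙b^ r 3))

  all-combination : S₂ ≐ AllCase → IsCombination 𝕂 S₂?
  all-combination (f , g) = kernel-combination (λ _ → 0ℙ) (λ _ _ → refl) S₂?
    (λ {x} x∈ → coset-degree {x = x} (f x∈) , refl) (λ {x} x-odd _ → g (coset-intro x x-odd (λ _ _ _ → _)))

  -- For even n the exponent of a is well defined modulo 2.
  module _ (2∣n : 2 ∣ n) where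
    ρ : T → Parity
    ρ (r , s) = parity (toℕ r)

    ρ-word : ∀ p q → ρ (word p q) ≡ parity p
    ρ-word p q = begin
      parity (toℕ ((p + n * (q / 4)) mod (2 * n))) ≡⟨ cong parity (toℕ-mod m (2 * n)) ⟩
      parity (m % (2 * n))                         ≡⟨ ℙ.+-identityʳ (parity (m % (2 * n))) ⟨
      parity (m % (2 * n)) ℙ.+ 0ℙ                  ≡⟨ cong (parity (m % (2 * n)) ℙ.+_) (2∣⇒parity {m / (2 * n) * (2 * n)} (∣n⇒∣m*n (m / (2 * n)) (m∣m*n n))) ⟨
      parity (m % (2 * n)) ℙ.+ parity (m / (2 * n) * (2 * n)) ≡⟨ ℙ.+-homo-+ (m % (2 * n)) (m / (2 * n) * (2 * n)) ⟨
      parity (m % (2 * n) + m / (2 * n) * (2 * n)) ≡⟨ cong parity (m≡m%n+[m/n]*n m (2 * n)) ⟨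
      parity (p + n * (q / 4))                     ≡⟨ ℙ.+-homo-+ p (n * (q / 4)) ⟩
      parity p ℙ.+ parity (n * (q / 4))            ≡⟨ cong (parity p ℙ.+_) (2∣⇒parity {n * (q / 4)} (∣m⇒∣m*n (q / 4) 2∣n)) ⟩
      parity p ℙ.+ 0ℙ                              ≡⟨ ℙ.+-identityʳ (parity p) ⟩
      parity p                                     ∎
      where
      open ≡.≡-Reasoning
      m = p + n * (q / 4)

    parity-σ^ : ∀ s → parity (σ ℕ.^ s) ≡ 1ℙ
    parity-σ^ zero    = refl
    parity-σ^ (suc s) = ≡.trans (ℙ.*-homo-* σ (σ ℕ.^ s)) (cong₂ ℙ._*_ (≡.trans (cong parity σ≡) (≡.trans (ℙ.+-homo-+ 1 (2 * pred n)) (cong (1ℙ ℙ.+_) (2∣⇒parity (m∣m*n (pred n)))))) (parity-σ^ s))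

    ρ-∙ : ∀ x y → ρ (x ∙ y) ≡ ρ x ℙ.+ ρ y
    ρ-∙ (r , s) (r′ , s′) = ≡.trans (ρ-word (toℕ r + σ ℕ.^ toℕ s * toℕ r′) (toℕ s + toℕ s′)) (≡.trans (ℙ.+-homo-+ (toℕ r) (σ ℕ.^ toℕ s * toℕ r′))
      (cong (parity (toℕ r) ℙ.+_) (≡.trans (ℙ.*-homo-* (σ ℕ.^ toℕ s) (toℕ r′)) (cong (ℙ._* parity (toℕ r′)) (parity-σ^ (toℕ s))))))

    private
      coset-ρ : ∀ {P x} → a^rb,a^rb³ P x → ∃ λ r → P r × ρ x ≡ parity r
      coset-ρ (r , _ , p , inj₁ refl) = r , p , ≡.trans (cong ρ (a^∙b r)) (ρ-word r 1)
      coset-ρ (r , _ , p , inj₂ refl) = r , p , ≡.trans (cong ρ (a^∙b^ r 3)) (ρ-word r 3)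

    even-combination : S₂ ≐ EvenCase → IsCombination 𝕂 S₂?
    even-combination (f , g) = kernel-combination ρ ρ-∙ S₂?
      (λ {x} x∈ → coset-degree {x = x} (f x∈) , ρ≡0 {x} (coset-ρ {2 ∣_} {x} (f x∈)))
      (λ {x} x-odd x-ρ → g (coset-intro x x-odd λ r s eq → parity⇒2∣ r (≡.trans (≡.sym (ρ-word r s)) (≡.trans (cong ρ (≡.sym eq)) x-ρ))))
      where
      ρ≡0 : ∀ {x} → (∃ λ r → 2 ∣ r × ρ x ≡ parity r) → ρ x ≡ 0ℙ
      ρ≡0 (r , 2∣r , eq) = ≡.trans eq (2∣⇒parity 2∣r)

    -- The elements with `ρ` = 1 form no subgroup, but among odd elements they are those where
    -- `degree` + `ρ` vanishes.
    odd-combination : S₂ ≐ OddCase → IsCombination 𝕂 S₂?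
    odd-combination (f , g) = kernel-combination (λ x → degree x ℙ.+ ρ x)
      (λ x y → ≡.trans (cong₂ ℙ._+_ (degree-∙ x y) (ρ-∙ x y)) (interchange (degree x) (degree y) (ρ x) (ρ y))) S₂?
      (λ {x} x∈ → coset-degree {x = x} (f x∈) , cong₂ ℙ._+_ (coset-degree {x = x} (f x∈)) (ρ≡1 {x} (coset-ρ {2 ∤_} {x} (f x∈))))
      (λ {x} x-odd x-χ → g (coset-intro x x-odd λ r s eq 2∣r → contradiction
        (≡.trans (≡.sym (cong₂ ℙ._+_ x-odd (≡.trans (cong ρ eq) (≡.trans (ρ-word r s) (2∣⇒parity 2∣r))))) x-χ) λ ()))
      where
      ρ≡1 : ∀ {x} → (∃ λ r → 2 ∤ r × ρ x ≡ parity r) → ρ x ≡ 1ℙ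
      ρ≡1 (r , 2∤r , eq) = ≡.trans eq (2∤⇒parity 2∤r)
      interchange : ∀ p q r s → p ℙ.+ q ℙ.+ (r ℙ.+ s) ≡ p ℙ.+ r ℙ.+ (q ℙ.+ s)
      interchange 0ℙ q 0ℙ s = refl
      interchange 0ℙ 0ℙ 1ℙ s = refl
      interchange 0ℙ 1ℙ 1ℙ 0ℙ = refl
      interchange 0ℙ 1ℙ 1ℙ 1ℙ = refl
      interchange 1ℙ 0ℙ 0ℙ s = refl
      interchange 1ℙ 0ℙ 1ℙ 0ℙ = refl
      interchange 1ℙ 0ℙ 1ℙ 1ℙ = refl
      interchange 1ℙ 1ℙ 0ℙ 0ℙ = refl
      interchange 1ℙ 1ℙ 0ℙ 1ℙ = refl
      interchange 1ℙ 1ℙ 1ℙ 0ℙ = refl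
      interchange 1ℙ 1ℙ 1ℙ 1ℙ = refl

  empty-combination : S₂ ≐ ∅ → IsCombination 𝕂 S₂?
  empty-combination (f , _) = ∅-combination 𝕂 S₂? (λ x x∈ → f x∈)

  S₂-combination : Condition₂ S₂ → IsCombination 𝕂 S₂?
  S₂-combination (odd-case , even-case) with 2 ∣? n
  ... | no 2∤n = [ empty-combination , all-combination ]′ (odd-case 2∤n)
  ... | yes 2∣n = [ empty-combination , [ even-combination 2∣n , [ odd-combination 2∣n , all-combination ]′ ]′ ]′ (even-case 2∣n)

  sufficient : Condition₁ S₁ → Condition₂ S₂ → Integral 𝕂 (Cay T₈ₙ (S₁ ∪ S₂) (S₁? ∪? S₂?) isConn)
  sufficient cond₁ cond₂ = integral-Cay 𝕂 (S₁ ∪ S₂) (S₁? ∪? S₂?) isConn (proj₁ combination) (proj₂ combination)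
    where
    combination : IsCombination 𝕂 (S₁? ∪? S₂?)
    combination = combination-∪ 𝕂 (S₁? ∪? S₂?) S₁? S₂? (λ x∈ → x∈) inj₁ inj₂
      (λ {x} x∈₁ x∈₂ → contradiction (≡.trans (≡.sym (S₁-even x x∈₁)) (S₂-odd x x∈₂)) λ ())
      (equigenerated-combination 𝕂 S₁? (λ {x} → S₁-even x) (Condition₁⇒closed cond₁)) (S₂-combination cond₂)

-- Characters of order 8 for odd n

private
  2∣m*m⇒2∣m : ∀ m → 2 ∣ m ℕ.* m → 2 ∣ m
  2∣m*m⇒2∣m m 2∣mm = [ (λ d → d) , (λ d → d) ]′ (euclidsLemma m m prime[2] 2∣mm)

-- Halving m twice leads to 2d² = n², against n odd.
m*m≢8*[n*n] : ∀ m n → 2 ∤ n → m ℕ.* m ≢ 8 ℕ.* (n ℕ.* n)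
m*m≢8*[n*n] m n 2∤n eq with 2∣m*m⇒2∣m m (≡.subst (2 ∣_) (≡.sym eq) (∣m⇒∣m*n (n ℕ.* n) (divides 4 refl)))
... | divides c refl with 2∣m*m⇒2∣m c (≡.subst (2 ∣_) (≡.sym cc≡) (m∣m*n (n ℕ.* n)))
  where
  lemma : ∀ c → c ℕ.* 2 ℕ.* (c ℕ.* 2) ≡ 4 ℕ.* (c ℕ.* c)
  lemma = ℕ-Solver.solve-∀
  lemma′ : ∀ k → 8 ℕ.* k ≡ 4 ℕ.* (2 ℕ.* k)
  lemma′ = ℕ-Solver.solve-∀
  cc≡ : c ℕ.* c ≡ 2 ℕ.* (n ℕ.* n)
  cc≡ = ℕ.*-cancelˡ-≡ (c ℕ.* c) (2 ℕ.* (n ℕ.* n)) 4 (≡.trans (≡.sym (lemma c)) (≡.trans eq (lemma′ (n ℕ.* n))))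
...   | divides d refl = 2∤n (2∣m*m⇒2∣m n (≡.subst (2 ∣_) dd≡ (m∣m*n (d ℕ.* d))))
  where
  lemma : ∀ d → d ℕ.* 2 ℕ.* 2 ℕ.* (d ℕ.* 2 ℕ.* 2) ≡ 8 ℕ.* (2 ℕ.* (d ℕ.* d))
  lemma = ℕ-Solver.solve-∀
  dd≡ : 2 ℕ.* (d ℕ.* d) ≡ n ℕ.* n
  dd≡ = ℕ.*-cancelˡ-≡ (2 ℕ.* (d ℕ.* d)) (n ℕ.* n) 8 (≡.trans (≡.sym (lemma d)) eq)

module ProductSums {c ℓ} (S : Semiring c ℓ) where
  open Semiring S hiding (zero) renaming (refl to ≈-refl; sym to ≈-sym; trans to ≈-trans)
  open SemiringSum S

  sum-↑ : ∀ k {m} (g : Fin (k ℕ.+ m) → Carrier) → sum g ≈ sum (λ i → g (i ↑ˡ m)) + sum (λ i → g (k ↑ʳ i))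
  sum-↑ zero    g = ≈-sym (+-identityˡ _)
  sum-↑ (suc k) g = ≈-trans (+-congˡ (sum-↑ k (g ∘ suc))) (≈-sym (+-assoc _ _ _))

  -- T₈ₙ is enumerated through `remQuot`; this turns a sum over the group into an iterated sum over
  -- the exponents of a and b.
  sum-remQuot : ∀ m k (g : Fin m × Fin k → Carrier) →
                sum (λ i → g (remQuot k i)) ≈ sum (λ i → sum (λ j → g (i , j)))
  sum-remQuot zero    k g = ≈-refl
  sum-remQuot (suc m) k g = ≈-trans (sum-↑ k {m ℕ.* k} (λ i → g (remQuot {suc m} k i)))
    (+-cong (sum-cong-≋ (λ j → reflexive (cong g (Fin.remQuot-combine {suc m} {k} zero j))))
      (≈-trans (sum-cong-≋ (λ i → reflexive (cong g (remQuot-↑ʳ i)))) (sum-remQuot m k (λ (i , j) → g (suc i , j)))))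
    where
    remQuot-↑ʳ : ∀ i → remQuot {suc m} k (k ↑ʳ i) ≡ map₁ suc (remQuot {m} k i)
    remQuot-↑ʳ i rewrite Fin.splitAt-↑ʳ k (m ℕ.* k) i = refl

module EighthRootCharacter {c ℓ₁ ℓ₂} (𝕂 : AlgebraicallyClosedField₀ c ℓ₁ ℓ₂) (n : ℕ) .{{_ : NonZero n}} (2∤n : 2 ∤ n)
  (S₁ S₂ : Pred (T₈.T n) 0ℓ) (S₁? : Decidable S₁) (S₂? : Decidable S₂)
  (isConn : FiniteGroup.IsConnectionSet (T₈.T₈ₙ n) (S₁ ∪ S₂))
  (S₁⊆ : S₁ ⊆ T₈.⟨a⟩∪⟨a⟩b² n) (S₂⊆ : S₂ ⊆ T₈.⟨a⟩b∪⟨a⟩b³ n)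
  (normal : IsNormalCayley (T₈.T₈ₙ n) (S₁ ∪ S₂))
  (integral : Integral 𝕂 (Cay (T₈.T₈ₙ n) (S₁ ∪ S₂) (S₁? ∪? S₂?) isConn)) where
  open T₈ n hiding (_^_)
  open T₈Words n
  open ConnectionSets n S₁ S₂ S₁? S₂? S₁⊆ S₂⊆
  open FiniteGroup T₈ₙ using (elements; identityˡ)
  open FiniteGroup.IsConnectionSet isConn using (inverseClosed)
  open FiniteGroupProperties T₈ₙ using (⁻¹-involutive)
  open Inverse elements using (to; from; strictlyInverseˡ)
  open AlgebraicallyClosedField₀ 𝕂 using (heytingField; characteristicZero; algebraicallyClosed)
  open HeytingFieldProperties heytingField hiding (ring)
  open GroupRing commutativeRing T₈ₙ hiding (_≋_)
  open SemiringSum semiring using (sum; sum-cong-≋)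
  open SemiringExp semiring using (_^_; ^-homo-*; ^-assocʳ; ^-congˡ)
  open Solver using (solve; con; _:+_; _:*_; _:-_; :-_; _:=_)
  open SetoidReasoning setoid

  f : A
  f x = ind ((S₁? ∪? S₂?) x)

  f-⁻¹ : ∀ x → f (x ⁻¹) ≡ f x
  f-⁻¹ x = ind-cong ((S₁? ∪? S₂?) (x ⁻¹)) ((S₁? ∪? S₂?) x) (proj₂ inverseClosed) (proj₁ inverseClosed)

  private
    n≡1+2k : ∃ λ k → n ≡ 1 ℕ.+ 2 ℕ.* k
    n≡1+2k with n ℕ.% 2 in eq | m%n<n n 2
    ... | 0 | _ = contradiction (m%n≡0⇒n∣m n 2 eq) 2∤n
    ... | 1 | _ = n ℕ./ 2 , ≡.trans (m≡m%n+[m/n]*n n 2) (≡.trans (cong (ℕ._+ n ℕ./ 2 ℕ.* 2) eq) (cong suc (ℕ.*-comm (n ℕ./ 2) 2)))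
    ... | suc (suc _) | ℕ.s≤s (ℕ.s≤s ())

    σ^-odd : ∀ s → ∃ λ k → σ ℕ.^ s ≡ 1 ℕ.+ 2 ℕ.* k
    σ^-odd zero    = 0 , refl
    σ^-odd (suc s) with σ^-odd s
    ... | k , eq = pred n ℕ.+ k ℕ.+ 2 ℕ.* (pred n ℕ.* k) , ≡.trans (cong₂ ℕ._*_ σ≡ eq) (lemma (pred n) k)
      where
      lemma : ∀ m k → suc (2 ℕ.* m) ℕ.* (1 ℕ.+ 2 ℕ.* k) ≡ 1 ℕ.+ 2 ℕ.* (m ℕ.+ k ℕ.+ 2 ℕ.* (m ℕ.* k))
      lemma = ℕ-Solver.solve-∀

  module Character (ζ : K) (ζ⁴≈-1 : ζ ^ 4 ≈ - 1#) where
    -- Modulo a² one has a = aⁿ = b⁴, as n is odd. The quotient is cyclic of order 8, generated by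
    -- b, so b ↦ ζ forces a ↦ ζ⁴.
    χ : A
    χ (r , s) = ζ ^ (toℕ s ℕ.+ toℕ r ℕ.* 4)

    ζ⁸≈1 : ζ ^ 8 ≈ 1#
    ζ⁸≈1 = begin
      ζ ^ 8            ≈⟨ ^-homo-* ζ 4 4 ⟩
      ζ ^ 4 * ζ ^ 4    ≈⟨ *-cong ζ⁴≈-1 ζ⁴≈-1 ⟩
      - 1# * - 1#      ≈⟨ solve 1 (λ x → :- x :* :- x := x :* x) ≈-refl 1# ⟩
      1# * 1#          ≈⟨ *-identityˡ 1# ⟩
      1#               ∎

    1^ : ∀ k → 1# ^ k ≈ 1#
    1^ zero    = ≈-refl
    1^ (suc k) = ≈-trans (*-identityˡ _) (1^ k)

    ζ^+8 : ∀ m k → ζ ^ (m ℕ.+ 8 ℕ.* k) ≈ ζ ^ m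
    ζ^+8 m k = begin
      ζ ^ (m ℕ.+ 8 ℕ.* k)      ≈⟨ ^-homo-* ζ m (8 ℕ.* k) ⟩
      ζ ^ m * ζ ^ (8 ℕ.* k)    ≈⟨ *-congˡ (≈-trans (≈-sym (^-assocʳ ζ 8 k)) (≈-trans (^-congˡ k ζ⁸≈1) (1^ k))) ⟩
      ζ ^ m * 1#               ≈⟨ *-identityʳ _ ⟩
      ζ ^ m                    ∎

    -- Normalising a word trades 4(q / 4) in the exponent of ζ for 4n(q / 4), and for odd n these
    -- agree modulo 8.
    χ-word : ∀ p q → χ (word p q) ≈ ζ ^ (q ℕ.+ p ℕ.* 4)
    χ-word p q = begin
      ζ ^ (toℕ (q mod 4) ℕ.+ toℕ (m mod (2 ℕ.* n)) ℕ.* 4)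
        ≡⟨ cong₂ (λ s r → ζ ^ (s ℕ.+ r ℕ.* 4)) (toℕ-mod q 4) (toℕ-mod m (2 ℕ.* n)) ⟩
      ζ ^ (q ℕ.% 4 ℕ.+ m ℕ.% (2 ℕ.* n) ℕ.* 4)
        ≈⟨ ζ^+8 (q ℕ.% 4 ℕ.+ m ℕ.% (2 ℕ.* n) ℕ.* 4) (m ℕ./ (2 ℕ.* n) ℕ.* n) ⟨
      ζ ^ (q ℕ.% 4 ℕ.+ m ℕ.% (2 ℕ.* n) ℕ.* 4 ℕ.+ 8 ℕ.* (m ℕ./ (2 ℕ.* n) ℕ.* n))
        ≡⟨ cong (ζ ^_) (≡.trans (lemma (q ℕ.% 4) (m ℕ.% (2 ℕ.* n)) (m ℕ./ (2 ℕ.* n)) n) (cong (λ m → q ℕ.% 4 ℕ.+ m ℕ.* 4) (≡.sym (m≡m%n+[m/n]*n m (2 ℕ.* n))))) ⟩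
      ζ ^ (q ℕ.% 4 ℕ.+ (p ℕ.+ n ℕ.* (q ℕ./ 4)) ℕ.* 4)
        ≡⟨ cong (λ n → ζ ^ (q ℕ.% 4 ℕ.+ (p ℕ.+ n ℕ.* (q ℕ./ 4)) ℕ.* 4)) (proj₂ n≡1+2k) ⟩
      ζ ^ (q ℕ.% 4 ℕ.+ (p ℕ.+ (1 ℕ.+ 2 ℕ.* k) ℕ.* (q ℕ./ 4)) ℕ.* 4)
        ≡⟨ cong (ζ ^_) (≡.trans (lemma′ (q ℕ.% 4) p k (q ℕ./ 4)) (cong (λ q′ → q′ ℕ.+ p ℕ.* 4 ℕ.+ 8 ℕ.* (k ℕ.* (q ℕ./ 4))) (≡.sym (m≡m%n+[m/n]*n q 4)))) ⟩
      ζ ^ (q ℕ.+ p ℕ.* 4 ℕ.+ 8 ℕ.* (k ℕ.* (q ℕ./ 4)))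
        ≈⟨ ζ^+8 (q ℕ.+ p ℕ.* 4) (k ℕ.* (q ℕ./ 4)) ⟩
      ζ ^ (q ℕ.+ p ℕ.* 4) ∎
      where
      m = p ℕ.+ n ℕ.* (q ℕ./ 4)
      k = proj₁ n≡1+2k
      lemma : ∀ s x y n → s ℕ.+ x ℕ.* 4 ℕ.+ 8 ℕ.* (y ℕ.* n) ≡ s ℕ.+ (x ℕ.+ y ℕ.* (2 ℕ.* n)) ℕ.* 4
      lemma = ℕ-Solver.solve-∀
      lemma′ : ∀ s p k d → s ℕ.+ (p ℕ.+ (1 ℕ.+ 2 ℕ.* k) ℕ.* d) ℕ.* 4 ≡ s ℕ.+ d ℕ.* 4 ℕ.+ p ℕ.* 4 ℕ.+ 8 ℕ.* (k ℕ.* d)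
      lemma′ = ℕ-Solver.solve-∀

    χ-∙ : ∀ x y → χ (x ∙ y) ≈ χ x * χ y
    χ-∙ (r , s) (r′ , s′) = begin
      χ (word (toℕ r ℕ.+ σ ℕ.^ toℕ s ℕ.* toℕ r′) (toℕ s ℕ.+ toℕ s′))
        ≈⟨ χ-word (toℕ r ℕ.+ σ ℕ.^ toℕ s ℕ.* toℕ r′) (toℕ s ℕ.+ toℕ s′) ⟩
      ζ ^ (toℕ s ℕ.+ toℕ s′ ℕ.+ (toℕ r ℕ.+ σ ℕ.^ toℕ s ℕ.* toℕ r′) ℕ.* 4)
        ≡⟨ cong (ζ ^_) (≡.trans (cong (λ t → toℕ s ℕ.+ toℕ s′ ℕ.+ (toℕ r ℕ.+ t ℕ.* toℕ r′) ℕ.* 4) (proj₂ (σ^-odd (toℕ s)))) (lemma (toℕ s) (toℕ s′) (toℕ r) k (toℕ r′))) ⟩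
      ζ ^ (toℕ s ℕ.+ toℕ r ℕ.* 4 ℕ.+ (toℕ s′ ℕ.+ toℕ r′ ℕ.* 4) ℕ.+ 8 ℕ.* (k ℕ.* toℕ r′))
        ≈⟨ ζ^+8 (toℕ s ℕ.+ toℕ r ℕ.* 4 ℕ.+ (toℕ s′ ℕ.+ toℕ r′ ℕ.* 4)) (k ℕ.* toℕ r′) ⟩
      ζ ^ (toℕ s ℕ.+ toℕ r ℕ.* 4 ℕ.+ (toℕ s′ ℕ.+ toℕ r′ ℕ.* 4))
        ≈⟨ ^-homo-* ζ (toℕ s ℕ.+ toℕ r ℕ.* 4) (toℕ s′ ℕ.+ toℕ r′ ℕ.* 4) ⟩
      χ (r , s) * χ (r′ , s′) ∎
      where
      k = proj₁ (σ^-odd (toℕ s))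
      lemma : ∀ s s′ r k r′ → s ℕ.+ s′ ℕ.+ (r ℕ.+ (1 ℕ.+ 2 ℕ.* k) ℕ.* r′) ℕ.* 4 ≡ s ℕ.+ r ℕ.* 4 ℕ.+ (s′ ℕ.+ r′ ℕ.* 4) ℕ.+ 8 ℕ.* (k ℕ.* r′)
      lemma = ℕ-Solver.solve-∀

    χ-ε : χ ε ≈ 1#
    χ-ε = χ-word 0 0

    eigenvalue : K
    eigenvalue = ∑ (λ y → f y * χ (y ⁻¹))

    f⋆χ : ∀ x → (f ⋆ χ) x ≈ eigenvalue * χ x
    f⋆χ x = begin
      (f ⋆ χ) x                         ≈⟨ ⋆-flip f χ x ⟩
      ∑ (λ y → f y * χ (y ⁻¹ ∙ x))      ≈⟨ ∑-cong (λ y → ≈-trans (*-congˡ (χ-∙ (y ⁻¹) x)) (≈-sym (*-assoc _ _ _))) ⟩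
      ∑ (λ y → f y * χ (y ⁻¹) * χ x)    ≈⟨ ∑-*ʳ (χ x) (λ y → f y * χ (y ⁻¹)) ⟨
      eigenvalue * χ x                  ∎

    eigenvalue≈ : eigenvalue ≈ ∑ (λ y → f y * χ y)
    eigenvalue≈ = ≈-trans (∑-reindex _⁻¹ _⁻¹ ⁻¹-involutive ⁻¹-involutive (λ y → f y * χ (y ⁻¹)))
      (∑-cong (λ y → *-cong (reflexive (f-⁻¹ y)) (reflexive (cong χ (⁻¹-involutive y)))))

    integer-eigenvalue : ∃ λ z → eigenvalue ≈ fromℤ z
    integer-eigenvalue = integral eigenvalue (χ ∘ to , (from ε , nonzero) , λ i →
      ≈-trans (reflexive (≡.sym (∑-def (λ y → f (to i ∙ y ⁻¹) * χ y)))) (f⋆χ (to i)))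
      where
      nonzero : χ (to (from ε)) # 0#
      nonzero = #-congʳ (≈-sym (≈-trans (reflexive (cong χ (strictlyInverseˡ ε))) χ-ε)) 1#0

  private
    ζ-exists : ∃ λ ζ → ζ ^ 4 ≈ - 1#
    ζ-exists = proj₁ root , (begin
      proj₁ root ^ 4                     ≈⟨ solve 2 (λ a b → a := a :+ (b :+ (con (+ 0) :* b :+ (con (+ 0) :* b :+ (con (+ 0) :* b :+ con (+ 0))))) :- b) ≈-refl (proj₁ root ^ 4) 1# ⟩
      proj₁ root ^ 4 + (1# + (0# * 1# + (0# * 1# + (0# * 1# + 0#)))) - 1#  ≈⟨ +-congʳ (≈-trans (+-congˡ (+-cong (≈-sym (*-identityˡ 1#))
        (+-cong (zeros _) (+-cong (zeros _) (+-congʳ (zeros _)))))) (proj₂ root)) ⟩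
      0# - 1#                            ≈⟨ +-identityˡ _ ⟩
      - 1#                               ∎)
      where
      p : Fin 4 → K
      p zero    = 1#
      p (suc _) = 0#
      root = algebraicallyClosed 3 p
      zeros : ∀ x → 0# * 1# ≈ 0# * x
      zeros x = ≈-trans (zeroˡ 1#) (≈-sym (zeroˡ x))

    ζ : K
    ζ = proj₁ ζ-exists

    ζ⁴≈-1 : ζ ^ 4 ≈ - 1#
    ζ⁴≈-1 = proj₂ ζ-exists

    [-ζ]⁴≈-1 : (- ζ) ^ 4 ≈ - 1#
    [-ζ]⁴≈-1 = ≈-trans (solve 2 (λ z o → (:- z) :* ((:- z) :* ((:- z) :* ((:- z) :* o))) := z :* (z :* (z :* (z :* o)))) ≈-refl ζ 1#) ζ⁴≈-1

    module χ₊ = Character ζ ζ⁴≈-1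
    module χ₋ = Character (- ζ) [-ζ]⁴≈-1

    sign : Parity → K
    sign 0ℙ = 1#
    sign 1ℙ = - 1#

    ^4i : ∀ x → x ^ 4 ≈ - 1# → ∀ i → x ^ (i ℕ.* 4) ≈ sign (parity i)
    ^4i x x⁴ zero          = ≈-refl
    ^4i x x⁴ (suc zero)    = x⁴
    ^4i x x⁴ (suc (suc i)) = begin
      x ^ (8 ℕ.+ i ℕ.* 4)           ≈⟨ ^-homo-* x 8 (i ℕ.* 4) ⟩
      x ^ 8 * x ^ (i ℕ.* 4)         ≈⟨ *-cong (Character.ζ⁸≈1 x x⁴) (^4i x x⁴ i) ⟩
      1# * sign (parity i)          ≈⟨ *-identityˡ _ ⟩
      sign (parity i)               ∎

    q : Parity → K
    q 0ℙ = ind (Q? isConn normal 0)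
    q 1ℙ = ind (Q? isConn normal 1)

    indicator-Q : ∀ r → ind (Q? isConn normal r) ≡ q (parity r)
    indicator-Q r = cases (Q-parity isConn normal r)
      where
      cases : _ → ind (Q? isConn normal r) ≡ q (parity r)
      cases (inj₁ (2∣r , e)) = ≡.trans (ind-cong (Q? isConn normal r) (Q? isConn normal 0) (Equivalence.to e) (Equivalence.from e)) (cong q (≡.sym (2∣⇒parity 2∣r)))
      cases (inj₂ (2∤r , e)) = ≡.trans (ind-cong (Q? isConn normal r) (Q? isConn normal 1) (Equivalence.to e) (Equivalence.from e)) (cong q (≡.sym (2∤⇒parity 2∤r)))

    f-b : ∀ (i : Fin (2 ℕ.* n)) → f (i , 1F) ≡ q (parity (toℕ i))
    f-b i = ≡.trans (ind-cong ((S₁? ∪? S₂?) (i , 1F)) (Q? isConn normal (toℕ i))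
      (λ s → ≡.subst S₂ (≡.sym (word-normal i 1F)) (odd⇒S₂ refl s)) (λ s → inj₂ (≡.subst S₂ (word-normal i 1F) s))) (indicator-Q (toℕ i))

    f-b³ : ∀ (i : Fin (2 ℕ.* n)) → f (i , 3F) ≡ q (parity (toℕ i) ℙ.+ 1ℙ)
    f-b³ i = ≡.trans (ind-cong ((S₁? ∪? S₂?) (i , 3F)) (Q? isConn normal (toℕ i ℕ.+ n))
      (λ s → Equivalence.to (b³⇔Q+n isConn normal (toℕ i)) (≡.subst S₂ (≡.sym (word-normal i 3F)) (odd⇒S₂ refl s)))
      (λ s → inj₂ (≡.subst S₂ (word-normal i 3F) (Equivalence.from (b³⇔Q+n isConn normal (toℕ i)) s))))
      (≡.trans (indicator-Q (toℕ i ℕ.+ n)) (cong q (≡.trans (ℙ.+-homo-+ (toℕ i) n) (cong (parity (toℕ i) ℙ.+_) (2∤⇒parity 2∤n)))))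

    -- The characters for ζ and -ζ agree on even elements and are opposite on odd ones, so S₁ drops
    -- out and S₂ is counted twice.
    difference : A
    difference y = f y * χ₊.χ y - f y * χ₋.χ y

    -- The contribution of all aʳbˢ with r of parity p. The sign is ζ^(4r), and the second argument
    -- p + 1 comes from the shift by the odd number n in `b³⇔Q+n`. The two rows add up to 2(q 0 - q
    -- 1)(ζ - ζ³).
    row : Parity → K
    row p = (1# + 1#) * (sign p * (q p * ζ + q (p ℙ.+ 1ℙ) * ζ ^ 3))

    row≈ : ∀ i → sum (λ s → difference (i , s)) ≈ row (parity (toℕ i))
    row≈ i = begin
      difference (i , 0F) + (difference (i , 1F) + (difference (i , 2F) + (difference (i , 3F) + 0#)))
        ≈⟨ +-cong (term 0F) (+-cong (term 1F) (+-cong (term 2F) (+-congʳ (term 3F)))) ⟩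
      g 0F + (g 1F + (g 2F + (g 3F + 0#)))
        ≈⟨ solve 7 (λ f₀ f₁ f₂ f₃ u z o →
             f₀ :* (o :* u) :- f₀ :* (o :* u) :+ (f₁ :* (z :* o :* u) :- f₁ :* ((:- z) :* o :* u) :+
             (f₂ :* (z :* (z :* o) :* u) :- f₂ :* ((:- z) :* ((:- z) :* o) :* u) :+
             (f₃ :* (z :* (z :* (z :* o)) :* u) :- f₃ :* ((:- z) :* ((:- z) :* ((:- z) :* o)) :* u) :+ con (+ 0))))
             := (f₁ :* (z :* o) :+ f₃ :* (z :* (z :* (z :* o)))) :* u :+ (f₁ :* (z :* o) :+ f₃ :* (z :* (z :* (z :* o)))) :* u)
             ≈-refl (f (i , 0F)) (f (i , 1F)) (f (i , 2F)) (f (i , 3F)) u ζ 1# ⟩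
      (f (i , 1F) * (ζ * 1#) + f (i , 3F) * ζ ^ 3) * u + (f (i , 1F) * (ζ * 1#) + f (i , 3F) * ζ ^ 3) * u
        ≈⟨ +-cong simplify simplify ⟩
      u * t + u * t
        ≈⟨ +-cong (*-identityˡ _) (*-identityˡ _) ⟨
      1# * (u * t) + 1# * (u * t)
        ≈⟨ distribʳ _ _ _ ⟨
      row (parity (toℕ i)) ∎
      where
      p = parity (toℕ i)
      u = sign p
      t = q p * ζ + q (p ℙ.+ 1ℙ) * ζ ^ 3
      g : Fin 4 → K
      g s = f (i , s) * (ζ ^ toℕ s * u) - f (i , s) * ((- ζ) ^ toℕ s * u)
      term : ∀ s → difference (i , s) ≈ g s
      term s = +-cong (*-congˡ (≈-trans (^-homo-* ζ (toℕ s) (toℕ i ℕ.* 4)) (*-congˡ (^4i ζ ζ⁴≈-1 (toℕ i)))))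
        (-‿cong (*-congˡ (≈-trans (^-homo-* (- ζ) (toℕ s) (toℕ i ℕ.* 4)) (*-congˡ (^4i (- ζ) [-ζ]⁴≈-1 (toℕ i))))))
      simplify : (f (i , 1F) * (ζ * 1#) + f (i , 3F) * ζ ^ 3) * u ≈ u * t
      simplify = ≈-trans (*-congʳ (+-cong (*-cong (reflexive (f-b i)) (*-identityʳ ζ)) (*-congʳ (reflexive (f-b³ i))))) (*-comm _ _)

    sum-parity : ∀ (g : Parity → K) m → sum {m ℕ.* 2} (λ i → g (parity (toℕ i))) ≈ fromℤ (+ m) * (g 0ℙ + g 1ℙ)
    sum-parity g zero    = ≈-sym (zeroˡ _)
    sum-parity g (suc m) = begin
      g 0ℙ + (g 1ℙ + sum {m ℕ.* 2} (λ i → g (parity (toℕ i))))  ≈⟨ +-assoc _ _ _ ⟨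
      g 0ℙ + g 1ℙ + sum {m ℕ.* 2} (λ i → g (parity (toℕ i)))    ≈⟨ +-cong (≈-sym (*-identityˡ _)) (sum-parity g m) ⟩
      1# * (g 0ℙ + g 1ℙ) + fromℤ (+ m) * (g 0ℙ + g 1ℙ)          ≈⟨ distribʳ _ _ _ ⟨
      fromℤ (+ suc m) * (g 0ℙ + g 1ℙ)                           ∎

    ∑-difference : ∑ difference ≈ fromℤ (+ n) * (row 0ℙ + row 1ℙ)
    ∑-difference = begin
      ∑ difference                                              ≈⟨ reflexive (∑-def difference) ⟩
      sum (λ i → difference (remQuot {2 ℕ.* n} 4 i))            ≈⟨ ProductSums.sum-remQuot semiring (2 ℕ.* n) 4 difference ⟩
      sum (λ i → sum (λ s → difference (i , s)))                ≈⟨ sum-cong-≋ row≈ ⟩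
      sum {2 ℕ.* n} (λ i → row (parity (toℕ i)))                ≈⟨ ≡.subst (λ m → sum {m} (λ i → row (parity (toℕ i))) ≈ fromℤ (+ n) * (row 0ℙ + row 1ℙ)) (ℕ.*-comm n 2) (sum-parity row n) ⟩
      fromℤ (+ n) * (row 0ℙ + row 1ℙ)                           ∎

    -- (ζ − ζ³)² = ζ² − 2ζ⁴ + ζ⁶ = 2.
    rows² : (q 0ℙ - q 1ℙ) * (q 0ℙ - q 1ℙ) ≈ 1# → (row 0ℙ + row 1ℙ) * (row 0ℙ + row 1ℙ) ≈ fromℤ (+ 8)
    rows² d²≈1 = begin
      (row 0ℙ + row 1ℙ) * (row 0ℙ + row 1ℙ)
        ≈⟨ solve 4 (λ o q₀ q₁ z →
             let d = (q₀ :- q₁) :* (q₀ :- q₁)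
                 r₀ = (o :+ o) :* (o :* (q₀ :* z :+ q₁ :* (z :* (z :* (z :* o)))))
                 r₁ = (o :+ o) :* ((:- o) :* (q₁ :* z :+ q₀ :* (z :* (z :* (z :* o)))))
                 z⁴ = z :* (z :* (z :* (z :* o)))
             in (r₀ :+ r₁) :* (r₀ :+ r₁) := con (+ 4) :* (o :* o :* o :* o) :* d :* (z :* z :- con (+ 2) :* z⁴ :+ z⁴ :* (z :* z :* o)))
             ≈-refl 1# (q 0ℙ) (q 1ℙ) ζ ⟩
      fromℤ (+ 4) * (1# * 1# * 1# * 1#) * ((q 0ℙ - q 1ℙ) * (q 0ℙ - q 1ℙ)) * (ζ * ζ - fromℤ (+ 2) * ζ ^ 4 + ζ ^ 4 * (ζ * ζ * 1#))
        ≈⟨ *-cong (*-cong (*-congˡ 1⁴≈1) d²≈1) (+-cong (+-congˡ (-‿cong (*-congˡ (≈-trans ζ⁴≈-1 -1≈)))) (*-cong (≈-trans ζ⁴≈-1 -1≈) (*-congˡ (≈-sym fromℤ-1)))) ⟩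
      fromℤ (+ 4) * 1# * 1# * (ζ * ζ - fromℤ (+ 2) * fromℤ (ℤ.- + 1) + fromℤ (ℤ.- + 1) * (ζ * ζ * fromℤ (+ 1)))
        ≈⟨ *-congʳ (≈-trans (*-identityʳ _) (*-identityʳ _)) ⟩
      fromℤ (+ 4) * (ζ * ζ - fromℤ (+ 2) * fromℤ (ℤ.- + 1) + fromℤ (ℤ.- + 1) * (ζ * ζ * fromℤ (+ 1)))
        ≈⟨ solve 1 (λ z → con (+ 4) :* (z :* z :- con (+ 2) :* con (ℤ.- + 1) :+ con (ℤ.- + 1) :* (z :* z :* con (+ 1))) := con (+ 8)) ≈-refl ζ ⟩
      fromℤ (+ 8) ∎
      where
      1⁴≈1 : 1# * 1# * 1# * 1# ≈ 1#
      1⁴≈1 = ≈-trans (*-identityʳ _) (≈-trans (*-identityʳ _) (*-identityʳ _))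
      -1≈ : - 1# ≈ fromℤ (ℤ.- + 1)
      -1≈ = -‿cong (≈-sym fromℤ-1)

    z₊ z₋ : ℤ
    z₊ = proj₁ χ₊.integer-eigenvalue
    z₋ = proj₁ χ₋.integer-eigenvalue

    fromℤ-z : fromℤ (z₊ ℤ.- z₋) ≈ fromℤ (+ n) * (row 0ℙ + row 1ℙ)
    fromℤ-z = begin
      fromℤ (z₊ ℤ.- z₋)                         ≈⟨ ≈-trans (fromℤ-+ z₊ (ℤ.- z₋)) (+-congˡ (fromℤ-neg z₋)) ⟩
      fromℤ z₊ - fromℤ z₋                       ≈⟨ +-cong (proj₂ χ₊.integer-eigenvalue) (-‿cong (proj₂ χ₋.integer-eigenvalue)) ⟨
      χ₊.eigenvalue - χ₋.eigenvalue             ≈⟨ +-cong χ₊.eigenvalue≈ (-‿cong χ₋.eigenvalue≈) ⟩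
      ∑ (λ y → f y * χ₊.χ y) - ∑ (λ y → f y * χ₋.χ y)
        ≈⟨ +-congˡ (≈-trans (≈-sym (-1* _)) (≈-trans (∑-* (- 1#) (λ y → f y * χ₋.χ y)) (∑-cong (λ y → -1* (f y * χ₋.χ y))))) ⟩
      ∑ (λ y → f y * χ₊.χ y) + ∑ (λ y → - (f y * χ₋.χ y))
        ≈⟨ ∑-+ (λ y → f y * χ₊.χ y) (λ y → - (f y * χ₋.χ y)) ⟨
      ∑ difference                              ≈⟨ ∑-difference ⟩
      fromℤ (+ n) * (row 0ℙ + row 1ℙ)           ∎
      where
      -1* : ∀ x → - 1# * x ≈ - x
      -1* x = ≈-trans (≈-sym (-‿distribˡ-* 1# x)) (-‿cong (*-identityˡ x))

    -- Squaring treats both excluded cases q 0 - q 1 = ±1 at once, and replaces ζ - ζ³ by the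
    -- integer 2.
    no-difference : ¬ ((q 0ℙ - q 1ℙ) * (q 0ℙ - q 1ℙ) ≈ 1#)
    no-difference d²≈1 = m*m≢8*[n*n] ℤ.∣ z ∣ n 2∤n ∣z∣²≡
      where
      z = z₊ ℤ.- z₋
      z²≡ : z ℤ.* z ≡ + 8 ℤ.* (+ n ℤ.* + n)
      z²≡ = fromℤ-injective characteristicZero _ _ (begin
        fromℤ (z ℤ.* z)                         ≈⟨ fromℤ-* z z ⟩
        fromℤ z * fromℤ z                       ≈⟨ *-cong fromℤ-z fromℤ-z ⟩
        fromℤ (+ n) * R * (fromℤ (+ n) * R)     ≈⟨ solve 2 (λ n r → n :* r :* (n :* r) := r :* r :* (n :* n)) ≈-refl (fromℤ (+ n)) R ⟩
        R * R * (fromℤ (+ n) * fromℤ (+ n))     ≈⟨ *-cong (rows² d²≈1) (≈-sym (fromℤ-* (+ n) (+ n))) ⟩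
        fromℤ (+ 8) * fromℤ (+ n ℤ.* + n)       ≈⟨ fromℤ-* (+ 8) (+ n ℤ.* + n) ⟨
        fromℤ (+ 8 ℤ.* (+ n ℤ.* + n))           ∎)
        where R = row 0ℙ + row 1ℙ
      ∣z∣²≡ : ℤ.∣ z ∣ ℕ.* ℤ.∣ z ∣ ≡ 8 ℕ.* (n ℕ.* n)
      ∣z∣²≡ = ≡.trans (≡.sym (ℤ.abs-* z z)) (≡.trans (cong ℤ.∣_∣ z²≡) (≡.trans (ℤ.abs-* (+ 8) (+ n ℤ.* + n)) (cong (8 ℕ.*_) (ℤ.abs-* (+ n) (+ n)))))

  Q0⇔Q1 : Q isConn normal 0 ⇔ Q isConn normal 1
  Q0⇔Q1 = cases (Q? isConn normal 0) (Q? isConn normal 1) no-difference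
    where
    cases : (d : Dec (Q isConn normal 0)) (e : Dec (Q isConn normal 1)) → ¬ ((ind d - ind e) * (ind d - ind e) ≈ 1#) → Q isConn normal 0 ⇔ Q isConn normal 1
    cases (yes q₀) (yes q₁) _ = mk⇔ (λ _ → q₁) (λ _ → q₀)
    cases (no ¬q₀) (no ¬q₁) _ = mk⇔ (λ q₀ → contradiction q₀ ¬q₀) (λ q₁ → contradiction q₁ ¬q₁)
    cases (yes q₀) (no ¬q₁) h = contradiction (≈-trans (*-cong (x-0≈x 1#) (x-0≈x 1#)) (*-identityˡ 1#)) h
    cases (no ¬q₀) (yes q₁) h = contradiction (≈-trans (*-cong (+-identityˡ _) (+-identityˡ _))
      (≈-trans (solve 1 (λ x → :- x :* :- x := x :* x) ≈-refl 1#) (*-identityˡ 1#))) h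

theorem5p1 : ∀ {c ℓ₁ ℓ₂} (K : AlgebraicallyClosedField₀ c ℓ₁ ℓ₂) →
    ∀ (n : ℕ) .{{_ : NonZero n}} → let open T₈ n in
    ∀ (S₁ S₂ : Pred T 0ℓ) (S₁? : Decidable S₁) (S₂? : Decidable S₂) →
    (isConn : FiniteGroup.IsConnectionSet T₈ₙ (S₁ ∪ S₂)) →
    S₁ ⊆ ⟨a⟩∪⟨a⟩b² →
    S₂ ⊆ ⟨a⟩b∪⟨a⟩b³ →
    IsNormalCayley T₈ₙ (S₁ ∪ S₂) →
    Integral K (Cay T₈ₙ (S₁ ∪ S₂) (S₁? ∪? S₂?) isConn) ⇔ (Condition₁ S₁ × Condition₂ S₂)
theorem5p1 K n S₁ S₂ S₁? S₂? isConn S₁⊆ S₂⊆ normal = mk⇔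
  (λ integral → closed⇒Condition₁ (Necessity.S₁-closed K n S₁ S₂ S₁? S₂? isConn S₁⊆ S₂⊆ normal integral) ,
    (λ 2∤n → condition₂-odd isConn normal
      (EighthRootCharacter.Q0⇔Q1 K n 2∤n S₁ S₂ S₁? S₂? isConn S₁⊆ S₂⊆ normal integral)) ,
    condition₂-even isConn normal)
  (λ (cond₁ , cond₂) → Sufficiency.sufficient K n S₁ S₂ S₁? S₂? isConn S₁⊆ S₂⊆ cond₁ cond₂)
  where open ConnectionSets n S₁ S₂ S₁? S₂? S₁⊆ S₂⊆
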